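{- Consider the $n$-simplex $\alpha_n$ (rank $n$), the $n$-dimensional cross-polytope $\beta_n$ (rank $n$), the $24$-cell (rank $4$), the icosahedron (rank $3$) and the $600$-cell (rank $4$). For every permutation $\delta$ and every flag, the length of the corresponding generalized zigzag in each of these polytopes equals the corresponding Coxeter number, namely $$h(\mathsf A_n)=n+1,\quad h(\mathsf B_n)=2n,\quad h(\mathsf F_4)=12,\quad h(\mathsf H_3)=10,\quad h(\mathsf H_4)=30,$$ respectively.
   Context: An abstract polytope of rank $n$ has $k$-faces for $k=-1,0,\dots,n$, with unique $(-1)$-face and $n$-face; here the polytopes are the face lattices of the named regular convex polytopes. As simplicial complexes of boundary faces: $\alpha_n$ has vertex set $\{1,\dots,n+1\}$ and its faces are all proper subsets of it; $\beta_n$ has vertex set $\{\pm1,\dots,\pm n\}$ and its faces are the subsets containing no pair $\{i,-i\}$. A flag $F$ is a maximal chain $X_0<X_1<\dots<X_{n-1}$ with $X_i$ an $i$-face (the $(-1)$-face and $n$-face are disregarded). For $i\in\{0,\dots,n-1\}$, $\sigma_i(F)$ is the unique flag differing from $F$ precisely in its $i$-face. For a permutation $\delta$ of $\{0,\dots,n-1\}$ put $T_\delta=\sigma_{\delta(n-1)}\cdots\sigma_{\delta(1)}\sigma_{\delta(0)}$. The sequence $\{T_\delta^i(F)\}_{i\in\mathbb N}$ is a generalized zigzag, and its length is the smallest $l>0$ such that $T_\delta^l(F)=F$. The Coxeter number of a finite Coxeter system $(W,S)$ with $S=\{s_1,\dots,s_n\}$ is the order $h$ of an element $s_{\delta(1)}\cdots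 s_{\delta(n)}$, $\delta$ any permutation of $\{1,\dots,n\}$ (it does not depend on $\delta$). -}

module Defs where

open import Algebra.Bundles using (Group)
import Algebra.Definitions.RawMonoid as Multiples
open import Data.Bool.Base using (if_then_else_)
open import Data.Fin.Base using (Fin; toℕ; _↑ˡ_; _↑ʳ_) renaming (_<_ to _<ᶠ_)
open import Data.Fin.Permutation using (Permutation′; _⟨$⟩ʳ_)
open import Data.Fin.Subset using (Subset; _∈_; _⊆_; _⊂_; ⊤; ⊥)
open import Data.Integer.Base using (ℤ; +_; -[1+_]; 0ℤ; 1ℤ; -1ℤ)
  renaming (_+_ to _+ℤ_; _-_ to _-ℤ_; _*_ to _*ℤ_; -_ to -ℤ_; _≤_ to _≤ℤ_; ∣_∣ to ∣_∣ℤ)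
open import Data.List.Base using (List; []; _∷_; _++_; length; lookup; foldl; foldr; map; concatMap; allFin)
open import Data.Nat.Base using (ℕ; zero; suc; _+_; _≤_; _<_; _⊓_; ∣_-_∣; _≡ᵇ_)
open import Data.Nat.GeneralisedArithmetic using (iterate)
open import Data.Product using (_×_; _,_; Σ-syntax; ∃-syntax; ∃!; proj₁)
open import Data.Sum.Base using (_⊎_)
open import Data.Vec.Base as Vec using (Vec; []; _∷_)
open import Function.Bundles using (_⇔_)
open import Level using (0ℓ)
open import Relation.Binary.PropositionalEquality.Core using (_≡_; _≢_)
open import Relation.Nullary.Negation.Core using (¬_)

IsLeastPositive : ∀ {ℓ} → (ℕ → Set ℓ) → ℕ → Set ℓ
IsLeastPositive P l = 0 < l × P l × (∀ k → 0 < k → P k → l ≤ k)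

-- The faces of a rank n polytope other than its greatest face, each given by
-- its set of vertices and ordered by inclusion.  The least face is ⊥, the
-- empty vertex set.

record FaceComplex (n : ℕ) : Set₁ where
  field
    #vertices : ℕ
    IsFace    : Subset #vertices → Set

module _ {n : ℕ} (P : FaceComplex n) where
  open FaceComplex P

  Covers : Subset #vertices → Subset #vertices → Set
  Covers Y X = X ⊂ Y × (∀ Z → IsFace Z → X ⊂ Z → ¬ (Z ⊂ Y))

  IsFaceOfRank : ℕ → Subset #vertices → Set
  IsFaceOfRank zero    Y = IsFace Y × Covers Y ⊥
  IsFaceOfRank (suc k) Y = IsFace Y × (∃[ X ] IsFaceOfRank k X × Covers Y X)

  record Flag : Set where
    field
      face    : Fin n → Subset #vertices
      ranked  : ∀ i → IsFaceOfRank (toℕ i) (face i)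
      chain   : ∀ {i j} → i <ᶠ j → face i ⊂ face j
      maximal : ∀ Z → IsFace Z → (∀ i → Z ⊆ face i ⊎ face i ⊆ Z) →
                Z ≡ ⊥ ⊎ (∃[ i ] Z ≡ face i)

  open Flag

  -- Flags carry proofs, so they are compared by their faces only.
  _≈ᶠ_ : Flag → Flag → Set
  F ≈ᶠ G = ∀ i → face F i ≡ face G i

  DifferPreciselyAt : Fin n → Flag → Flag → Set
  DifferPreciselyAt i F G = face F i ≢ face G i × (∀ j → j ≢ i → face F j ≡ face G j)

  UniqueAdjacentFlags : Set
  UniqueAdjacentFlags = ∀ i F → ∃! _≈ᶠ_ (DifferPreciselyAt i F)

  module Zigzag (adjacent : UniqueAdjacentFlags) where

    σ : Fin n → Flag → Flag
    σ i F = proj₁ (adjacent i F)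

    -- σ (δ 0) is applied first and σ (δ (n - 1)) last.
    T : Permutation′ n → Flag → Flag
    T δ F = foldl (λ G k → σ (δ ⟨$⟩ʳ k) G) F (allFin n)

    IsZigzagLength : Permutation′ n → Flag → ℕ → Set
    IsZigzagLength δ F = IsLeastPositive (λ l → iterate (T δ) F l ≈ᶠ F)

CoxeterMatrix : ℕ → Set
CoxeterMatrix n = Fin n → Fin n → ℕ

-- The group presented by generators sᵢ and relations (sᵢ sⱼ)^(m i j) = 1,
-- as formal group terms modulo the congruence generated by the group axioms
-- and the relations.

module _ {n : ℕ} (m : CoxeterMatrix n) where

  infixl 7 _∙_
  infix  8 _⁻¹
  infix  4 _≈_

  data Term : Set where
    s   : Fin n → Term
    ε   : Term
    _∙_ : Term → Term → Term
    _⁻¹ : Term → Term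

  termPower : ℕ → Term → Term
  termPower zero    x = ε
  termPower (suc k) x = x ∙ termPower k x

  data _≈_ : Term → Term → Set where
    refl      : ∀ {x} → x ≈ x
    sym       : ∀ {x y} → x ≈ y → y ≈ x
    trans     : ∀ {x y z} → x ≈ y → y ≈ z → x ≈ z
    ∙-cong    : ∀ {x y u v} → x ≈ y → u ≈ v → x ∙ u ≈ y ∙ v
    ⁻¹-cong   : ∀ {x y} → x ≈ y → x ⁻¹ ≈ y ⁻¹
    assoc     : ∀ x y z → (x ∙ y) ∙ z ≈ x ∙ (y ∙ z)
    identityˡ : ∀ x → ε ∙ x ≈ x
    identityʳ : ∀ x → x ∙ ε ≈ x
    inverseˡ  : ∀ x → x ⁻¹ ∙ x ≈ ε
    inverseʳ  : ∀ x → x ∙ x ⁻¹ ≈ ε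
    relation  : ∀ i j → termPower (m i j) (s i ∙ s j) ≈ ε

  CoxeterGroup : Group 0ℓ 0ℓ
  CoxeterGroup = record
    { Carrier = Term
    ; _≈_     = _≈_
    ; _∙_     = _∙_
    ; ε       = ε
    ; _⁻¹     = _⁻¹
    ; isGroup = record
      { isMonoid = record
        { isSemigroup = record
          { isMagma = record
            { isEquivalence = record { refl = refl ; sym = sym ; trans = trans }
            ; ∙-cong        = ∙-cong
            }
          ; assoc = assoc
          }
        ; identity = identityˡ , identityʳ
        }
      ; inverse = inverseˡ , inverseʳ
      ; ⁻¹-cong = ⁻¹-cong
      }
    }

module _ {c ℓ} (G : Group c ℓ) where
  open Group G using (Carrier; rawMonoid) renaming (_≈_ to _≈ᴳ_; ε to εᴳ)
  open Multiples rawMonoid renaming (_×_ to _times_)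

  -- k times x is the k-th power of x, written additively in the library.
  HasOrder : Carrier → ℕ → Set ℓ
  HasOrder x = IsLeastPositive (λ l → l times x ≈ᴳ εᴳ)

coxeterElement : ∀ {n} (m : CoxeterMatrix n) → Permutation′ n → Term m
coxeterElement m δ = foldr (λ k w → s (δ ⟨$⟩ʳ k) ∙ w) ε (allFin _)

IsCoxeterNumber : ∀ {n} → CoxeterMatrix n → ℕ → Set
IsCoxeterNumber m h = ∀ δ → HasOrder (CoxeterGroup m) (coxeterElement m δ) h

-- The Coxeter matrix whose diagram is a path with label k on the edge joining
-- the nodes k and k + 1.
pathMatrix : (ℕ → ℕ) → ∀ n → CoxeterMatrix n
pathMatrix label n i j with ∣ toℕ i - toℕ j ∣
... | 0 = 1
... | 1 = label (toℕ i ⊓ toℕ j)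
... | _ = 2

A-matrix B-matrix : ∀ n → CoxeterMatrix n
A-matrix n = pathMatrix (λ _ → 3) n
B-matrix n = pathMatrix (λ k → if k + 2 ≡ᵇ n then 4 else 3) n

F₄-matrix : CoxeterMatrix 4
F₄-matrix = pathMatrix (λ k → if k ≡ᵇ 1 then 4 else 3) 4

H₃-matrix : CoxeterMatrix 3
H₃-matrix = pathMatrix (λ k → if k ≡ᵇ 1 then 5 else 3) 3

H₄-matrix : CoxeterMatrix 4
H₄-matrix = pathMatrix (λ k → if k ≡ᵇ 2 then 5 else 3) 4

simplex : ∀ n → FaceComplex n
simplex n = record { #vertices = suc n ; IsFace = _⊂ ⊤ }

-- The vertices +i and -i are i ↑ˡ n and n ↑ʳ i.
crossPolytope : ∀ n → FaceComplex n
crossPolytope n = record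
  { #vertices = n + n
  ; IsFace    = λ X → ∀ i → ¬ (i ↑ˡ n ∈ X × n ↑ʳ i ∈ X)
  }

-- The ring ℤ[φ] for the golden ratio φ = (1 + √5)/2; a ⊹ b φ is a + bφ.

infix 6 _⊹_φ

record ℤ[φ] : Set where
  constructor _⊹_φ
  field
    int  : ℤ
    coef : ℤ

infixl 6 _+φ_ _-φ_
infixl 7 _*φ_
infix  4 _≤φ_

_+φ_ _-φ_ _*φ_ : ℤ[φ] → ℤ[φ] → ℤ[φ]
(a ⊹ b φ) +φ (c ⊹ d φ) = (a +ℤ c) ⊹ (b +ℤ d) φ
(a ⊹ b φ) -φ (c ⊹ d φ) = (a -ℤ c) ⊹ (b -ℤ d) φ
(a ⊹ b φ) *φ (c ⊹ d φ) = (a *ℤ c +ℤ b *ℤ d) ⊹ (a *ℤ d +ℤ b *ℤ c +ℤ b *ℤ d) φ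

signedSquare : ℤ → ℤ
signedSquare x = x *ℤ (+ ∣ x ∣ℤ)

-- The order inherited from ℝ: 2(a + bφ) = (2a + b) + b√5, and x + y√5 ≥ 0 iff
-- x∣x∣ + 5y∣y∣ ≥ 0 because t ↦ t∣t∣ is increasing.
NonNegative : ℤ[φ] → Set
NonNegative (a ⊹ b φ) = 0ℤ ≤ℤ signedSquare ((+ 2) *ℤ a +ℤ b) +ℤ (+ 5) *ℤ signedSquare b

_≤φ_ : ℤ[φ] → ℤ[φ] → Set
x ≤φ y = NonNegative (y -φ x)

0φ 1φ 2φ φ φ⁻¹ : ℤ[φ]
0φ  = 0ℤ ⊹ 0ℤ φ
1φ  = 1ℤ ⊹ 0ℤ φ
2φ  = (+ 2) ⊹ 0ℤ φ
φ   = 0ℤ ⊹ 1ℤ φ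
φ⁻¹ = -1ℤ ⊹ 1ℤ φ

dot : ∀ {d} → Vec ℤ[φ] d → Vec ℤ[φ] d → ℤ[φ]
dot u v = Vec.foldr _ _+φ_ 0φ (Vec.zipWith _*φ_ u v)

-- S is cut out of the points by a hyperplane f · x = c such that f · x ≤ c is
-- valid for all of them.  For points with coordinates in ℤ[φ] every face of
-- the real convex hull arises from some f and c over ℤ[φ].
IsExposed : ∀ {d} (points : List (Vec ℤ[φ] d)) → Subset (length points) → Set
IsExposed {d} points S =
  Σ[ f ∈ Vec ℤ[φ] d ] Σ[ c ∈ ℤ[φ] ]
    (∀ i → dot f (lookup points i) ≤φ c) ×
    (∀ i → i ∈ S ⇔ dot f (lookup points i) ≡ c)

-- The proper faces of the convex hull of a list of points, which are meant to
-- be distinct, in convex position and full-dimensional.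
convexHull : ∀ {d} → List (Vec ℤ[φ] d) → FaceComplex d
convexHull points = record
  { #vertices = length points
  ; IsFace    = λ S → S ⊂ ⊤ × IsExposed points S
  }

± : ℤ[φ] → List ℤ[φ]
± x = x ∷ 0φ -φ x ∷ []

cyclicPermutations : Vec ℤ[φ] 3 → List (Vec ℤ[φ] 3)
cyclicPermutations (a ∷ b ∷ c ∷ []) =
  (a ∷ b ∷ c ∷ []) ∷ (b ∷ c ∷ a ∷ []) ∷ (c ∷ a ∷ b ∷ []) ∷ []

evenPermutations : Vec ℤ[φ] 4 → List (Vec ℤ[φ] 4)
evenPermutations (a ∷ b ∷ c ∷ d ∷ []) =
  (a ∷ b ∷ c ∷ d ∷ []) ∷ (b ∷ a ∷ d ∷ c ∷ []) ∷ (c ∷ d ∷ a ∷ b ∷ []) ∷ (d ∷ c ∷ b ∷ a ∷ []) ∷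
  (a ∷ c ∷ d ∷ b ∷ []) ∷ (a ∷ d ∷ b ∷ c ∷ []) ∷ (c ∷ b ∷ d ∷ a ∷ []) ∷ (d ∷ b ∷ a ∷ c ∷ []) ∷
  (b ∷ d ∷ c ∷ a ∷ []) ∷ (d ∷ a ∷ c ∷ b ∷ []) ∷ (b ∷ c ∷ a ∷ d ∷ []) ∷ (c ∷ a ∷ b ∷ d ∷ []) ∷ []

-- Cyclic permutations of (0, ±1, ±φ).
icosahedronVertices : List (Vec ℤ[φ] 3)
icosahedronVertices =
  concatMap (λ x → concatMap (λ y → cyclicPermutations (0φ ∷ x ∷ y ∷ [])) (± φ)) (± 1φ)

-- Permutations of (±1, ±1, 0, 0).
24-cellVertices : List (Vec ℤ[φ] 4)
24-cellVertices = concatMap (λ x → concatMap (arrangements x) (± 1φ)) (± 1φ)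
  where
  arrangements : ℤ[φ] → ℤ[φ] → List (Vec ℤ[φ] 4)
  arrangements x y =
    (x ∷ y ∷ 0φ ∷ 0φ ∷ []) ∷ (x ∷ 0φ ∷ y ∷ 0φ ∷ []) ∷ (x ∷ 0φ ∷ 0φ ∷ y ∷ []) ∷
    (0φ ∷ x ∷ y ∷ 0φ ∷ []) ∷ (0φ ∷ x ∷ 0φ ∷ y ∷ []) ∷ (0φ ∷ 0φ ∷ x ∷ y ∷ []) ∷ []

-- Scaled to circumradius 2: permutations of (±2, 0, 0, 0), all
-- (±1, ±1, ±1, ±1), and even permutations of (±φ, ±1, ±φ⁻¹, 0).
600-cellVertices : List (Vec ℤ[φ] 4)
600-cellVertices =
  concatMap (λ x → (x ∷ 0φ ∷ 0φ ∷ 0φ ∷ []) ∷ (0φ ∷ x ∷ 0φ ∷ 0φ ∷ []) ∷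
                   (0φ ∷ 0φ ∷ x ∷ 0φ ∷ []) ∷ (0φ ∷ 0φ ∷ 0φ ∷ x ∷ []) ∷ []) (± 2φ) ++
  concatMap (λ x → concatMap (λ y → concatMap (λ z → map (λ t →
    x ∷ y ∷ z ∷ t ∷ []) (± 1φ)) (± 1φ)) (± 1φ)) (± 1φ) ++
  concatMap (λ x → concatMap (λ y → concatMap (λ z →
    evenPermutations (x ∷ y ∷ z ∷ 0φ ∷ [])) (± φ⁻¹)) (± 1φ)) (± φ)

icosahedron : FaceComplex 3
icosahedron = convexHull icosahedronVertices

24-cell 600-cell : FaceComplex 4
24-cell  = convexHull 24-cellVertices
600-cell = convexHull 600-cellVertices

-- σᵢ is defined only once the flags adjacent to each flag are known to exist
-- and be unique, so this is asserted along with the lengths.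
ZigzagsHaveLength : ∀ {n} → FaceComplex n → ℕ → Set
ZigzagsHaveLength P l =
  Σ[ adjacent ∈ UniqueAdjacentFlags P ] (∀ δ F → Zigzag.IsZigzagLength P adjacent δ F l)

{-# OPTIONS --safe #-}

-- The operators σᵢ on flags satisfy the Coxeter relations of the diagram of the polytope, so the
-- presented Coxeter group acts on flags, with T δ acting as a Coxeter element.  On a path diagram all
-- Coxeter elements are conjugate.  It therefore suffices that c = s₀ ⋯ sₙ₋₁ satisfies cʰ = 1 in the
-- presented group and that cᵏ fixes no flag for 0 < k < h: these two facts bound both the order of
-- the Coxeter elements and the zigzag lengths from above and below.
--
-- The first is an identity between words: for A and B by induction on the rank, for F₄, H₃ and H₄ by
-- explicit braid moves.  For the second, flags are encoded by sequences of vertices, on which σᵢ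
-- exchanges two neighbours or replaces the last entry by the other vertex beyond its ridge; then c is
-- a shift, namely a rotation (A), a rotation with a sign (B), or a linear recurrence whose products
-- with the first vertex are computed.
--
-- For the convex hulls, two vertices are in a common proper face only if their product is large: if
-- not, some vertices have a sum ax + by with a + b exceeding their number, and a hyperplane
-- supporting the hull at x and y would pass through its centre.  So faces are cliques of vertices
-- at minimal distance or, in the 24-cell, octahedra.

module Submission where

open import Defs hiding (_≈_; refl; sym; trans; ∙-cong; ⁻¹-cong; assoc; identityˡ; identityʳ; inverseˡ; inverseʳ; relation; _∙_; ε; _⁻¹; s)
open import Algebra.Bundles using (Group; CommutativeRing)
import Algebra.Definitions.RawMonoid as RawMultiples
import Algebra.Properties.Group as GroupProperties
import Algebra.Properties.Monoid.Mult as MonoidMult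
open import Data.Nat.Base using (ℕ; zero; suc; _+_; _*_; _∸_; _≤_; _<_; z≤n; s≤s; s≤s⁻¹; z<s; ∣_-_∣; _≡ᵇ_; NonZero)
import Data.Nat.Properties as ℕ
open import Data.List.Base using (List; []; _∷_; _++_; foldr; foldl; map; allFin; filter; length; concatMap)
open import Data.List.Membership.Propositional using (_∈_; _∉_; find)
import Data.List.Membership.Propositional.Properties as ∈ₗ
open import Data.List.Relation.Unary.Any using (here; there)
open import Data.List.Relation.Unary.All as All using (All; []; _∷_)
import Data.List.Relation.Unary.All.Properties as Allₚ
open import Data.List.Relation.Unary.AllPairs using ([]; _∷_)
open import Data.List.Relation.Unary.Unique.Propositional using (Unique)
open import Data.Product.Base using (_×_; _,_; ∃-syntax; proj₁; proj₂)
open import Data.Sum.Base using (_⊎_; inj₁; inj₂; [_,_]′)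
open import Data.Empty using (⊥-elim)
open import Function.Base using (_∘_; id)
open import Relation.Binary.PropositionalEquality as ≡ using (_≡_; _≢_; cong; cong₂; subst)
import Relation.Binary.Reasoning.Setoid as SetoidReasoning
open import Tactic.MonoidSolver using (solve)
open import Data.Maybe.Base using (Maybe; just; nothing; maybe′)
open import Data.Fin.Base using (Fin; zero; suc; fromℕ<; toℕ; inject₁; fromℕ; _↑ˡ_; _↑ʳ_; splitAt; join) renaming (_<_ to _<ᶠ_)
import Data.Fin.Properties as Fin
open import Data.Fin using (#_)
open import Data.Fin.Permutation as Perm using (Permutation′; _⟨$⟩ʳ_; _⟨$⟩ˡ_)
import Data.List.Relation.Unary.Unique.Propositional.Properties as Uniqueₚ
import Data.Bool.Properties as Bool
open import Data.Bool.Base using (if_then_else_; true; false) renaming (T to IsTrue)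
open import Data.Nat.GeneralisedArithmetic using (iterate)
open import Relation.Binary.Bundles using (Setoid)
open import Relation.Nullary.Negation.Core using (¬_)
import Data.List.Relation.Unary.Unique.DecPropositional as DecUnique
open import Relation.Binary.Definitions using (DecidableEquality; tri<; tri≈; tri>)
open import Data.Fin.Subset as Subset using (Subset; _∪_; ⁅_⁆; _⊆_; _⊂_; ⊥; ⊤; ∣_∣; _─_)
import Data.Fin.Subset.Properties as Subsetₚ
open import Data.Vec.Base as Vec using (Vec; []; _∷_; _∷ʳ_; lookup; head; tail)
import Data.Vec.Properties as Vecₚ
import Data.List.Base as List
open import Data.List.Relation.Unary.Any as Any using (Any)
import Data.List.Relation.Unary.Any.Properties as Anyₚ
open import Function.Bundles using (_⇔_; mk⇔; Equivalence)
import Tactic.RingSolver as Solver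
import Data.List.Properties as Listₚ
import Data.List.Membership.DecPropositional as DecMembership
import Data.Sum.Base as Sum
import Data.Nat.Base as ℕ
open import Data.Nat.Induction using (<-wellFounded)
import Data.Nat.Tactic.RingSolver as ℕSolver
open import Induction.WellFounded using (Acc; acc)
import Data.Integer.Base as ℤ
open import Data.Integer.Base using (ℤ; +_; -[1+_])
import Data.Integer.Properties as ℤ
open import Data.Integer.Tactic.RingSolver using (solve-∀)
open import Tactic.RingSolver.Core.AlmostCommutativeRing using (AlmostCommutativeRing; fromCommutativeRing)
open import Level using (0ℓ)
open import Relation.Nullary.Decidable using (yes; no; toWitness; dec-true; ¬?; Dec; _×-dec_; _⊎-dec_; _→-dec_; map′)

-- Coxeter elements of path diagrams

-- The equation `cʰ = 1` cannot be read off the action on flags: that `cʰ` fixes every flag would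
-- give it only if the presented group were already known to act faithfully, that is, to be no
-- larger than the symmetry group of the polytope. It is therefore derived inside the presentation,
-- by rewriting words, and then holds for flags as well. Lower bounds need no faithfulness, since an
-- element that moves a flag is not trivial. A second obstacle is that a face of a hull is given by
-- an arbitrary hyperplane over ℤ[φ], so faces cannot be enumerated by a finite search. Everything
-- about faces is reduced to the finitely many inner products of vertices, and only these are
-- evaluated.

Enumerates : ℕ → List ℕ → Set
Enumerates n l = Unique l × (∀ {x} → x ∈ l → x < n) × (∀ {x} → x < n → x ∈ l)

Unique-split : ∀ u {x : ℕ} {v} → Unique (u ++ x ∷ v) → Unique (u ++ v) × x ∉ u ++ v
Unique-split []      (p ∷ q) = q , λ i → All.lookup p i ≡.refl
Unique-split (y ∷ u) (p ∷ q) with Unique-split u q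
... | q′ , x∉ = Allₚ.++⁺ (Allₚ.++⁻ˡ u p) (All.tail (Allₚ.++⁻ʳ u p)) ∷ q′
              , λ { (here ≡.refl) → All.head (Allₚ.++⁻ʳ u p) ≡.refl ; (there i) → x∉ i }

∈-remove : ∀ u {x y : ℕ} {v} → y ∈ u ++ x ∷ v → y ≢ x → y ∈ u ++ v
∈-remove []      (here eq) ne = ⊥-elim (ne eq)
∈-remove []      (there i) ne = i
∈-remove (z ∷ u) (here eq) ne = here eq
∈-remove (z ∷ u) (there i) ne = there (∈-remove u i ne)

∈-weaken : ∀ u {x y : ℕ} {v} → y ∈ u ++ v → y ∈ u ++ x ∷ v
∈-weaken []      i         = there i
∈-weaken (z ∷ u) (here eq) = here eq
∈-weaken (z ∷ u) (there i) = there (∈-weaken u i)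

Enumerates-remove : ∀ {n} u v → Enumerates (suc n) (u ++ n ∷ v) → Enumerates n (u ++ v)
Enumerates-remove u v (unique , below , cover) with Unique-split u unique
... | unique′ , n∉ =
    unique′
  , (λ x∈ → ℕ.≤∧≢⇒< (s≤s⁻¹ (below (∈-weaken u x∈))) λ { ≡.refl → n∉ x∈ })
  , λ x<n → ∈-remove u (cover (ℕ.m<n⇒m<1+n x<n)) (ℕ.<⇒≢ x<n)

zero-or-suc : ∀ k → k ≡ 0 ⊎ (∃[ i ] k ≡ suc i)
zero-or-suc zero    = inj₁ ≡.refl
zero-or-suc (suc i) = inj₂ (i , ≡.refl)

module GroupLemmas {c ℓ} (G : Group c ℓ) where
  open Group G
  open GroupProperties G
  open RawMultiples rawMonoid public using () renaming (_×_ to _times_)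
  module × = MonoidMult monoid
  open SetoidReasoning setoid

  Commute : Carrier → Carrier → Set ℓ
  Commute x y = x ∙ y ≈ y ∙ x

  commute-∙ : ∀ {x y z} → Commute x y → Commute x z → Commute x (y ∙ z)
  commute-∙ {x} {y} {z} xy xz = begin
    x ∙ (y ∙ z) ≈⟨ assoc x y z ⟨
    x ∙ y ∙ z   ≈⟨ ∙-congʳ xy ⟩
    y ∙ x ∙ z   ≈⟨ assoc y x z ⟩
    y ∙ (x ∙ z) ≈⟨ ∙-congˡ xz ⟩
    y ∙ (z ∙ x) ≈⟨ assoc y z x ⟨
    y ∙ z ∙ x   ∎

  commute-ε : ∀ {x} → Commute x ε
  commute-ε = trans (identityʳ _) (sym (identityˡ _))

  Conjugate : Carrier → Carrier → Set _
  Conjugate a b = ∃[ g ] a ∙ g ≈ g ∙ b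

  conjugate-trans : ∀ {a b d} → Conjugate a b → Conjugate b d → Conjugate a d
  conjugate-trans {a} {b} {d} (g , p) (h , q) = g ∙ h , (begin
    a ∙ (g ∙ h) ≈⟨ assoc a g h ⟨
    a ∙ g ∙ h   ≈⟨ ∙-congʳ p ⟩
    g ∙ b ∙ h   ≈⟨ assoc g b h ⟩
    g ∙ (b ∙ h) ≈⟨ ∙-congˡ q ⟩
    g ∙ (h ∙ d) ≈⟨ assoc g h d ⟨
    g ∙ h ∙ d   ∎)

  conjugate-sym : ∀ {a b} → Conjugate a b → Conjugate b a
  conjugate-sym {a} {b} (g , p) = g ⁻¹ , (begin
    b ∙ g ⁻¹                ≈⟨ ∙-congʳ (\\-leftDividesʳ g b) ⟨
    g ⁻¹ ∙ (g ∙ b) ∙ g ⁻¹   ≈⟨ ∙-congʳ (∙-congˡ p) ⟨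
    g ⁻¹ ∙ (a ∙ g) ∙ g ⁻¹   ≈⟨ assoc _ _ _ ⟩
    g ⁻¹ ∙ (a ∙ g ∙ g ⁻¹)   ≈⟨ ∙-congˡ (//-rightDividesʳ g a) ⟩
    g ⁻¹ ∙ a                ∎)

  conjugate-≈ : ∀ {a b} → a ≈ b → Conjugate a b
  conjugate-≈ a≈b = ε , trans (∙-congʳ a≈b) commute-ε

  conjugate-swap : ∀ a b → Conjugate (a ∙ b) (b ∙ a)
  conjugate-swap a b = a , assoc a b a

  times-intertwine : ∀ {a b g} → a ∙ g ≈ g ∙ b → ∀ k → k times a ∙ g ≈ g ∙ k times b
  times-intertwine p zero = sym commute-ε
  times-intertwine {a} {b} {g} p (suc k) = begin
    a ∙ k times a ∙ g     ≈⟨ assoc _ _ _ ⟩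
    a ∙ (k times a ∙ g)   ≈⟨ ∙-congˡ (times-intertwine p k) ⟩
    a ∙ (g ∙ k times b)   ≈⟨ assoc _ _ _ ⟨
    a ∙ g ∙ k times b     ≈⟨ ∙-congʳ p ⟩
    g ∙ b ∙ k times b     ≈⟨ assoc _ _ _ ⟩
    g ∙ (b ∙ k times b)   ∎

  times-conjugate : ∀ {a b} → Conjugate a b → ∀ k → k times b ≈ ε → k times a ≈ ε
  times-conjugate {a} {b} (g , p) k eq = identityˡ-unique (k times a) g (begin
    k times a ∙ g ≈⟨ times-intertwine p k ⟩
    g ∙ k times b ≈⟨ ∙-congˡ eq ⟩
    g ∙ ε         ≈⟨ identityʳ g ⟩
    g             ∎)

  times-commute : ∀ x k → Commute (k times x) x
  times-commute x k = times-intertwine refl k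

  module PathLemmas (s : ℕ → Carrier)
    (far : ∀ i j → suc (suc i) ≤ j → Commute (s i) (s j)) where

    word : List ℕ → Carrier
    word = foldr (λ k w → s k ∙ w) ε

    initial : ℕ → Carrier
    initial zero    = ε
    initial (suc k) = initial k ∙ s k

    word-++ : ∀ u v → word (u ++ v) ≈ word u ∙ word v
    word-++ []      v = sym (identityˡ _)
    word-++ (x ∷ u) v = trans (∙-congˡ (word-++ u v)) (sym (assoc _ _ _))

    commute-word : ∀ {x} l → (∀ {j} → j ∈ l → Commute x (s j)) → Commute x (word l)
    commute-word []      p = commute-ε
    commute-word (j ∷ l) p = commute-∙ (p (here ≡.refl)) (commute-word l (p ∘ there))

    far-initial : ∀ k j → k < j → Commute (s j) (initial k)
    far-initial zero    j _   = commute-ε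
    far-initial (suc k) j k<j =
      commute-∙ (far-initial k j (ℕ.<⇒≤ k<j)) (sym (far k j k<j))

    -- The largest generator `s k` fails to commute with only one other letter, its predecessor, and
    -- this lies on one side of it. On the other side `s k` can leave: to the right it joins the
    -- tail `t` directly, to the left it passes to the end of the word, together with `t`, by a
    -- cyclic rotation, which is a conjugation. The tail collects the generators already placed; it
    -- commutes with all that are not adjacent to it, which is what lets the induction continue.
    word∙-conjugate-initial∙ : ∀ k l → Enumerates k l → ∀ t →
      (∀ j → suc j < k → Commute t (s j)) → Conjugate (word l ∙ t) (initial k ∙ t)
    word∙-conjugate-initial∙ zero [] e t _ = conjugate-≈ refl
    word∙-conjugate-initial∙ zero (x ∷ l) (_ , below , _) t _ with below (here ≡.refl)
    ... | ()
    word∙-conjugate-initial∙ (suc k) l e@(_ , _ , cover) t ct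
      with u , v , ≡.refl ← ∈ₗ.∈-∃++ (cover ℕ.≤-refl) = result
      where
      e′ = Enumerates-remove u v e

      commutes : ∀ {j} → j ∈ u ++ v → suc j ≢ k → Commute (s k) (s j)
      commutes {j} j∈ 1+j≢k = sym (far j k (ℕ.≤∧≢⇒< (proj₁ (proj₂ e′) j∈) 1+j≢k))

      ct′ : ∀ j → suc j < k → Commute (s k ∙ t) (s j)
      ct′ j j<k = sym (commute-∙ (far j k j<k) (sym (ct j (ℕ.m<n⇒m<1+n j<k))))

      unfold : word (u ++ k ∷ v) ∙ t ≈ word u ∙ (s k ∙ word v) ∙ t
      unfold = ∙-congʳ (word-++ u (k ∷ v))

      last-right : (∀ {j} → j ∈ v → suc j ≢ k) →
                   word (u ++ k ∷ v) ∙ t ≈ word (u ++ v) ∙ (s k ∙ t)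
      last-right p = begin
        word (u ++ k ∷ v) ∙ t           ≈⟨ unfold ⟩
        word u ∙ (s k ∙ word v) ∙ t     ≈⟨ ∙-congʳ (∙-congˡ (commute-word v λ j∈ → commutes (∈ₗ.∈-++⁺ʳ u j∈) (p j∈))) ⟩
        word u ∙ (word v ∙ s k) ∙ t     ≈⟨ solve monoid ⟩
        word u ∙ word v ∙ (s k ∙ t)     ≈⟨ ∙-congʳ (word-++ u v) ⟨
        word (u ++ v) ∙ (s k ∙ t)       ∎

      last-left : (∀ {j} → j ∈ u → suc j ≢ k) →
                  word (u ++ k ∷ v) ∙ t ≈ (s k ∙ t) ∙ word (u ++ v)
      last-left p = begin
        word (u ++ k ∷ v) ∙ t           ≈⟨ unfold ⟩
        word u ∙ (s k ∙ word v) ∙ t     ≈⟨ solve monoid ⟩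
        word u ∙ s k ∙ word v ∙ t       ≈⟨ ∙-congʳ (∙-congʳ (commute-word u λ j∈ → commutes (∈ₗ.∈-++⁺ˡ j∈) (p j∈))) ⟨
        s k ∙ word u ∙ word v ∙ t       ≈⟨ solve monoid ⟩
        s k ∙ (word u ∙ word v ∙ t)     ≈⟨ ∙-congˡ (∙-congʳ (word-++ u v)) ⟨
        s k ∙ (word (u ++ v) ∙ t)       ≈⟨ ∙-congˡ (commute-word (u ++ v) λ j∈ → ct _ (s≤s (proj₁ (proj₂ e′) j∈))) ⟨
        s k ∙ (t ∙ word (u ++ v))       ≈⟨ assoc _ _ _ ⟨
        (s k ∙ t) ∙ word (u ++ v)       ∎

      recurse : Conjugate (word (u ++ v) ∙ (s k ∙ t)) (initial k ∙ s k ∙ t)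
      recurse = conjugate-trans (word∙-conjugate-initial∙ k (u ++ v) e′ (s k ∙ t) ct′)
                                (conjugate-≈ (sym (assoc _ _ _)))

      right-case : (∀ {j} → j ∈ v → suc j ≢ k) → Conjugate (word (u ++ k ∷ v) ∙ t) (initial k ∙ s k ∙ t)
      right-case p = conjugate-trans (conjugate-≈ (last-right p)) recurse

      left-case : (∀ {j} → j ∈ u → suc j ≢ k) → Conjugate (word (u ++ k ∷ v) ∙ t) (initial k ∙ s k ∙ t)
      left-case p = conjugate-trans (conjugate-≈ (last-left p))
                      (conjugate-trans (conjugate-swap _ _) recurse)

      disjoint : ∀ u → Unique (u ++ v) → ∀ {j} → j ∈ u → j ∉ v
      disjoint (_ ∷ u) (p ∷ q) (here ≡.refl) j∈v = All.lookup p (∈ₗ.∈-++⁺ʳ u j∈v) ≡.refl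
      disjoint (_ ∷ u) (p ∷ q) (there j∈u) j∈v = disjoint u q j∈u j∈v

      result : Conjugate (word (u ++ k ∷ v) ∙ t) (initial k ∙ s k ∙ t)
      result with zero-or-suc k
      ... | inj₁ k≡0 = right-case λ _ 1+j≡k → ℕ.1+n≢0 (≡.trans 1+j≡k k≡0)
      ... | inj₂ (i , k≡1+i) with ∈ₗ.∈-++⁻ u (proj₂ (proj₂ e′) (ℕ.≤-reflexive (≡.sym k≡1+i)))
      ... | inj₁ i∈u = right-case λ j∈v 1+j≡k →
              disjoint u (proj₁ e′) i∈u (subst (_∈ v) (ℕ.suc-injective (≡.trans 1+j≡k k≡1+i)) j∈v)
      ... | inj₂ i∈v = left-case λ j∈u 1+j≡k →
              disjoint u (proj₁ e′) (subst (_∈ u) (ℕ.suc-injective (≡.trans 1+j≡k k≡1+i)) j∈u) i∈v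

    word-conjugate-initial : ∀ {k l} → Enumerates k l → Conjugate (word l) (initial k)
    word-conjugate-initial {k} {l} e =
      conjugate-trans (conjugate-≈ (sym (identityʳ _)))
        (conjugate-trans (word∙-conjugate-initial∙ k l e ε λ j _ → sym commute-ε)
                         (conjugate-≈ (identityʳ _)))

-- Powers of Coxeter elements in types A and B

module CoxeterPowers {c ℓ} (G : Group c ℓ) (s : ℕ → Group.Carrier G)
  (far : ∀ i j → suc (suc i) ≤ j → GroupLemmas.Commute G (s i) (s j))
  (square : ∀ i → Group._≈_ G (Group._∙_ G (s i) (s i)) (Group.ε G)) where
  open Group G
  open GroupProperties G
  open GroupLemmas G
  open PathLemmas s far
  open SetoidReasoning setoid

  Braid : ℕ → Set ℓ
  Braid i = s i ∙ s (suc i) ∙ s i ≈ s (suc i) ∙ s i ∙ s (suc i)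

  module _ {n} (braid : ∀ i → suc i < n → Braid i) where

    -- In the symmetric group `initial k` is a long cycle, which conjugates each adjacent
    -- transposition into the next one. In the presentation, `s i` moves left past the far factors
    -- until it meets `s i ∙ s (suc i)`, where the braid relation turns it into `s (suc i)`.
    initial-shift : ∀ k i → suc i < k → k ≤ n → initial k ∙ s i ≈ s (suc i) ∙ initial k
    initial-shift (suc k) i i<k k<n with ℕ.m≤n⇒m<n∨m≡n (s≤s⁻¹ i<k)
    ... | inj₁ 1+i<k = begin
      initial k ∙ s k ∙ s i         ≈⟨ assoc _ _ _ ⟩
      initial k ∙ (s k ∙ s i)       ≈⟨ ∙-congˡ (far i k 1+i<k) ⟨
      initial k ∙ (s i ∙ s k)       ≈⟨ assoc _ _ _ ⟨
      initial k ∙ s i ∙ s k         ≈⟨ ∙-congʳ (initial-shift k i 1+i<k (ℕ.<⇒≤ k<n)) ⟩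
      s (suc i) ∙ initial k ∙ s k   ≈⟨ assoc _ _ _ ⟩
      s (suc i) ∙ (initial k ∙ s k) ∎
    ... | inj₂ ≡.refl = begin
      initial i ∙ s i ∙ s (suc i) ∙ s i           ≈⟨ solve monoid ⟩
      initial i ∙ (s i ∙ s (suc i) ∙ s i)         ≈⟨ ∙-congˡ (braid i k<n) ⟩
      initial i ∙ (s (suc i) ∙ s i ∙ s (suc i))   ≈⟨ solve monoid ⟩
      initial i ∙ s (suc i) ∙ (s i ∙ s (suc i))   ≈⟨ ∙-congʳ (far-initial i (suc i) ℕ.≤-refl) ⟨
      s (suc i) ∙ initial i ∙ (s i ∙ s (suc i))   ≈⟨ solve monoid ⟩
      s (suc i) ∙ (initial i ∙ s i ∙ s (suc i))   ∎

    -- Stands for the product of `j` generators with indices m, m - 1, and so on. It occurs only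
    -- with j ≤ m + 1, so the truncation in `m ∸ 1` has no effect on it.
    descending : ℕ → ℕ → Carrier
    descending m zero    = ε
    descending m (suc j) = s m ∙ descending (m ∸ 1) j

    descending-shift : ∀ k p j → j ≤ p → p < k → k ≤ n →
      descending p j ∙ initial k ≈ initial k ∙ descending (p ∸ 1) j
    descending-shift k p zero _ _ _ = sym commute-ε
    descending-shift k (suc p) (suc j) (s≤s j≤p) p<k k≤n = begin
      s (suc p) ∙ descending p j ∙ initial k         ≈⟨ assoc _ _ _ ⟩
      s (suc p) ∙ (descending p j ∙ initial k)       ≈⟨ ∙-congˡ (descending-shift k p j j≤p (ℕ.<⇒≤ p<k) k≤n) ⟩
      s (suc p) ∙ (initial k ∙ descending (p ∸ 1) j) ≈⟨ assoc _ _ _ ⟨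
      s (suc p) ∙ initial k ∙ descending (p ∸ 1) j   ≈⟨ ∙-congʳ (initial-shift k p p<k k≤n) ⟨
      initial k ∙ s p ∙ descending (p ∸ 1) j         ≈⟨ assoc _ _ _ ⟩
      initial k ∙ (s p ∙ descending (p ∸ 1) j)       ∎

    descending-initial : ∀ m → descending (m ∸ 1) m ∙ initial m ≈ ε
    descending-initial zero    = identityˡ ε
    descending-initial (suc m) = begin
      s m ∙ descending (m ∸ 1) m ∙ (initial m ∙ s m)   ≈⟨ solve monoid ⟩
      s m ∙ (descending (m ∸ 1) m ∙ initial m) ∙ s m   ≈⟨ ∙-congʳ (∙-congˡ (descending-initial m)) ⟩
      s m ∙ ε ∙ s m                                    ≈⟨ ∙-congʳ (identityʳ _) ⟩
      s m ∙ s m                                        ≈⟨ square m ⟩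
      ε                                                ∎

    -- A further factor `initial (suc m)` passes to the left of the descending product, lowering its
    -- indices by one, and its own last letter `s m` then becomes the new first letter of that
    -- product. For j = m + 1 the descending product is the inverse of `initial (suc m)`, so one
    -- more factor cancels it and the order in type A follows by induction on the rank.
    times-initial-suc : ∀ m j → j ≤ suc m → m < n →
      j times initial (suc m) ≈ j times initial m ∙ descending m j
    times-initial-suc m zero    _         _   = sym (identityˡ ε)
    times-initial-suc m (suc j) (s≤s j≤m) m<n = begin
      initial (suc m) ∙ j times initial (suc m)
        ≈⟨ times-commute (initial (suc m)) j ⟨
      j times initial (suc m) ∙ initial (suc m)
        ≈⟨ ∙-congʳ (times-initial-suc m j (ℕ.m≤n⇒m≤1+n j≤m) m<n) ⟩
      j times initial m ∙ descending m j ∙ initial (suc m)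
        ≈⟨ assoc _ _ _ ⟩
      j times initial m ∙ (descending m j ∙ initial (suc m))
        ≈⟨ ∙-congˡ (descending-shift (suc m) m j j≤m ℕ.≤-refl m<n) ⟩
      j times initial m ∙ (initial m ∙ s m ∙ descending (m ∸ 1) j)
        ≈⟨ ∙-congˡ (assoc _ _ _) ⟩
      j times initial m ∙ (initial m ∙ (s m ∙ descending (m ∸ 1) j))
        ≈⟨ assoc _ _ _ ⟨
      j times initial m ∙ initial m ∙ (s m ∙ descending (m ∸ 1) j)
        ≈⟨ ∙-congʳ (times-commute (initial m) j) ⟩
      initial m ∙ j times initial m ∙ (s m ∙ descending (m ∸ 1) j) ∎

    times-initial-A : ∀ m → m ≤ n → suc m times initial m ≈ ε
    times-initial-A zero    _   = identityʳ ε
    times-initial-A (suc m) m<n = begin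
      initial (suc m) ∙ suc m times initial (suc m)
        ≈⟨ times-commute (initial (suc m)) (suc m) ⟨
      suc m times initial (suc m) ∙ initial (suc m)
        ≈⟨ ∙-congʳ (times-initial-suc m (suc m) ℕ.≤-refl m<n) ⟩
      suc m times initial m ∙ descending m (suc m) ∙ initial (suc m)
        ≈⟨ assoc _ _ _ ⟩
      suc m times initial m ∙ (descending m (suc m) ∙ initial (suc m))
        ≈⟨ ∙-cong (times-initial-A m (ℕ.<⇒≤ m<n)) (descending-initial (suc m)) ⟩
      ε ∙ ε
        ≈⟨ identityˡ ε ⟩
      ε ∎

  -- With a = s₀ ⋯ sₘ₋₁ of order m + 1 and t = sₘ, the conjugates of t by the powers of a are
  -- commuting involutions (the sign changes), and (at)ᵐ⁺¹ is their product.
  module _ (m : ℕ) (braid : ∀ i → suc i < m → Braid i)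
    (fourfold : ∀ p → m ≡ suc p → Commute (s m) (s p ∙ s m ∙ s p)) where

    private
      a t : Carrier
      a = initial m
      t = s m

    conj : ℕ → Carrier
    conj zero    = t
    conj (suc i) = a ⁻¹ ∙ (conj i ∙ a)

    a∙conj : ∀ i → a ∙ conj (suc i) ≈ conj i ∙ a
    a∙conj i = \\-leftDividesˡ a _

    conj-unique : ∀ i {x} → conj i ∙ a ≈ a ∙ x → conj (suc i) ≈ x
    conj-unique i {x} p = trans (∙-congˡ p) (\\-leftDividesʳ a x)

    -- Consecutive sign changes are exchanged by the transposition of their coordinates. This form
    -- makes commutation with `t` visible: every letter used after the first step is far from `t`,
    -- so only `conj 1` requires the fourfold relation.
    conj-suc : ∀ p → m ≡ suc p → ∀ i → i ≤ p → conj (suc i) ≈ s (p ∸ i) ∙ conj i ∙ s (p ∸ i)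
    conj-suc p ≡.refl zero _ = conj-unique 0 (begin
      t ∙ (initial p ∙ s p)                   ≈⟨ assoc _ _ _ ⟨
      t ∙ initial p ∙ s p                     ≈⟨ ∙-congʳ (far-initial p m ℕ.≤-refl) ⟩
      initial p ∙ t ∙ s p                     ≈⟨ ∙-congʳ (∙-congˡ (identityˡ t)) ⟨
      initial p ∙ (ε ∙ t) ∙ s p               ≈⟨ ∙-congʳ (∙-congˡ (∙-congʳ (square p))) ⟨
      initial p ∙ (s p ∙ s p ∙ t) ∙ s p       ≈⟨ solve monoid ⟩
      initial p ∙ s p ∙ (s p ∙ t ∙ s p)       ∎)
    conj-suc p ≡.refl (suc i) i<p = conj-unique (suc i) (begin
      conj (suc i) ∙ a                            ≈⟨ ∙-congʳ (conj-suc p ≡.refl i (ℕ.<⇒≤ i<p)) ⟩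
      s (p ∸ i) ∙ conj i ∙ s (p ∸ i) ∙ a          ≡⟨ cong (λ r → s r ∙ conj i ∙ s r ∙ a) (≡.sym 1+q≡) ⟩
      s (suc q) ∙ conj i ∙ s (suc q) ∙ a          ≈⟨ assoc _ _ _ ⟩
      s (suc q) ∙ conj i ∙ (s (suc q) ∙ a)        ≈⟨ ∙-congˡ shift ⟨
      s (suc q) ∙ conj i ∙ (a ∙ s q)              ≈⟨ solve monoid ⟩
      s (suc q) ∙ (conj i ∙ a) ∙ s q              ≈⟨ ∙-congʳ (∙-congˡ (a∙conj i)) ⟨
      s (suc q) ∙ (a ∙ conj (suc i)) ∙ s q        ≈⟨ ∙-congʳ (assoc _ _ _) ⟨
      s (suc q) ∙ a ∙ conj (suc i) ∙ s q          ≈⟨ ∙-congʳ (∙-congʳ shift) ⟨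
      a ∙ s q ∙ conj (suc i) ∙ s q                ≈⟨ trans (∙-congʳ (assoc _ _ _)) (assoc _ _ _) ⟩
      a ∙ (s q ∙ conj (suc i) ∙ s q)              ∎)
      where
      q = p ∸ suc i
      1+q≡ : suc q ≡ p ∸ i
      1+q≡ = ≡.sym (ℕ.+-∸-assoc 1 i<p)
      shift : a ∙ s q ≈ s (suc q) ∙ a
      shift = initial-shift braid m q (s≤s (ℕ.≤-trans (ℕ.≤-reflexive 1+q≡) (ℕ.m∸n≤m p i))) ℕ.≤-refl

    commute-t-conj : ∀ i → i ≤ m → Commute t (conj i)
    commute-t-conj zero    _   = refl
    commute-t-conj (suc i) i<m with zero-or-suc m
    ... | inj₁ ≡.refl with () ← i<m
    ... | inj₂ (p , ≡.refl) with zero-or-suc i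
    ...   | inj₁ ≡.refl = begin
      t ∙ conj 1               ≈⟨ ∙-congˡ (conj-suc p ≡.refl 0 z≤n) ⟩
      t ∙ (s p ∙ t ∙ s p)      ≈⟨ fourfold p ≡.refl ⟩
      s p ∙ t ∙ s p ∙ t        ≈⟨ ∙-congʳ (conj-suc p ≡.refl 0 z≤n) ⟨
      conj 1 ∙ t               ∎
    ...   | inj₂ (i′ , ≡.refl) = begin
      t ∙ conj (suc i)                 ≈⟨ ∙-congˡ (conj-suc p ≡.refl i (s≤s⁻¹ i<m)) ⟩
      t ∙ (s q ∙ conj i ∙ s q)         ≈⟨ commute-∙ (commute-∙ tq (commute-t-conj i (ℕ.<⇒≤ i<m))) tq ⟩
      s q ∙ conj i ∙ s q ∙ t           ≈⟨ ∙-congʳ (conj-suc p ≡.refl i (s≤s⁻¹ i<m)) ⟨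
      conj (suc i) ∙ t                 ∎
      where
      q = p ∸ i
      tq : Commute t (s q)
      tq = sym (far q m (s≤s (ℕ.≤-trans (ℕ.≤-reflexive (≡.sym (ℕ.+-∸-assoc 1 (s≤s⁻¹ i<m)))) (ℕ.m∸n≤m p i′))))

    conj-∙ : ∀ x y → (a ⁻¹ ∙ (x ∙ a)) ∙ (a ⁻¹ ∙ (y ∙ a)) ≈ a ⁻¹ ∙ (x ∙ y ∙ a)
    conj-∙ x y = begin
      (a ⁻¹ ∙ (x ∙ a)) ∙ (a ⁻¹ ∙ (y ∙ a))   ≈⟨ assoc _ _ _ ⟩
      a ⁻¹ ∙ (x ∙ a ∙ (a ⁻¹ ∙ (y ∙ a)))     ≈⟨ ∙-congˡ (assoc _ _ _) ⟩
      a ⁻¹ ∙ (x ∙ (a ∙ (a ⁻¹ ∙ (y ∙ a))))   ≈⟨ ∙-congˡ (∙-congˡ (\\-leftDividesˡ a _)) ⟩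
      a ⁻¹ ∙ (x ∙ (y ∙ a))                  ≈⟨ ∙-congˡ (assoc _ _ _) ⟨
      a ⁻¹ ∙ (x ∙ y ∙ a)                    ∎

    conj-commute : ∀ k i → i ≤ m → Commute (conj k) (conj (k + i))
    conj-commute zero    i i≤m = commute-t-conj i i≤m
    conj-commute (suc k) i i≤m = begin
      conj (suc k) ∙ conj (suc (k + i))          ≈⟨ conj-∙ _ _ ⟩
      a ⁻¹ ∙ (conj k ∙ conj (k + i) ∙ a)         ≈⟨ ∙-congˡ (∙-congʳ (conj-commute k i i≤m)) ⟩
      a ⁻¹ ∙ (conj (k + i) ∙ conj k ∙ a)         ≈⟨ conj-∙ _ _ ⟨
      conj (suc (k + i)) ∙ conj (suc k)          ∎

    conj-square : ∀ i → conj i ∙ conj i ≈ ε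
    conj-square zero    = square m
    conj-square (suc i) = begin
      conj (suc i) ∙ conj (suc i)       ≈⟨ conj-∙ _ _ ⟩
      a ⁻¹ ∙ (conj i ∙ conj i ∙ a)      ≈⟨ ∙-congˡ (∙-congʳ (conj-square i)) ⟩
      a ⁻¹ ∙ (ε ∙ a)                    ≈⟨ ∙-congˡ (identityˡ a) ⟩
      a ⁻¹ ∙ a                          ≈⟨ inverseˡ a ⟩
      ε                                 ∎

    conj-∙-times : ∀ i j → conj i ∙ j times a ≈ j times a ∙ conj (i + j)
    conj-∙-times i zero rewrite ℕ.+-identityʳ i = commute-ε
    conj-∙-times i (suc j) rewrite ℕ.+-suc i j = begin
      conj i ∙ (a ∙ j times a)           ≈⟨ assoc _ _ _ ⟨
      conj i ∙ a ∙ j times a             ≈⟨ ∙-congʳ (a∙conj i) ⟨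
      a ∙ conj (suc i) ∙ j times a       ≈⟨ assoc _ _ _ ⟩
      a ∙ (conj (suc i) ∙ j times a)     ≈⟨ ∙-congˡ (conj-∙-times (suc i) j) ⟩
      a ∙ (j times a ∙ conj (suc i + j)) ≈⟨ assoc _ _ _ ⟨
      a ∙ j times a ∙ conj (suc i + j)   ∎

    conjs : ℕ → Carrier
    conjs zero    = ε
    conjs (suc j) = conj j ∙ conjs j

    -- Collecting the factors `a` on the left conjugates the copies of `t` by powers of `a`. For j =
    -- m + 1 the power of `a` is trivial by type A, and a product of commuting involutions remains.
    times-initial-suc-B : ∀ j → j times initial (suc m) ≈ j times a ∙ conjs j
    times-initial-suc-B zero    = sym (identityˡ ε)
    times-initial-suc-B (suc j) = begin
      a ∙ t ∙ j times initial (suc m)     ≈⟨ ∙-congˡ (times-initial-suc-B j) ⟩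
      a ∙ t ∙ (j times a ∙ conjs j)       ≈⟨ solve monoid ⟩
      a ∙ (t ∙ j times a) ∙ conjs j       ≈⟨ ∙-congʳ (∙-congˡ (conj-∙-times 0 j)) ⟩
      a ∙ (j times a ∙ conj j) ∙ conjs j  ≈⟨ solve monoid ⟩
      a ∙ j times a ∙ (conj j ∙ conjs j)  ∎

    commute-conjs : ∀ k j → k ≤ j → j ≤ m → Commute (conj j) (conjs k)
    commute-conjs zero    j _   _   = commute-ε
    commute-conjs (suc k) j k<j j≤m =
      commute-∙ (subst (λ i → Commute (conj i) (conj k)) (ℕ.m+[n∸m]≡n (ℕ.<⇒≤ k<j))
                  (sym (conj-commute k (j ∸ k) (ℕ.≤-trans (ℕ.m∸n≤m j k) j≤m))))
                (commute-conjs k j (ℕ.<⇒≤ k<j) j≤m)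

    conjs-square : ∀ j → j ≤ suc m → conjs j ∙ conjs j ≈ ε
    conjs-square zero    _         = identityˡ ε
    conjs-square (suc j) (s≤s j≤m) = begin
      conj j ∙ conjs j ∙ (conj j ∙ conjs j)    ≈⟨ ∙-congʳ (commute-conjs j j ℕ.≤-refl j≤m) ⟩
      conjs j ∙ conj j ∙ (conj j ∙ conjs j)    ≈⟨ solve monoid ⟩
      conjs j ∙ (conj j ∙ conj j) ∙ conjs j    ≈⟨ ∙-congʳ (∙-congˡ (conj-square j)) ⟩
      conjs j ∙ ε ∙ conjs j                    ≈⟨ ∙-congʳ (identityʳ _) ⟩
      conjs j ∙ conjs j                        ≈⟨ conjs-square j (ℕ.m≤n⇒m≤1+n j≤m) ⟩
      ε                                        ∎

    times-initial-B : (2 * suc m) times initial (suc m) ≈ ε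
    times-initial-B = begin
      (2 * suc m) times initial (suc m)        ≈⟨ ×.×-assocˡ (initial (suc m)) 2 (suc m) ⟨
      2 times (suc m times initial (suc m))    ≈⟨ ×.×-congʳ 2 (trans (times-initial-suc-B (suc m))
                                                    (trans (∙-congʳ (times-initial-A braid m ℕ.≤-refl)) (identityˡ _))) ⟩
      conjs (suc m) ∙ (conjs (suc m) ∙ ε)      ≈⟨ ∙-congˡ (identityʳ _) ⟩
      conjs (suc m) ∙ conjs (suc m)            ≈⟨ conjs-square (suc m) ℕ.≤-refl ⟩
      ε                                        ∎

-- Rewriting of words by braid moves

alternating : ℕ → ℕ → ℕ → List ℕ
alternating i j zero    = []
alternating i j (suc k) = i ∷ alternating j i k

stripPrefix : List ℕ → List ℕ → Maybe (List ℕ)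
stripPrefix []      w       = just w
stripPrefix (x ∷ u) []      = nothing
stripPrefix (x ∷ u) (y ∷ w) with x ℕ.≟ y
... | yes _ = stripPrefix u w
... | no  _ = nothing

stripPrefix-just : ∀ u w {r} → stripPrefix u w ≡ just r → w ≡ u ++ r
stripPrefix-just []      w       ≡.refl = ≡.refl
stripPrefix-just (x ∷ u) (y ∷ w) eq with x ℕ.≟ y
... | yes ≡.refl = cong (x ∷_) (stripPrefix-just u w eq)

module _ (m : ℕ → ℕ → ℕ) where

  -- A move that does not apply leaves the word as it is. Hence any list of positions preserves the
  -- group element, and a recorded list needs no proof that its moves are applicable.
  braidHead : List ℕ → List ℕ
  braidHead w@(i ∷ j ∷ _) = maybe′ (alternating j i (m i j) ++_) w (stripPrefix (alternating i j (m i j)) w)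
  braidHead w             = w

  braidAt : List ℕ → ℕ → List ℕ
  braidAt w       zero    = braidHead w
  braidAt []      (suc p) = []
  braidAt (x ∷ w) (suc p) = x ∷ braidAt w p

cancelHead : ℕ → List ℕ → List ℕ
cancelHead x []      = x ∷ []
cancelHead x (y ∷ w) with x ℕ.≟ y
... | yes _ = w
... | no  _ = x ∷ y ∷ w

freelyReduce : List ℕ → List ℕ
freelyReduce = foldr cancelHead []

repeat : ℕ → List ℕ → List ℕ
repeat zero    w = []
repeat (suc k) w = w ++ repeat k w

module BraidMoves {c ℓ} (G : Group c ℓ) (s : ℕ → Group.Carrier G)
  (far : ∀ i j → suc (suc i) ≤ j → GroupLemmas.Commute G (s i) (s j))
  (square : ∀ i → Group._≈_ G (Group._∙_ G (s i) (s i)) (Group.ε G)) where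
  open Group G
  open GroupProperties G
  open GroupLemmas G
  open PathLemmas s far
  open SetoidReasoning setoid

  -- True for both parities of `k`: a new letter in front exchanges the roles of `i` and `j`, and
  -- `s j` is its own inverse. When the power is trivial the two alternating words agree, which is
  -- the relation in the form of a braid move.
  times-alternating : ∀ i j k →
    k times (s i ∙ s j) ≈ word (alternating i j k) ∙ word (alternating j i k) ⁻¹
  times-alternating i j zero    = sym (inverseʳ ε)
  times-alternating i j (suc k) = begin
    s i ∙ s j ∙ k times (s i ∙ s j)          ≈⟨ assoc _ _ _ ⟩
    s i ∙ (s j ∙ k times (s i ∙ s j))        ≈⟨ ∙-congˡ (times-intertwine (assoc _ _ _) k) ⟨
    s i ∙ (k times (s j ∙ s i) ∙ s j)        ≈⟨ ∙-congˡ (∙-congʳ (times-alternating j i k)) ⟩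
    s i ∙ (ji ∙ ij ⁻¹ ∙ s j)                 ≈⟨ ∙-congˡ (∙-congˡ (inverseˡ-unique _ _ (square j))) ⟩
    s i ∙ (ji ∙ ij ⁻¹ ∙ s j ⁻¹)              ≈⟨ ∙-congˡ (assoc _ _ _) ⟩
    s i ∙ (ji ∙ (ij ⁻¹ ∙ s j ⁻¹))            ≈⟨ ∙-congˡ (∙-congˡ (⁻¹-anti-homo-∙ _ _)) ⟨
    s i ∙ (ji ∙ (s j ∙ ij) ⁻¹)               ≈⟨ assoc _ _ _ ⟨
    s i ∙ ji ∙ (s j ∙ ij) ⁻¹                 ∎
    where
    ij = word (alternating i j k)
    ji = word (alternating j i k)

  alternating-swap : ∀ i j k → k times (s i ∙ s j) ≈ ε → word (alternating i j k) ≈ word (alternating j i k)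
  alternating-swap i j k p = x∙y⁻¹≈ε⇒x≈y _ _ (trans (sym (times-alternating i j k)) p)

  braid₃ : ∀ i j → 3 times (s i ∙ s j) ≈ ε → s i ∙ s j ∙ s i ≈ s j ∙ s i ∙ s j
  braid₃ i j p = begin
    s i ∙ s j ∙ s i           ≈⟨ solve monoid ⟩
    s i ∙ (s j ∙ (s i ∙ ε))   ≈⟨ alternating-swap i j 3 p ⟩
    s j ∙ (s i ∙ (s j ∙ ε))   ≈⟨ solve monoid ⟩
    s j ∙ s i ∙ s j           ∎

  braid₄ : ∀ i j → 4 times (s i ∙ s j) ≈ ε → Commute (s j) (s i ∙ s j ∙ s i)
  braid₄ i j p = begin
    s j ∙ (s i ∙ s j ∙ s i)           ≈⟨ solve monoid ⟩
    s j ∙ (s i ∙ (s j ∙ (s i ∙ ε)))   ≈⟨ alternating-swap i j 4 p ⟨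
    s i ∙ (s j ∙ (s i ∙ (s j ∙ ε)))   ≈⟨ solve monoid ⟩
    s i ∙ s j ∙ s i ∙ s j             ∎

  cancelHead-word : ∀ x w → word (cancelHead x w) ≈ s x ∙ word w
  cancelHead-word x []      = refl
  cancelHead-word x (y ∷ w) with x ℕ.≟ y
  ... | no  _      = refl
  ... | yes ≡.refl = begin
    word w               ≈⟨ identityˡ _ ⟨
    ε ∙ word w           ≈⟨ ∙-congʳ (square x) ⟨
    s x ∙ s x ∙ word w   ≈⟨ assoc _ _ _ ⟩
    s x ∙ (s x ∙ word w) ∎

  freelyReduce-word : ∀ w → word (freelyReduce w) ≈ word w
  freelyReduce-word []      = refl
  freelyReduce-word (x ∷ w) = trans (cancelHead-word x (freelyReduce w)) (∙-congˡ (freelyReduce-word w))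

  repeat-word : ∀ k w → word (repeat k w) ≈ k times word w
  repeat-word zero    w = refl
  repeat-word (suc k) w = trans (word-++ w (repeat k w)) (∙-congˡ (repeat-word k w))

  module _ (m : ℕ → ℕ → ℕ) (relation : ∀ i j → m i j times (s i ∙ s j) ≈ ε) where

    braidHead-word : ∀ w → word (braidHead m w) ≈ word w
    braidHead-word []      = refl
    braidHead-word (i ∷ []) = refl
    braidHead-word w@(i ∷ j ∷ _) with stripPrefix (alternating i j (m i j)) w in eq
    ... | nothing = refl
    ... | just r  = begin
      word (alternating j i (m i j) ++ r)        ≈⟨ word-++ (alternating j i (m i j)) r ⟩
      word (alternating j i (m i j)) ∙ word r    ≈⟨ ∙-congʳ (alternating-swap i j (m i j) (relation i j)) ⟨
      word (alternating i j (m i j)) ∙ word r    ≈⟨ word-++ (alternating i j (m i j)) r ⟨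
      word (alternating i j (m i j) ++ r)        ≡⟨ cong word (stripPrefix-just (alternating i j (m i j)) w eq) ⟨
      word w                                     ∎

    braidAt-word : ∀ w p → word (braidAt m w p) ≈ word w
    braidAt-word w       zero    = braidHead-word w
    braidAt-word []      (suc p) = refl
    braidAt-word (x ∷ w) (suc p) = ∙-congˡ (braidAt-word w p)

    braidAts-word : ∀ ps w → word (foldl (braidAt m) w ps) ≈ word w
    braidAts-word []       w = refl
    braidAts-word (p ∷ ps) w = trans (braidAts-word ps (braidAt m w p)) (braidAt-word w p)

    -- Intended for moves that turn the first half of `repeat k w` into the reversal of the second
    -- half, which then cancels against it letter by letter.
    times-word-trivial : ∀ k w ps → freelyReduce (foldl (braidAt m) (repeat k w) ps) ≡ [] → k times word w ≈ ε
    times-word-trivial k w ps eq = begin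
      k times word w                                            ≈⟨ repeat-word k w ⟨
      word (repeat k w)                                         ≈⟨ braidAts-word ps (repeat k w) ⟨
      word (foldl (braidAt m) (repeat k w) ps)                  ≈⟨ freelyReduce-word (foldl (braidAt m) (repeat k w) ps) ⟨
      word (freelyReduce (foldl (braidAt m) (repeat k w) ps))   ≡⟨ cong word eq ⟩
      ε                                                         ∎

-- Positions of the braid moves that turn the reduced word (s₀s₂s₁s₃)^(h/2) of the longest element
-- into its reversal, h being the Coxeter number.  They are read off by rotating a half great
-- circle between opposite chambers half a turn around its ends: it then sweeps once over each
-- intersection of two reflecting hyperplanes.

F₄-moves H₃-moves H₄-moves : List ℕ
F₄-moves =
  2 ∷ 4 ∷ 6 ∷ 12 ∷ 14 ∷ 22 ∷ 13 ∷ 5 ∷ 11 ∷ 6 ∷ 19 ∷ 5 ∷ 8 ∷ 11 ∷ 20 ∷ 7 ∷ 14 ∷ 19 ∷ 16 ∷ 15 ∷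
  12 ∷ 15 ∷ 17 ∷ 14 ∷ 18 ∷ 15 ∷ 13 ∷ 10 ∷ 9 ∷ 8 ∷ 18 ∷ 6 ∷ 3 ∷ 12 ∷ 11 ∷ 1 ∷ 6 ∷ 9 ∷ 13 ∷ 3 ∷
  20 ∷ 4 ∷ 6 ∷ 9 ∷ 10 ∷ 14 ∷ 5 ∷ 13 ∷ 14 ∷ 16 ∷ 8 ∷ 17 ∷ 18 ∷ 10 ∷ 2 ∷ 17 ∷ 11 ∷ 7 ∷ 13 ∷ 12 ∷
  20 ∷ 6 ∷ 14 ∷ 0 ∷ 13 ∷ 5 ∷ 19 ∷ 17 ∷ 16 ∷ 14 ∷ 8 ∷ 7 ∷ 11 ∷ 10 ∷ 8 ∷ 13 ∷ 10 ∷ 9 ∷ 19 ∷ 6 ∷ 9 ∷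
  11 ∷ 12 ∷ 4 ∷ 3 ∷ 14 ∷ 20 ∷ 13 ∷ 6 ∷ 12 ∷ 15 ∷ 1 ∷ 18 ∷ 14 ∷ 3 ∷ 17 ∷ 6 ∷ 15 ∷ 8 ∷ 7 ∷ 9 ∷ 10 ∷
  12 ∷ 15 ∷ 16 ∷ 19 ∷ 11 ∷ 20 ∷ 8 ∷ 14 ∷ 19 ∷ 11 ∷ 5 ∷ 6 ∷ 5 ∷ 13 ∷ 2 ∷ 4 ∷ 6 ∷ 12 ∷ 14 ∷ 22 ∷ []
H₃-moves =
  3 ∷ 9 ∷ 4 ∷ 10 ∷ 6 ∷ 5 ∷ 10 ∷ 1 ∷ 5 ∷ 7 ∷ 8 ∷ 10 ∷ 4 ∷ 9 ∷ 5 ∷ 3 ∷ 2 ∷ 9 ∷ 5 ∷ 8 ∷ 11 ∷ 6 ∷ 0 ∷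
  2 ∷ 6 ∷ 7 ∷ 11 ∷ 5 ∷ 1 ∷ 7 ∷ 13 ∷ []
H₄-moves =
  2 ∷ 4 ∷ 6 ∷ 14 ∷ 16 ∷ 18 ∷ 24 ∷ 26 ∷ 28 ∷ 36 ∷ 38 ∷ 46 ∷ 48 ∷ 50 ∷ 58 ∷ 31 ∷ 37 ∷ 17 ∷ 29 ∷
  18 ∷ 43 ∷ 17 ∷ 49 ∷ 25 ∷ 27 ∷ 31 ∷ 5 ∷ 20 ∷ 11 ∷ 50 ∷ 38 ∷ 40 ∷ 39 ∷ 42 ∷ 29 ∷ 26 ∷ 40 ∷ 15 ∷
  38 ∷ 6 ∷ 22 ∷ 49 ∷ 32 ∷ 8 ∷ 26 ∷ 10 ∷ 27 ∷ 21 ∷ 28 ∷ 52 ∷ 34 ∷ 26 ∷ 11 ∷ 47 ∷ 19 ∷ 7 ∷ 33 ∷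
  15 ∷ 20 ∷ 29 ∷ 16 ∷ 38 ∷ 20 ∷ 43 ∷ 33 ∷ 21 ∷ 51 ∷ 35 ∷ 23 ∷ 19 ∷ 36 ∷ 24 ∷ 32 ∷ 26 ∷ 42 ∷ 27 ∷
  8 ∷ 29 ∷ 30 ∷ 32 ∷ 36 ∷ 25 ∷ 47 ∷ 14 ∷ 41 ∷ 37 ∷ 41 ∷ 31 ∷ 24 ∷ 55 ∷ 40 ∷ 10 ∷ 20 ∷ 39 ∷ 42 ∷
  23 ∷ 35 ∷ 13 ∷ 44 ∷ 9 ∷ 34 ∷ 22 ∷ 45 ∷ 16 ∷ 5 ∷ 32 ∷ 21 ∷ 47 ∷ 28 ∷ 41 ∷ 27 ∷ 46 ∷ 19 ∷ 11 ∷
  26 ∷ 54 ∷ 28 ∷ 42 ∷ 17 ∷ 22 ∷ 51 ∷ 29 ∷ 19 ∷ 37 ∷ 8 ∷ 52 ∷ 40 ∷ 20 ∷ 46 ∷ 30 ∷ 32 ∷ 10 ∷ 18 ∷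
  38 ∷ 26 ∷ 13 ∷ 37 ∷ 42 ∷ 45 ∷ 48 ∷ 53 ∷ 17 ∷ 16 ∷ 15 ∷ 36 ∷ 14 ∷ 35 ∷ 22 ∷ 34 ∷ 25 ∷ 28 ∷ 33 ∷
  13 ∷ 31 ∷ 23 ∷ 43 ∷ 18 ∷ 29 ∷ 40 ∷ 11 ∷ 25 ∷ 19 ∷ 13 ∷ 24 ∷ 12 ∷ 41 ∷ 31 ∷ 54 ∷ 20 ∷ 29 ∷ 19 ∷
  51 ∷ 34 ∷ 42 ∷ 24 ∷ 17 ∷ 49 ∷ 20 ∷ 30 ∷ 26 ∷ 3 ∷ 16 ∷ 9 ∷ 51 ∷ 27 ∷ 14 ∷ 52 ∷ 50 ∷ 21 ∷ 29 ∷
  32 ∷ 38 ∷ 19 ∷ 23 ∷ 13 ∷ 49 ∷ 48 ∷ 47 ∷ 46 ∷ 45 ∷ 40 ∷ 46 ∷ 37 ∷ 34 ∷ 52 ∷ 31 ∷ 43 ∷ 35 ∷ 41 ∷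
  37 ∷ 36 ∷ 32 ∷ 30 ∷ 5 ∷ 36 ∷ 41 ∷ 28 ∷ 38 ∷ 35 ∷ 27 ∷ 32 ∷ 45 ∷ 26 ∷ 39 ∷ 25 ∷ 24 ∷ 33 ∷ 44 ∷
  22 ∷ 35 ∷ 20 ∷ 39 ∷ 16 ∷ 34 ∷ 9 ∷ 15 ∷ 14 ∷ 4 ∷ 40 ∷ 22 ∷ 38 ∷ 37 ∷ 35 ∷ 10 ∷ 31 ∷ 8 ∷ 7 ∷ 5 ∷
  30 ∷ 44 ∷ 29 ∷ 1 ∷ 20 ∷ 10 ∷ 31 ∷ 25 ∷ 21 ∷ 32 ∷ 43 ∷ 33 ∷ 5 ∷ 54 ∷ 23 ∷ 6 ∷ 22 ∷ 42 ∷ 10 ∷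
  34 ∷ 20 ∷ 12 ∷ 50 ∷ 19 ∷ 45 ∷ 4 ∷ 9 ∷ 18 ∷ 14 ∷ 29 ∷ 15 ∷ 25 ∷ 53 ∷ 13 ∷ 15 ∷ 47 ∷ 28 ∷ 16 ∷
  6 ∷ 18 ∷ 26 ∷ 31 ∷ 41 ∷ 14 ∷ 19 ∷ 21 ∷ 13 ∷ 17 ∷ 44 ∷ 7 ∷ 48 ∷ 22 ∷ 26 ∷ 27 ∷ 31 ∷ 3 ∷ 18 ∷
  33 ∷ 19 ∷ 34 ∷ 25 ∷ 36 ∷ 37 ∷ 30 ∷ 38 ∷ 27 ∷ 39 ∷ 24 ∷ 41 ∷ 28 ∷ 21 ∷ 42 ∷ 44 ∷ 22 ∷ 48 ∷ 24 ∷
  49 ∷ 28 ∷ 9 ∷ 29 ∷ 43 ∷ 20 ∷ 33 ∷ 53 ∷ 47 ∷ 34 ∷ 46 ∷ 8 ∷ 32 ∷ 23 ∷ 36 ∷ 44 ∷ 19 ∷ 37 ∷ 54 ∷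
  31 ∷ 13 ∷ 21 ∷ 49 ∷ 39 ∷ 30 ∷ 40 ∷ 27 ∷ 39 ∷ 33 ∷ 14 ∷ 12 ∷ 4 ∷ 40 ∷ 22 ∷ 41 ∷ 44 ∷ 38 ∷ 15 ∷
  56 ∷ 34 ∷ 11 ∷ 45 ∷ 19 ∷ 32 ∷ 31 ∷ 21 ∷ 38 ∷ 29 ∷ 22 ∷ 34 ∷ 28 ∷ 26 ∷ 24 ∷ 13 ∷ 18 ∷ 37 ∷ 49 ∷
  27 ∷ 25 ∷ 27 ∷ 52 ∷ 15 ∷ 35 ∷ 40 ∷ 23 ∷ 28 ∷ 22 ∷ 16 ∷ 30 ∷ 12 ∷ 10 ∷ 53 ∷ 31 ∷ 18 ∷ 35 ∷ 17 ∷
  25 ∷ 36 ∷ 51 ∷ 30 ∷ 13 ∷ 43 ∷ 22 ∷ 41 ∷ 29 ∷ 43 ∷ 23 ∷ 40 ∷ 41 ∷ 31 ∷ 43 ∷ 24 ∷ 17 ∷ 11 ∷ 53 ∷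
  45 ∷ 25 ∷ 50 ∷ 34 ∷ 19 ∷ 46 ∷ 32 ∷ 39 ∷ 9 ∷ 29 ∷ 16 ∷ 44 ∷ 57 ∷ 38 ∷ 47 ∷ 24 ∷ 31 ∷ 21 ∷ 48 ∷
  40 ∷ 32 ∷ 22 ∷ 11 ∷ 8 ∷ 20 ∷ 22 ∷ 47 ∷ 13 ∷ 23 ∷ 34 ∷ 28 ∷ 37 ∷ 35 ∷ 54 ∷ 31 ∷ 37 ∷ 25 ∷ 48 ∷
  50 ∷ 19 ∷ 7 ∷ 45 ∷ 38 ∷ 36 ∷ 33 ∷ 30 ∷ 26 ∷ 24 ∷ 42 ∷ 18 ∷ 2 ∷ 9 ∷ 12 ∷ 14 ∷ 21 ∷ 29 ∷ 17 ∷ 6 ∷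
  55 ∷ 28 ∷ 41 ∷ 25 ∷ 40 ∷ 41 ∷ 40 ∷ 29 ∷ 41 ∷ 16 ∷ 37 ∷ 5 ∷ 13 ∷ 11 ∷ 39 ∷ 33 ∷ 26 ∷ 14 ∷ 38 ∷
  47 ∷ 45 ∷ 28 ∷ 27 ∷ 56 ∷ 34 ∷ 12 ∷ 32 ∷ 52 ∷ 26 ∷ 46 ∷ 31 ∷ 38 ∷ 29 ∷ 14 ∷ 8 ∷ 17 ∷ 51 ∷ 34 ∷
  39 ∷ 28 ∷ 47 ∷ 21 ∷ 0 ∷ 46 ∷ 22 ∷ 44 ∷ 16 ∷ 43 ∷ 41 ∷ 20 ∷ 40 ∷ 38 ∷ 19 ∷ 26 ∷ 37 ∷ 43 ∷ 22 ∷
  35 ∷ 17 ∷ 25 ∷ 31 ∷ 23 ∷ 19 ∷ 30 ∷ 29 ∷ 18 ∷ 23 ∷ 28 ∷ 24 ∷ 22 ∷ 21 ∷ 19 ∷ 15 ∷ 24 ∷ 14 ∷ 19 ∷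
  44 ∷ 13 ∷ 38 ∷ 20 ∷ 9 ∷ 24 ∷ 7 ∷ 26 ∷ 35 ∷ 15 ∷ 45 ∷ 6 ∷ 37 ∷ 51 ∷ 47 ∷ 29 ∷ 31 ∷ 36 ∷ 28 ∷
  29 ∷ 18 ∷ 46 ∷ 27 ∷ 29 ∷ 13 ∷ 23 ∷ 16 ∷ 9 ∷ 50 ∷ 4 ∷ 32 ∷ 31 ∷ 30 ∷ 3 ∷ 12 ∷ 31 ∷ 33 ∷ 53 ∷
  35 ∷ 48 ∷ 32 ∷ 33 ∷ 26 ∷ 15 ∷ 31 ∷ 10 ∷ 33 ∷ 40 ∷ 1 ∷ 45 ∷ 25 ∷ 47 ∷ 3 ∷ 27 ∷ 5 ∷ 16 ∷ 36 ∷
  24 ∷ 18 ∷ 40 ∷ 6 ∷ 41 ∷ 10 ∷ 11 ∷ 35 ∷ 39 ∷ 45 ∷ 38 ∷ 15 ∷ 16 ∷ 41 ∷ 18 ∷ 36 ∷ 20 ∷ 44 ∷ 21 ∷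
  22 ∷ 42 ∷ 24 ∷ 38 ∷ 25 ∷ 27 ∷ 37 ∷ 31 ∷ 42 ∷ 32 ∷ 19 ∷ 33 ∷ 37 ∷ 39 ∷ 40 ∷ 42 ∷ 46 ∷ 47 ∷ 48 ∷
  41 ∷ 36 ∷ 49 ∷ 37 ∷ 20 ∷ 53 ∷ 32 ∷ 26 ∷ 41 ∷ 22 ∷ 30 ∷ 14 ∷ 29 ∷ 27 ∷ 55 ∷ 56 ∷ 33 ∷ 15 ∷ 43 ∷
  23 ∷ 35 ∷ 46 ∷ 9 ∷ 32 ∷ 22 ∷ 55 ∷ 27 ∷ 21 ∷ 17 ∷ 13 ∷ 48 ∷ 16 ∷ 28 ∷ 17 ∷ 16 ∷ 45 ∷ 23 ∷ 17 ∷
  5 ∷ 46 ∷ 33 ∷ 26 ∷ 14 ∷ 35 ∷ 32 ∷ 49 ∷ 11 ∷ 33 ∷ 21 ∷ 44 ∷ 35 ∷ 12 ∷ 25 ∷ 11 ∷ 43 ∷ 31 ∷ 23 ∷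
  37 ∷ 25 ∷ 2 ∷ 4 ∷ 6 ∷ 14 ∷ 16 ∷ 18 ∷ 24 ∷ 26 ∷ 28 ∷ 36 ∷ 38 ∷ 46 ∷ 48 ∷ 50 ∷ 58 ∷ []

-- With the exponent 0 outside the diagram the relation is about an empty product, and the
-- corresponding braid move replaces an empty prefix by an empty one.
totalMatrix : ∀ {n} → CoxeterMatrix n → ℕ → ℕ → ℕ
totalMatrix {n} m i j with i ℕ.<? n | j ℕ.<? n
... | yes p | yes q = m (fromℕ< p) (fromℕ< q)
... | _     | _     = 0

module _ {label : ℕ → ℕ} {n} {i j : Fin n} where

  pathMatrix-refl : toℕ i ≡ toℕ j → pathMatrix label n i j ≡ 1
  pathMatrix-refl eq with ∣ toℕ i - toℕ j ∣ | ≡.trans (cong (∣ toℕ i -_∣) (≡.sym eq)) (ℕ.∣n-n∣≡0 (toℕ i))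
  ... | _ | ≡.refl = ≡.refl

  pathMatrix-edge : toℕ j ≡ suc (toℕ i) → pathMatrix label n i j ≡ label (toℕ i)
  pathMatrix-edge eq with ∣ toℕ i - toℕ j ∣ | ≡.trans (cong (∣ toℕ i -_∣) eq) (∣n-1+n∣≡1 (toℕ i))
    where
    ∣n-1+n∣≡1 : ∀ k → ∣ k - suc k ∣ ≡ 1
    ∣n-1+n∣≡1 zero    = ≡.refl
    ∣n-1+n∣≡1 (suc k) = ∣n-1+n∣≡1 k
  ... | _ | ≡.refl = cong label (ℕ.m≤n⇒m⊓n≡m (ℕ.≤-trans (ℕ.n≤1+n _) (ℕ.≤-reflexive (≡.sym eq))))

  pathMatrix-far : suc (suc (toℕ i)) ≤ toℕ j → pathMatrix label n i j ≡ 2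
  pathMatrix-far i<<j with ∣ toℕ i - toℕ j ∣ | 2≤∣-∣ (toℕ i) (toℕ j) i<<j
    where
    2≤∣-∣ : ∀ a b → suc (suc a) ≤ b → 2 ≤ ∣ a - b ∣
    2≤∣-∣ zero    b       p       = p
    2≤∣-∣ (suc a) (suc b) (s≤s p) = 2≤∣-∣ a b p
  ... | suc (suc _) | _ = ≡.refl
  ... | suc zero | s≤s ()

pathMatrix-sym : ∀ label n i j → pathMatrix label n i j ≡ pathMatrix label n j i
pathMatrix-sym label n i j
  with ∣ toℕ i - toℕ j ∣ | ∣ toℕ j - toℕ i ∣ | ℕ.∣-∣-comm (toℕ i) (toℕ j)
... | zero        | _ | ≡.refl = ≡.refl
... | suc zero    | _ | ≡.refl = cong label (ℕ.⊓-comm (toℕ i) (toℕ j))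
... | suc (suc _) | _ | ≡.refl = ≡.refl

data PathRelation {n} (i j : Fin n) : Set where
  same  : i ≡ j → PathRelation i j
  edge  : toℕ j ≡ suc (toℕ i) → PathRelation i j
  edge′ : toℕ i ≡ suc (toℕ j) → PathRelation i j
  far   : suc (suc (toℕ i)) ≤ toℕ j → PathRelation i j
  far′  : suc (suc (toℕ j)) ≤ toℕ i → PathRelation i j

pathRelation : ∀ {n} (i j : Fin n) → PathRelation i j
pathRelation i j with ℕ.<-cmp (toℕ i) (toℕ j)
... | tri≈ _ eq _ = same (Fin.toℕ-injective eq)
... | tri< lt _ _ = [ far , (λ eq → edge (≡.sym eq)) ]′ (ℕ.m≤n⇒m<n∨m≡n lt)
... | tri> _ _ gt = [ far′ , (λ eq → edge′ (≡.sym eq)) ]′ (ℕ.m≤n⇒m<n∨m≡n gt)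

module PathPresentation (label : ℕ → ℕ) (n : ℕ) where
  private
    m = pathMatrix label n
  open Group (CoxeterGroup m)
  open GroupLemmas (CoxeterGroup m)

  -- The generators are indexed by all of ℕ, with ε beyond the diagram: far-apart commutation and
  -- involutivity then hold without side conditions.
  generator : ℕ → Carrier
  generator k with k ℕ.<? n
  ... | yes p = Defs.s (fromℕ< p)
  ... | no  _ = ε

  generator-toℕ : ∀ i → generator (toℕ i) ≡ Defs.s i
  generator-toℕ i with toℕ i ℕ.<? n
  ... | yes p = cong Defs.s (Fin.fromℕ<-toℕ i p)
  ... | no ¬p = ⊥-elim (¬p (Fin.toℕ<n i))

  relation : ∀ i j {k} → m i j ≡ k → k times (Defs.s i ∙ Defs.s j) ≈ ε
  relation i j ≡.refl = trans (reflexive (times≡termPower (m i j))) (Defs.relation i j)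
    where
    times≡termPower : ∀ {x} k → k times x ≡ termPower m k x
    times≡termPower zero    = ≡.refl
    times≡termPower (suc k) = cong (_ ∙_) (times≡termPower k)

  total-relation : ∀ i j → totalMatrix m i j times (generator i ∙ generator j) ≈ ε
  total-relation i j with i ℕ.<? n | j ℕ.<? n
  ... | yes p | yes q = relation (fromℕ< p) (fromℕ< q) ≡.refl
  ... | yes _ | no  _ = refl
  ... | no  _ | yes _ = refl
  ... | no  _ | no  _ = refl

  involution : ∀ i → Defs.s i ∙ Defs.s i ≈ ε
  involution i = trans (sym (identityʳ _)) (relation i i (pathMatrix-refl {label} {n} {i} ≡.refl))

  square : ∀ i → generator i ∙ generator i ≈ ε
  square i with i ℕ.<? n
  ... | yes p = involution (fromℕ< p)
  ... | no  _ = identityˡ ε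

  far-commute : ∀ i j → suc (suc i) ≤ j → Commute (generator i) (generator j)
  far-commute i j i<<j with i ℕ.<? n | j ℕ.<? n
  ... | no  _ | _     = sym commute-ε
  ... | yes _ | no  _ = commute-ε
  ... | yes p | yes q = begin
    s₁ ∙ s₂          ≈⟨ inverseˡ-unique _ _ squared ⟩
    (s₁ ∙ s₂) ⁻¹     ≈⟨ ⁻¹-anti-homo-∙ s₁ s₂ ⟩
    s₂ ⁻¹ ∙ s₁ ⁻¹    ≈⟨ ∙-cong (inverseˡ-unique _ _ (involution _)) (inverseˡ-unique _ _ (involution _)) ⟨
    s₂ ∙ s₁          ∎
    where
    open SetoidReasoning setoid
    open GroupProperties (CoxeterGroup m)
    s₁ = Defs.s (fromℕ< p)
    s₂ = Defs.s (fromℕ< q)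
    squared : (s₁ ∙ s₂) ∙ (s₁ ∙ s₂) ≈ ε
    squared = trans (∙-congˡ (sym (identityʳ _))) (relation (fromℕ< p) (fromℕ< q)
      (pathMatrix-far {label} {n} {fromℕ< p} {fromℕ< q}
        (≡.subst₂ _≤_ (cong (λ k → suc (suc k)) (≡.sym (Fin.toℕ-fromℕ< p))) (≡.sym (Fin.toℕ-fromℕ< q)) i<<j)))

  open PathLemmas generator far-commute public
  open CoxeterPowers (CoxeterGroup m) generator far-commute square public
  open BraidMoves (CoxeterGroup m) generator far-commute square public

  edge-relation : ∀ i {k} → suc i < n → label i ≡ k → k times (generator i ∙ generator (suc i)) ≈ ε
  edge-relation i {k} i<n eq = subst (λ x → k times x ≈ ε)
    (cong₂ _∙_ (≡.trans (≡.sym (generator-toℕ _)) (cong generator (Fin.toℕ-fromℕ< i<n′)))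
               (≡.trans (≡.sym (generator-toℕ _)) (cong generator (Fin.toℕ-fromℕ< i<n))))
    (relation (fromℕ< i<n′) (fromℕ< i<n) (≡.trans
      (pathMatrix-edge {label} {n} {fromℕ< i<n′} {fromℕ< i<n}
        (≡.trans (Fin.toℕ-fromℕ< i<n) (cong suc (≡.sym (Fin.toℕ-fromℕ< i<n′)))))
      (≡.trans (cong label (Fin.toℕ-fromℕ< i<n′)) eq)))
    where i<n′ = ℕ.<⇒≤ i<n

  indices : Permutation′ n → List ℕ
  indices δ = map (λ k → toℕ (δ ⟨$⟩ʳ k)) (allFin n)

  indices-enumerates : ∀ δ → Enumerates n (indices δ)
  indices-enumerates δ =
      Uniqueₚ.map⁺ (λ eq → ≡.trans (≡.sym (Perm.inverseˡ δ)) (≡.trans (cong (δ ⟨$⟩ˡ_) (Fin.toℕ-injective eq)) (Perm.inverseˡ δ))) (Uniqueₚ.allFin⁺ n)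
    , (λ x∈ → let k , _ , eq = ∈ₗ.∈-map⁻ _ x∈ in subst (_< n) (≡.sym eq) (Fin.toℕ<n (δ ⟨$⟩ʳ k)))
    , λ {x} x<n → subst (_∈ indices δ)
        (≡.trans (cong toℕ (Perm.inverseʳ δ)) (Fin.toℕ-fromℕ< x<n))
        (∈ₗ.∈-map⁺ _ (∈ₗ.∈-allFin (δ ⟨$⟩ˡ fromℕ< x<n)))

  coxeterElement-word : ∀ δ → coxeterElement m δ ≡ word (indices δ)
  coxeterElement-word δ = go (allFin n)
    where
    go : ∀ l → foldr (λ k w → Defs.s (δ ⟨$⟩ʳ k) ∙ w) ε l ≡ word (map (λ k → toℕ (δ ⟨$⟩ʳ k)) l)
    go []      = ≡.refl
    go (k ∷ l) = cong₂ _∙_ (≡.sym (generator-toℕ _)) (go l)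

  A-power : (∀ i → suc i < n → label i ≡ 3) → suc n times initial n ≈ ε
  A-power l≡3 = times-initial-A
    (λ i i<n → braid₃ i (suc i) (edge-relation i i<n (l≡3 i i<n))) n ℕ.≤-refl

  B-power : ∀ {m} → n ≡ suc m → (∀ i → suc i < m → label i ≡ 3) → (∀ p → m ≡ suc p → label p ≡ 4) →
            (2 * n) times initial n ≈ ε
  B-power {m} ≡.refl l≡3 l≡4 = times-initial-B m
    (λ i i<m → braid₃ i (suc i) (edge-relation i (ℕ.m<n⇒m<1+n i<m) (l≡3 i i<m)))
    λ { p ≡.refl → braid₄ p (suc p) (edge-relation p ℕ.≤-refl (l≡4 p ≡.refl)) }

  coxeterElement-conjugate-initial : ∀ δ → Conjugate (coxeterElement m δ) (initial n)
  coxeterElement-conjugate-initial δ =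
    conjugate-trans (conjugate-≈ (reflexive (coxeterElement-word δ)))
                    (word-conjugate-initial (indices-enumerates δ))

  times-initial-of-word : ∀ {l k} → Enumerates n l → k times word l ≈ ε → k times initial n ≈ ε
  times-initial-of-word {_} {k} e = times-conjugate (conjugate-sym (word-conjugate-initial e)) k


  -- The recorded moves start from the bipartite order of the generators, not from the order along
  -- the path; conjugacy of the two Coxeter elements transfers the conclusion to `initial n`.
  power-by-moves : ∀ {l} k ps → Enumerates n l →
    freelyReduce (foldl (braidAt (totalMatrix m)) (repeat k l) ps) ≡ [] → k times initial n ≈ ε
  power-by-moves {l} k ps e eq =
    times-initial-of-word {l} {k} e (times-word-trivial (totalMatrix m) total-relation k l ps eq)

enumerates-0213 : Enumerates 4 (0 ∷ 2 ∷ 1 ∷ 3 ∷ [])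
enumerates-0213 =
    toWitness {a? = DecUnique.unique? ℕ._≟_ (0 ∷ 2 ∷ 1 ∷ 3 ∷ [])} _
  , All.lookup (toWitness {a? = All.all? (ℕ._<? 4) (0 ∷ 2 ∷ 1 ∷ 3 ∷ [])} _)
  , λ { {0} _ → here ≡.refl ; {1} _ → there (there (here ≡.refl)) ; {2} _ → there (here ≡.refl)
      ; {3} _ → there (there (there (here ≡.refl))) ; {suc (suc (suc (suc _)))} (s≤s (s≤s (s≤s (s≤s ())))) }

enumerates-021 : Enumerates 3 (0 ∷ 2 ∷ 1 ∷ [])
enumerates-021 =
    toWitness {a? = DecUnique.unique? ℕ._≟_ (0 ∷ 2 ∷ 1 ∷ [])} _
  , All.lookup (toWitness {a? = All.all? (ℕ._<? 3) (0 ∷ 2 ∷ 1 ∷ [])} _)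
  , λ { {0} _ → here ≡.refl ; {1} _ → there (there (here ≡.refl)) ; {2} _ → there (here ≡.refl)
      ; {suc (suc (suc _))} (s≤s (s≤s (s≤s ()))) }

TrivialPower : (ℕ → ℕ) → ℕ → ℕ → Set
TrivialPower label n h = let open PathPresentation label n; open GroupLemmas (CoxeterGroup (pathMatrix label n)) in
  Group._≈_ (CoxeterGroup (pathMatrix label n)) (h times initial n) (Group.ε (CoxeterGroup (pathMatrix label n)))

F₄-power : TrivialPower (λ k → if k ≡ᵇ 1 then 4 else 3) 4 12
F₄-power = PathPresentation.power-by-moves _ 4 12 F₄-moves enumerates-0213 ≡.refl

H₃-power : TrivialPower (λ k → if k ≡ᵇ 1 then 5 else 3) 3 10
H₃-power = PathPresentation.power-by-moves _ 3 10 H₃-moves enumerates-021 ≡.refl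

H₄-power : TrivialPower (λ k → if k ≡ᵇ 2 then 5 else 3) 4 30
H₄-power = PathPresentation.power-by-moves _ 4 30 H₄-moves enumerates-0213 ≡.refl

A-power : ∀ n → TrivialPower (λ _ → 3) n (n + 1)
A-power n rewrite ℕ.+-comm n 1 = PathPresentation.A-power _ n λ _ _ → ≡.refl

B-label : ℕ → ℕ → ℕ
B-label n k = if k + 2 ≡ᵇ n then 4 else 3

B-label≡4 : ∀ {n} k → suc (suc k) ≡ n → B-label n k ≡ 4
B-label≡4 k ≡.refl with k + 2 ≡ᵇ suc (suc k) | ℕ.≡⇒≡ᵇ (k + 2) (suc (suc k)) (ℕ.+-comm k 2)
... | true | _ = ≡.refl

B-label≡3 : ∀ {n} k → suc (suc k) ≢ n → B-label n k ≡ 3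
B-label≡3 {n} k ne with k + 2 ≡ᵇ n in eq
... | false = ≡.refl
... | true  = ⊥-elim (ne (≡.trans (ℕ.+-comm 2 k) (ℕ.≡ᵇ⇒≡ (k + 2) n (subst IsTrue (≡.sym eq) _))))

B-power : ∀ n → TrivialPower (B-label (suc n)) (suc n) (2 * suc n)
B-power n = PathPresentation.B-power _ (suc n) ≡.refl
  (λ i i<n → B-label≡3 i λ eq → ℕ.<-irrefl (ℕ.suc-injective eq) i<n) λ { p ≡.refl → B-label≡4 p ≡.refl }

-- The action of the Coxeter group on flags

module FlagEquality {n} (P : FaceComplex n) where
  open Flag

  -- A record, so that the two flags can be inferred from a proof.
  record _≋_ (F G : Flag P) : Set where
    constructor pointwise
    field at : _≈ᶠ_ P F G
  open _≋_ public

  flagSetoid : Setoid _ _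
  flagSetoid = record
    { Carrier       = Flag P
    ; _≈_           = _≋_
    ; isEquivalence = record
      { refl  = pointwise λ _ → ≡.refl
      ; sym   = λ p → pointwise λ i → ≡.sym (at p i)
      ; trans = λ p q → pointwise λ i → ≡.trans (at p i) (at q i)
      }
    }

  differ-sym : ∀ i F G → DifferPreciselyAt P i F G → DifferPreciselyAt P i G F
  differ-sym i F G (ne , eq) = (λ e → ne (≡.sym e)) , λ j j≢i → ≡.sym (eq j j≢i)

  differ-resp : ∀ i {F F′ G G′} → F ≋ F′ → G ≋ G′ → DifferPreciselyAt P i F G → DifferPreciselyAt P i F′ G′
  differ-resp i p q (ne , eq) =
      (λ e → ne (≡.trans (at p i) (≡.trans e (≡.sym (at q i)))))
    , λ j j≢i → ≡.trans (≡.sym (at p j)) (≡.trans (eq j j≢i) (at q j))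

module ZigzagAction {n} (P : FaceComplex n) (adjacent : UniqueAdjacentFlags P) where
  open FlagEquality P
  open Zigzag P adjacent
  open Setoid flagSetoid

  σ-differ : ∀ i F → DifferPreciselyAt P i F (σ i F)
  σ-differ i F = proj₁ (proj₂ (adjacent i F))

  σ-unique : ∀ i F G → DifferPreciselyAt P i F G → σ i F ≈ G
  σ-unique i F G differ = pointwise (proj₂ (proj₂ (adjacent i F)) {G} differ)

  σ-cong : ∀ i {F G} → F ≈ G → σ i F ≈ σ i G
  σ-cong i {F} {G} F≈G = σ-unique i F (σ i G) (differ-resp i {G = σ i G} (sym F≈G) refl (σ-differ i G))

  σ-involutive : ∀ i F → σ i (σ i F) ≈ F
  σ-involutive i F = σ-unique i (σ i F) F (differ-sym i F (σ i F) (σ-differ i F))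

  iterate-cong : ∀ {f : Flag P → Flag P} → (∀ {F G} → F ≈ G → f F ≈ f G) →
    ∀ k {F G} → F ≈ G → iterate f F k ≈ iterate f G k
  iterate-cong f-cong zero    p = p
  iterate-cong f-cong (suc k) p = iterate-cong f-cong k (f-cong p)

  iterate-inverse : ∀ {f g : Flag P → Flag P} → (∀ {F G} → F ≈ G → g F ≈ g G) → (∀ F → g (f F) ≈ F) →
    ∀ k F → iterate g (iterate f F k) k ≈ F
  iterate-inverse g-cong gf zero    F = refl
  iterate-inverse {f} {g} g-cong gf (suc k) F = trans (reflexive (shift g k _))
    (trans (g-cong (iterate-inverse g-cong gf k (f F))) (gf F))
    where
    shift : ∀ (g : Flag P → Flag P) k F → iterate g (g F) k ≡ g (iterate g F k)
    shift g zero    F = ≡.refl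
    shift g (suc k) F = shift g k (g F)

  module _ (label : ℕ → ℕ)
    (far-σ : ∀ i j → suc (suc (toℕ i)) ≤ toℕ j → ∀ F → σ j (σ i F) ≈ σ i (σ j F))
    (edge-σ : ∀ i j → toℕ j ≡ suc (toℕ i) → ∀ F → iterate (λ F → σ j (σ i F)) F (label (toℕ i)) ≈ F) where

    private
      m = pathMatrix label n

    relation-σ : ∀ i j F → iterate (λ F → σ j (σ i F)) F (m i j) ≈ F
    relation-σ i j F with pathRelation i j
    ... | same ≡.refl rewrite pathMatrix-refl {label} {n} {i} ≡.refl = σ-involutive i F
    ... | edge e rewrite pathMatrix-edge {label} {n} {i} {j} e = edge-σ i j e F
    ... | edge′ e rewrite ≡.trans (pathMatrix-sym label n i j) (pathMatrix-edge {label} {n} {j} {i} e) =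
      -- The hypothesis concerns the two moves in increasing order; composed in the other order they
      -- are the inverse, which has the same trivial power.
      trans (iterate-cong cong₂σ (label (toℕ j)) (sym (edge-σ j i e F)))
            (iterate-inverse cong₂σ (λ F → trans (σ-cong j (σ-involutive i _)) (σ-involutive j F)) (label (toℕ j)) F)
      where
      cong₂σ : ∀ {F G} → F ≈ G → σ j (σ i F) ≈ σ j (σ i G)
      cong₂σ p = σ-cong j (σ-cong i p)
    ... | far f rewrite pathMatrix-far {label} {n} {i} {j} f =
      trans (σ-cong j (sym (far-σ i j f _)) )
        (trans (σ-involutive j _) (σ-involutive i F))
    ... | far′ f rewrite ≡.trans (pathMatrix-sym label n i j) (pathMatrix-far {label} {n} {j} {i} f) =
      trans (σ-cong j (far-σ j i f _))
        (trans (σ-involutive j _) (σ-involutive i F))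

    -- A right action: the leftmost letter is applied first, as in `T`, so that `coxeterElement m δ`
    -- acts exactly as `T δ`. Inverses are handled by a second recursion that reverses the order of
    -- products, since each generator is undone by itself.
    act act⁻¹ : Term m → Flag P → Flag P
    act (Defs.s i)      = σ i
    act Defs.ε          = id
    act (x Defs.∙ y)    = act y ∘ act x
    act (x Defs.⁻¹)     = act⁻¹ x
    act⁻¹ (Defs.s i)    = σ i
    act⁻¹ Defs.ε        = id
    act⁻¹ (x Defs.∙ y)  = act⁻¹ x ∘ act⁻¹ y
    act⁻¹ (x Defs.⁻¹)   = act x

    act-cong : ∀ x {F G} → F ≈ G → act x F ≈ act x G
    act⁻¹-cong : ∀ x {F G} → F ≈ G → act⁻¹ x F ≈ act⁻¹ x G
    act-cong (Defs.s i)       p = σ-cong i p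
    act-cong Defs.ε           p = p
    act-cong (x Defs.∙ y)     p = act-cong y (act-cong x p)
    act-cong (x Defs.⁻¹)      p = act⁻¹-cong x p
    act⁻¹-cong (Defs.s i)     p = σ-cong i p
    act⁻¹-cong Defs.ε         p = p
    act⁻¹-cong (x Defs.∙ y)   p = act⁻¹-cong x (act⁻¹-cong y p)
    act⁻¹-cong (x Defs.⁻¹)    p = act-cong x p

    act-act⁻¹ : ∀ x F → act x (act⁻¹ x F) ≈ F
    act⁻¹-act : ∀ x F → act⁻¹ x (act x F) ≈ F
    act-act⁻¹ (Defs.s i)     F = σ-involutive i F
    act-act⁻¹ Defs.ε         F = refl
    act-act⁻¹ (x Defs.∙ y)   F = trans (act-cong y (act-act⁻¹ x _)) (act-act⁻¹ y F)
    act-act⁻¹ (x Defs.⁻¹)    F = act⁻¹-act x F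
    act⁻¹-act (Defs.s i)     F = σ-involutive i F
    act⁻¹-act Defs.ε         F = refl
    act⁻¹-act (x Defs.∙ y)   F = trans (act⁻¹-cong x (act⁻¹-act y _)) (act⁻¹-act x F)
    act⁻¹-act (x Defs.⁻¹)    F = act-act⁻¹ x F

    act-termPower : ∀ x k F → act (termPower m k x) F ≡ iterate (act x) F k
    act-termPower x zero    F = ≡.refl
    act-termPower x (suc k) F = act-termPower x k (act x F)

    act-sound : ∀ {x y} → Defs._≈_ m x y → ∀ F → act x F ≈ act y F
    act-sound Defs.refl             F = refl
    act-sound (Defs.sym p)          F = sym (act-sound p F)
    act-sound (Defs.trans p q)      F = trans (act-sound p F) (act-sound q F)
    act-sound (Defs.∙-cong {y = y} {u} p q) F = trans (act-cong u (act-sound p F)) (act-sound q (act y F))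
    act-sound (Defs.⁻¹-cong {x} {y} p) F =
      trans (act⁻¹-cong x (sym (act-act⁻¹ y F)))
        (trans (act⁻¹-cong x (sym (act-sound p (act⁻¹ y F)))) (act⁻¹-act x _))
    act-sound (Defs.assoc x y z)    F = refl
    act-sound (Defs.identityˡ x)    F = refl
    act-sound (Defs.identityʳ x)    F = refl
    act-sound (Defs.inverseˡ x)     F = act-act⁻¹ x F
    act-sound (Defs.inverseʳ x)     F = act⁻¹-act x F
    act-sound (Defs.relation i j)   F =
      trans (reflexive (act-termPower (Defs.s i Defs.∙ Defs.s j) (m i j) F)) (relation-σ i j F)

    open Group (CoxeterGroup m) using () renaming (_∙_ to _·_; sym to ≈-sym; trans to ≈-trans)
    open GroupLemmas (CoxeterGroup m)
    open PathPresentation label n using (initial; coxeterElement-conjugate-initial)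

    act-times : ∀ x k F → act (k times x) F ≡ iterate (act x) F k
    act-times x zero    F = ≡.refl
    act-times x (suc k) F = act-times x k (act x F)

    act-coxeterElement : ∀ δ F → act (coxeterElement m δ) F ≡ T δ F
    act-coxeterElement δ = go (allFin n)
      where
      go : ∀ l F → act (foldr (λ k w → Defs.s (δ ⟨$⟩ʳ k) Defs.∙ w) Defs.ε l) F
                 ≡ foldl (λ G k → σ (δ ⟨$⟩ʳ k) G) F l
      go []      F = ≡.refl
      go (k ∷ l) F = go l (σ (δ ⟨$⟩ʳ k) F)

    act-times-coxeterElement : ∀ δ k F → act (k times coxeterElement m δ) F ≡ iterate (T δ) F k
    act-times-coxeterElement δ k F = ≡.trans (act-times _ k F) (iterate-≗ (act-coxeterElement δ) k F)
      where
      iterate-≗ : ∀ {f g : Flag P → Flag P} → (∀ F → f F ≡ g F) → ∀ k F → iterate f F k ≡ iterate g F k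
      iterate-≗ f≗g zero    F = ≡.refl
      iterate-≗ {f} f≗g (suc k) F = ≡.trans (cong (λ G → iterate f G k) (f≗g F)) (iterate-≗ f≗g k _)

    module _ (h : ℕ) (0<h : 0 < h) (power : TrivialPower label n h) (F₀ : Flag P)
      (aperiodic : ∀ F k → 0 < k → k < h → ¬ (iterate (T Perm.id) F k ≈ F)) where

      coxeterElement-power : ∀ δ → Defs._≈_ m (h times coxeterElement m δ) Defs.ε
      coxeterElement-power δ = times-conjugate (coxeterElement-conjugate-initial δ) h power

      -- Coxeter elements are conjugate, so a flag fixed by a power of T δ is moved by the action
      -- of the group to one fixed by the same power of T id.
      period-bound : ∀ δ F k → 0 < k → iterate (T δ) F k ≈ F → h ≤ k
      period-bound δ F k 0<k fixed = ℕ.≮⇒≥ λ k<h → aperiodic (act g F) k 0<k k<h (begin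
        iterate (T Perm.id) (act g F) k                  ≡⟨ act-times-coxeterElement Perm.id k _ ⟨
        act (g · k times coxeterElement m Perm.id) F     ≈⟨ act-sound (times-intertwine intertwines k) F ⟨
        act g (act (k times coxeterElement m δ) F)       ≡⟨ cong (act g) (act-times-coxeterElement δ k F) ⟩
        act g (iterate (T δ) F k)                        ≈⟨ act-cong g fixed ⟩
        act g F                                          ∎)
        where
        open SetoidReasoning flagSetoid
        conjugating = conjugate-trans (coxeterElement-conjugate-initial δ)
                                      (conjugate-sym (coxeterElement-conjugate-initial Perm.id))
        g = proj₁ conjugating
        intertwines = proj₂ conjugating

      -- One flag is enough for the lower bound: a trivial power of the Coxeter element fixes `F₀`.
      coxeterNumber : IsCoxeterNumber m h
      coxeterNumber δ = 0<h , coxeterElement-power δ , λ k 0<k p →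
        period-bound δ F₀ k 0<k (trans (reflexive (≡.sym (act-times-coxeterElement δ k F₀))) (act-sound p F₀))

      zigzagLengths : ∀ δ F → IsZigzagLength δ F h
      zigzagLengths δ F =
          0<h
        , at (trans (reflexive (≡.sym (act-times-coxeterElement δ h F))) (act-sound (coxeterElement-power δ) F))
        , λ k 0<k fixed → period-bound δ F k 0<k (pointwise fixed)

-- Codes are concrete data on which the neighbours of a flag can be written down. If `move` gives a
-- flag that differs in the prescribed face, and the only such flag, then adjacent flags exist
-- uniquely, σ is represented by `move`, and both the Coxeter relations and aperiodicity become
-- statements about `move`.
module CodedFlags {n} (P : FaceComplex n) {Code : Set} (flagOf : Code → Flag P)
  (codeOf : ∀ F → ∃[ c ] FlagEquality._≋_ P (flagOf c) F) (move : Fin n → Code → Code)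
  (move-differ : ∀ i c → DifferPreciselyAt P i (flagOf c) (flagOf (move i c)))
  (move-unique : ∀ i c d → DifferPreciselyAt P i (flagOf c) (flagOf d) →
    FlagEquality._≋_ P (flagOf (move i c)) (flagOf d))
  where
  open FlagEquality P
  open Setoid flagSetoid

  adjacentFlags : UniqueAdjacentFlags P
  adjacentFlags i F = flagOf (move i c) , differ-resp i {G = flagOf (move i c)} c≈F refl (move-differ i c) , λ {G} differ →
    let d , d≈G = codeOf G
    in at (trans (move-unique i c d (differ-resp i {F} {G = G} (sym c≈F) (sym d≈G) differ)) d≈G)
    where
    c = proj₁ (codeOf F)
    c≈F = proj₂ (codeOf F)

  open Zigzag P adjacentFlags
  open ZigzagAction P adjacentFlags

  rotate : Code → Code
  rotate c = foldl (λ d i → move i d) c (allFin n)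

  σ-flagOf : ∀ i c → σ i (flagOf c) ≈ flagOf (move i c)
  σ-flagOf i c = σ-unique i (flagOf c) (flagOf (move i c)) (move-differ i c)

  T-flagOf : ∀ c → T Perm.id (flagOf c) ≈ flagOf (rotate c)
  T-flagOf c = go (allFin n) refl
    where
    go : ∀ l {F c} → F ≈ flagOf c → foldl (λ G k → σ k G) F l ≈ flagOf (foldl (λ d i → move i d) c l)
    go []      p = p
    go (i ∷ l) p = go l (trans (σ-cong i p) (σ-flagOf i _))

  iterate-flagOf : ∀ {f : Flag P → Flag P} {g : Code → Code} → (∀ {F G} → F ≈ G → f F ≈ f G) →
    (∀ c → f (flagOf c) ≈ flagOf (g c)) → ∀ k c → iterate f (flagOf c) k ≈ flagOf (iterate g c k)
  iterate-flagOf f-cong fg zero    c = refl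
  iterate-flagOf f-cong fg (suc k) c =
    trans (iterate-cong f-cong k (fg c)) (iterate-flagOf f-cong fg k _)

  T-cong : ∀ {F G} → F ≈ G → T Perm.id F ≈ T Perm.id G
  T-cong = go (allFin n)
    where
    go : ∀ l {F G} → F ≈ G → foldl (λ G k → σ k G) F l ≈ foldl (λ G k → σ k G) G l
    go []      p = p
    go (i ∷ l) p = go l (σ-cong i p)

  lengths : (label : ℕ → ℕ)
    (far-move : ∀ i j → suc (suc (toℕ i)) ≤ toℕ j → ∀ c → flagOf (move j (move i c)) ≈ flagOf (move i (move j c)))
    (edge-move : ∀ i j → toℕ j ≡ suc (toℕ i) → ∀ c →
      flagOf (iterate (λ d → move j (move i d)) c (label (toℕ i))) ≈ flagOf c)
    (h : ℕ) → 0 < h → TrivialPower label n h → Code →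
    (∀ c k → 0 < k → k < h → ¬ (flagOf (iterate rotate c k) ≈ flagOf c)) →
    IsCoxeterNumber (pathMatrix label n) h × ZigzagsHaveLength P h
  lengths label far-move edge-move h 0<h power c₀ aperiodic =
      coxeterNumber label far-σ edge-σ h 0<h power (flagOf c₀) aperiodic-σ
    , adjacentFlags , zigzagLengths label far-σ edge-σ h 0<h power (flagOf c₀) aperiodic-σ
    where
    σσ-flagOf : ∀ i j c → σ j (σ i (flagOf c)) ≈ flagOf (move j (move i c))
    σσ-flagOf i j c = trans (σ-cong j (σ-flagOf i c)) (σ-flagOf j _)

    far-σ : ∀ i j → suc (suc (toℕ i)) ≤ toℕ j → ∀ F → σ j (σ i F) ≈ σ i (σ j F)
    far-σ i j f F = trans (σ-cong j (σ-cong i (sym c≈F))) (trans (σσ-flagOf i j c)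
      (trans (far-move i j f c) (trans (sym (σσ-flagOf j i c)) (σ-cong i (σ-cong j c≈F)))))
      where
      c = proj₁ (codeOf F)
      c≈F = proj₂ (codeOf F)

    edge-σ : ∀ i j → toℕ j ≡ suc (toℕ i) → ∀ F → iterate (λ F → σ j (σ i F)) F (label (toℕ i)) ≈ F
    edge-σ i j e F = trans (iterate-cong cong₂σ k (sym c≈F))
      (trans (iterate-flagOf cong₂σ (σσ-flagOf i j) k c) (trans (edge-move i j e c) c≈F))
      where
      k = label (toℕ i)
      c = proj₁ (codeOf F)
      c≈F = proj₂ (codeOf F)
      cong₂σ : ∀ {F G} → F ≈ G → σ j (σ i F) ≈ σ j (σ i G)
      cong₂σ p = σ-cong j (σ-cong i p)

    aperiodic-σ : ∀ F k → 0 < k → k < h → ¬ (iterate (T Perm.id) F k ≈ F)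
    aperiodic-σ F k 0<k k<h fixed = aperiodic c k 0<k k<h
      (trans (sym (iterate-flagOf T-cong T-flagOf k c))
        (trans (iterate-cong T-cong k c≈F) (trans fixed (sym c≈F))))
      where
      c = proj₁ (codeOf F)
      c≈F = proj₂ (codeOf F)

-- Flags of simplicial complexes

infix 4 _∈ˢ_ _∉ˢ_
_∈ˢ_ _∉ˢ_ : ∀ {N} → Fin N → Subset N → Set
_∈ˢ_ = Subset._∈_
_∉ˢ_ = Subset._∉_

infixl 6 _⊕_
_⊕_ : ∀ {N} → Subset N → Fin N → Subset N
X ⊕ a = X ∪ ⁅ a ⁆

module _ {N : ℕ} where

  ∈-insert⁻ : ∀ {x} X (a : Fin N) → x ∈ˢ X ⊕ a → x ∈ˢ X ⊎ x ≡ a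
  ∈-insert⁻ X a x∈ = [ inj₁ , inj₂ ∘ Subsetₚ.x∈⁅y⁆⇒x≡y a ]′ (Subsetₚ.x∈p∪q⁻ X ⁅ a ⁆ x∈)

  ∈-insertˡ : ∀ {x X} (a : Fin N) → x ∈ˢ X → x ∈ˢ X ⊕ a
  ∈-insertˡ a x∈ = Subsetₚ.x∈p∪q⁺ (inj₁ x∈)

  ∈-insertʳ : ∀ X (a : Fin N) → a ∈ˢ X ⊕ a
  ∈-insertʳ X a = Subsetₚ.x∈p∪q⁺ (inj₂ (Subsetₚ.x∈⁅x⁆ a))

  ∉-insert : ∀ {x X} {a : Fin N} → x ∉ˢ X → x ≢ a → x ∉ˢ X ⊕ a
  ∉-insert {X = X} {a} x∉ x≢a x∈ = [ x∉ , x≢a ]′ (∈-insert⁻ X a x∈)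

  ∉-insert⁻ : ∀ {x} X (a : Fin N) → x ∉ˢ X ⊕ a → x ∉ˢ X × x ≢ a
  ∉-insert⁻ X a x∉ = x∉ ∘ ∈-insertˡ a , λ { ≡.refl → x∉ (∈-insertʳ X a) }

  insert-⊆ : ∀ {X Y} {a : Fin N} → X ⊆ Y → a ∈ˢ Y → X ⊕ a ⊆ Y
  insert-⊆ {X} {Y} {a} X⊆Y a∈Y x∈ = [ X⊆Y , (λ { ≡.refl → a∈Y }) ]′ (∈-insert⁻ X a x∈)

  insert-comm : ∀ X (a b : Fin N) → X ⊕ a ⊕ b ≡ X ⊕ b ⊕ a
  insert-comm X a b = ≡.trans (Subsetₚ.∪-assoc X ⁅ a ⁆ ⁅ b ⁆)
    (≡.trans (cong (X ∪_) (Subsetₚ.∪-comm ⁅ a ⁆ ⁅ b ⁆)) (≡.sym (Subsetₚ.∪-assoc X ⁅ b ⁆ ⁅ a ⁆)))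

  insert-cancelˡ : ∀ {X} {a b : Fin N} → a ∉ˢ X → X ⊕ a ≡ X ⊕ b → a ≡ b
  insert-cancelˡ {X} {a} {b} a∉ eq =
    [ ⊥-elim ∘ a∉ , id ]′ (∈-insert⁻ X b (subst (a ∈ˢ_) eq (∈-insertʳ X a)))

  ⊆∧∣∣≤⇒≡ : ∀ {X Y : Subset N} → X ⊆ Y → ∣ Y ∣ ≤ ∣ X ∣ → X ≡ Y
  ⊆∧∣∣≤⇒≡ {X} {Y} X⊆Y ∣Y∣≤∣X∣ = Subsetₚ.⊆-antisym X⊆Y Y⊆X
    where
    Y⊆X : Y ⊆ X
    Y⊆X {x} x∈Y with x Subsetₚ.∈? X
    ... | yes x∈X = x∈X
    ... | no  x∉X = ⊥-elim (ℕ.<⇒≱ (Subsetₚ.p⊂q⇒∣p∣<∣q∣ (X⊆Y , x , x∈Y , x∉X)) ∣Y∣≤∣X∣)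

  ⊆∧∣∣<⇒⊂ : ∀ {X Y : Subset N} → X ⊆ Y → ∣ X ∣ < ∣ Y ∣ → X ⊂ Y
  ⊆∧∣∣<⇒⊂ {X} {Y} X⊆Y ∣X∣<∣Y∣ with Subsetₚ.nonempty? (Y ─ X)
  ... | yes (x , x∈) = X⊆Y , x , Subsetₚ.p─q⊆p Y X x∈ , ∉X
    where
    ∉X : x ∉ˢ X
    ∉X x∈X = Subsetₚ.∉⊥ (subst (x ∈ˢ_) (─-∩-⊥ Y X) (Subsetₚ.x∈p∩q⁺ (x∈ , x∈X)))
      where
      ─-∩-⊥ : ∀ {N} (Y X : Subset N) → (Y ─ X) Subset.∩ X ≡ ⊥
      ─-∩-⊥ []      []          = ≡.refl
      ─-∩-⊥ (y ∷ Y) (true  ∷ X) = cong (false ∷_) (─-∩-⊥ Y X)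
      ─-∩-⊥ (y ∷ Y) (false ∷ X) = cong₂ _∷_ (Bool.∧-zeroʳ y) (─-∩-⊥ Y X)
  ... | no empty = ⊥-elim (ℕ.<⇒≱ ∣X∣<∣Y∣ (Subsetₚ.p⊆q⇒∣p∣≤∣q∣ Y⊆X))
    where
    Y⊆X : Y ⊆ X
    Y⊆X {x} x∈Y with x Subsetₚ.∈? X
    ... | yes x∈X = x∈X
    ... | no  x∉X = ⊥-elim (empty (x , Subsetₚ.x∈p∧x∉q⇒x∈p─q x∈Y x∉X))

∣insert∣ : ∀ {N} {X : Subset N} {a} → a ∉ˢ X → ∣ X ⊕ a ∣ ≡ suc ∣ X ∣
∣insert∣ {X = true  ∷ X} {zero}  a∉ = ⊥-elim (a∉ Vec.here)
∣insert∣ {X = false ∷ X} {zero}  a∉ = cong (suc ∘ ∣_∣) (Subsetₚ.∪-identityʳ X)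
∣insert∣ {X = true  ∷ X} {suc a} a∉ = cong suc (∣insert∣ (a∉ ∘ Vec.there))
∣insert∣ {X = false ∷ X} {suc a} a∉ = ∣insert∣ (a∉ ∘ Vec.there)

∣X∣≡1+k⇒nonempty : ∀ {N k} {X : Subset N} → ∣ X ∣ ≡ suc k → ∃[ x ] x ∈ˢ X
∣X∣≡1+k⇒nonempty {N} {X = X} eq with Subsetₚ.nonempty? X
... | yes ne = ne
... | no  e with () ← ≡.trans (≡.sym eq) (≡.trans (cong ∣_∣ (Subsetₚ.Empty-unique e)) (Subsetₚ.∣⊥∣≡0 N))

∉-remove : ∀ {N} (X : Subset N) x → x ∉ˢ X Subset.- x
∉-remove (_ ∷ X) (suc x) (Vec.there x∈) = ∉-remove X x x∈

remove-insert : ∀ {N} {X : Subset N} {x} → x ∈ˢ X → ∃[ Y ] x ∉ˢ Y × X ≡ Y ⊕ x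
remove-insert {X = X} {x} x∈ =
  X Subset.- x , ∉-remove X x , Subsetₚ.⊆-antisym ⊆₁ (insert-⊆ (Subsetₚ.p─q⊆p X ⁅ x ⁆) x∈)
  where
  ⊆₁ : X ⊆ (X Subset.- x) ⊕ x
  ⊆₁ {y} y∈ with y Fin.≟ x
  ... | yes ≡.refl = ∈-insertʳ (X Subset.- x) x
  ... | no  y≢x    = ∈-insertˡ x (Subsetₚ.x∈p∧x≢y⇒x∈p-y y∈ y≢x)

⊂-card-suc : ∀ {N} {X Y : Subset N} → X ⊆ Y → ∣ Y ∣ ≡ suc ∣ X ∣ → ∃[ a ] a ∉ˢ X × Y ≡ X ⊕ a
⊂-card-suc {X = X} {Y} X⊆Y eq with _ , a , a∈Y , a∉X ← ⊆∧∣∣<⇒⊂ X⊆Y (ℕ.≤-reflexive (≡.sym eq)) =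
  a , a∉X , ≡.sym (⊆∧∣∣≤⇒≡ (insert-⊆ X⊆Y a∈Y) (ℕ.≤-reflexive (≡.trans eq (≡.sym (∣insert∣ a∉X)))))

insert-between : ∀ {N} {X Z : Subset N} {a} → X ⊆ Z → Z ⊆ X ⊕ a → Z ≡ X ⊎ Z ≡ X ⊕ a
insert-between {X = X} {Z} {a} X⊆Z Z⊆ with a Subsetₚ.∈? Z
... | yes a∈ = inj₂ (Subsetₚ.⊆-antisym Z⊆ (insert-⊆ X⊆Z a∈))
... | no  a∉ = inj₁ (Subsetₚ.⊆-antisym
  (λ z∈ → [ id , (λ { ≡.refl → ⊥-elim (a∉ z∈) }) ]′ (∈-insert⁻ X a (Z⊆ z∈))) X⊆Z)

module CoveringFaces {n} (P : FaceComplex n) where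
  open FaceComplex P

  ∣∣⇒covers : ∀ {X Y} → X ⊆ Y → ∣ Y ∣ ≡ suc ∣ X ∣ → Covers P Y X
  ∣∣⇒covers X⊆Y eq = ⊆∧∣∣<⇒⊂ X⊆Y (ℕ.≤-reflexive (≡.sym eq)) , λ Z _ X⊂Z Z⊂Y →
    ℕ.<⇒≱ (Subsetₚ.p⊂q⇒∣p∣<∣q∣ X⊂Z) (s≤s⁻¹ (ℕ.≤-trans (Subsetₚ.p⊂q⇒∣p∣<∣q∣ Z⊂Y) (ℕ.≤-reflexive eq)))

  covers-≡ : ∀ {X Y Z} → Covers P Y X → IsFace Z → X ⊂ Z → Z ⊆ Y → Z ≡ Y
  covers-≡ {Z = Z} (_ , between) face X⊂Z Z⊆Y = ⊆∧∣∣≤⇒≡ Z⊆Y (ℕ.≮⇒≥ λ lt → between Z face X⊂Z (⊆∧∣∣<⇒⊂ Z⊆Y lt))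

  rank⇒face : ∀ k Y → IsFaceOfRank P k Y → IsFace Y
  rank⇒face zero    Y = proj₁
  rank⇒face (suc k) Y = proj₁

module SimplicialFlags {m : ℕ} (P : FaceComplex (suc m))
  (face-⊆ : ∀ {X Y} → FaceComplex.IsFace P Y → X ⊆ Y → FaceComplex.IsFace P X)
  (∣face∣≤ : ∀ {X} → FaceComplex.IsFace P X → ∣ X ∣ ≤ suc m)
  (opposite : Subset (FaceComplex.#vertices P) → Fin (FaceComplex.#vertices P) → Fin (FaceComplex.#vertices P))
  (opposite∉ : ∀ X a → a ∉ˢ X → ∣ X ∣ ≡ m → FaceComplex.IsFace P (X ⊕ a) → opposite X a ∉ˢ X)
  (opposite≢ : ∀ X a → a ∉ˢ X → ∣ X ∣ ≡ m → FaceComplex.IsFace P (X ⊕ a) → opposite X a ≢ a)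
  (opposite-face : ∀ X a → a ∉ˢ X → ∣ X ∣ ≡ m → FaceComplex.IsFace P (X ⊕ a) →
    FaceComplex.IsFace P (X ⊕ opposite X a))
  (opposite-unique : ∀ X a → a ∉ˢ X → ∣ X ∣ ≡ m → FaceComplex.IsFace P (X ⊕ a) →
    ∀ b → b ∉ˢ X → FaceComplex.IsFace P (X ⊕ b) → b ≢ a → b ≡ opposite X a)
  where
  open FaceComplex P
  open CoveringFaces P

  private
    N n : ℕ
    N = #vertices
    n = suc m

  -- Subsets of faces are faces, so for `a` in Y but not in X the set `X ⊕ a` is a face strictly
  -- above X and inside Y. A cover therefore adds a single vertex, and the rank is determined by
  -- counting.
  rank⇒∣∣ : ∀ k Y → IsFaceOfRank P k Y → ∣ Y ∣ ≡ suc k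
  covers⇒∣∣ : ∀ {X Y} → IsFace Y → Covers P Y X → ∣ Y ∣ ≡ suc ∣ X ∣
  covers⇒∣∣ {X} {Y} faceY covers@((X⊆Y , a , a∈Y , a∉X) , _) =
    ≡.trans (cong ∣_∣ (≡.sym X⊕a≡Y)) (∣insert∣ a∉X)
    where
    X⊕a⊆Y : X ⊕ a ⊆ Y
    X⊕a⊆Y = insert-⊆ X⊆Y a∈Y
    X⊕a≡Y : X ⊕ a ≡ Y
    X⊕a≡Y = covers-≡ covers (face-⊆ faceY X⊕a⊆Y) (∈-insertˡ a , a , ∈-insertʳ X a , a∉X) X⊕a⊆Y
  rank⇒∣∣ zero    Y (face , covers) = ≡.trans (covers⇒∣∣ face covers) (cong suc (Subsetₚ.∣⊥∣≡0 N))
  rank⇒∣∣ (suc k) Y (face , X , rankX , covers) = ≡.trans (covers⇒∣∣ face covers) (cong suc (rank⇒∣∣ k X rankX))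

  ∣∣⇒rank : ∀ k Y → IsFace Y → ∣ Y ∣ ≡ suc k → IsFaceOfRank P k Y
  ∣∣⇒rank zero Y face eq = face , ∣∣⇒covers (λ x∈ → ⊥-elim (Subsetₚ.∉⊥ x∈))
    (≡.trans eq (cong suc (≡.sym (Subsetₚ.∣⊥∣≡0 N))))
  ∣∣⇒rank (suc k) Y face eq
    with x , x∈ ← ∣X∣≡1+k⇒nonempty {X = Y} eq
    with X , x∉ , ≡.refl ← remove-insert {X = Y} x∈ =
    face , X , ∣∣⇒rank k X (face-⊆ face (∈-insertˡ x)) ∣X∣≡ , ∣∣⇒covers (∈-insertˡ x) (∣insert∣ x∉)
    where
    ∣X∣≡ : ∣ X ∣ ≡ suc k
    ∣X∣≡ = ℕ.suc-injective (≡.trans (≡.sym (∣insert∣ x∉)) eq)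

  faces : ∀ {l} → Subset N → Vec (Fin N) l → Fin l → Subset N
  faces X (a ∷ v) zero    = X ⊕ a
  faces X (a ∷ v) (suc i) = faces (X ⊕ a) v i

  Valid : ∀ {l} → Subset N → Vec (Fin N) l → Set
  Valid X []      = IsFace X
  Valid X (a ∷ v) = a ∉ˢ X × Valid (X ⊕ a) v

  insertAll : ∀ {l} → Subset N → Vec (Fin N) l → Subset N
  insertAll X []      = X
  insertAll X (a ∷ v) = insertAll (X ⊕ a) v

  valid⇒face : ∀ {l} X (v : Vec (Fin N) l) → Valid X v → IsFace X
  valid⇒face X []      face        = face
  valid⇒face X (a ∷ v) (_ , valid) = face-⊆ (valid⇒face (X ⊕ a) v valid) (∈-insertˡ a)

  faces-face : ∀ {l} X (v : Vec (Fin N) l) → Valid X v → ∀ i → IsFace (faces X v i)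
  faces-face X (a ∷ v) (_ , valid) zero    = valid⇒face (X ⊕ a) v valid
  faces-face X (a ∷ v) (_ , valid) (suc i) = faces-face (X ⊕ a) v valid i

  ∣faces∣ : ∀ {l} X (v : Vec (Fin N) l) → Valid X v → ∀ i → ∣ faces X v i ∣ ≡ suc (∣ X ∣ + toℕ i)
  ∣faces∣ X (a ∷ v) (a∉ , valid) zero    = ≡.trans (∣insert∣ a∉) (cong suc (≡.sym (ℕ.+-identityʳ _)))
  ∣faces∣ X (a ∷ v) (a∉ , valid) (suc i) = ≡.trans (∣faces∣ (X ⊕ a) v valid i)
    (cong suc (≡.trans (cong (_+ toℕ i) (∣insert∣ a∉)) (≡.sym (ℕ.+-suc ∣ X ∣ (toℕ i)))))

  base⊆faces : ∀ {l} X (v : Vec (Fin N) l) i → X ⊆ faces X v i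
  base⊆faces X (a ∷ v) zero    x∈ = ∈-insertˡ a x∈
  base⊆faces X (a ∷ v) (suc i) x∈ = base⊆faces (X ⊕ a) v i (∈-insertˡ a x∈)

  faces-⊆ : ∀ {l} X (v : Vec (Fin N) l) {i j} → i <ᶠ j → faces X v i ⊆ faces X v j
  faces-⊆ X (a ∷ v) {zero}  {suc j} _         = base⊆faces (X ⊕ a) v j
  faces-⊆ X (a ∷ v) {suc i} {suc j} (s≤s i<j) = faces-⊆ (X ⊕ a) v i<j

  -- Climb the chain while the next vertex belongs to `Z`. At the first vertex outside `Z`,
  -- comparability with the next face forces `Z` below it, hence equal to the face just reached. If
  -- no such vertex occurs, the bound on the size of faces ends the climb.
  faces-maximal : ∀ {l} X (v : Vec (Fin N) l) → ∣ X ∣ + l ≡ n → ∀ Z → IsFace Z → X ⊆ Z → Valid X v →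
    (∀ i → Z ⊆ faces X v i ⊎ faces X v i ⊆ Z) → Z ≡ X ⊎ (∃[ i ] Z ≡ faces X v i)
  faces-maximal X [] eq Z face X⊆Z _ _ =
    inj₁ (≡.sym (⊆∧∣∣≤⇒≡ X⊆Z (ℕ.≤-trans (∣face∣≤ face) (ℕ.≤-reflexive (≡.trans (≡.sym eq) (ℕ.+-identityʳ _))))))
  faces-maximal {suc l} X (a ∷ v) eq Z face X⊆Z (a∉ , valid) comparable with a Subsetₚ.∈? Z
  ... | yes a∈Z with faces-maximal (X ⊕ a) v
                       (≡.trans (cong (_+ l) (∣insert∣ a∉)) (≡.trans (≡.sym (ℕ.+-suc ∣ X ∣ l)) eq))
                       Z face (insert-⊆ X⊆Z a∈Z) valid (comparable ∘ suc)
  ...   | inj₁ Z≡       = inj₂ (zero , Z≡)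
  ...   | inj₂ (i , Z≡) = inj₂ (suc i , Z≡)
  faces-maximal X (a ∷ v) eq Z face X⊆Z (a∉ , valid) comparable | no a∉Z with comparable zero
  ... | inj₂ ⊆Z = ⊥-elim (a∉Z (⊆Z (∈-insertʳ X a)))
  ... | inj₁ Z⊆ = inj₁ (Subsetₚ.⊆-antisym Z⊆X X⊆Z)
    where
    Z⊆X : Z ⊆ X
    Z⊆X z∈ = [ id , (λ { ≡.refl → ⊥-elim (a∉Z z∈) }) ]′ (∈-insert⁻ X a (Z⊆ z∈))

  Code : Set
  Code = ∃[ v ] Valid {n} ⊥ v

  flagOf : Code → Flag P
  flagOf (v , valid) = record
    { face    = faces ⊥ v
    ; ranked  = λ i → ∣∣⇒rank (toℕ i) (faces ⊥ v i) (faces-face ⊥ v valid i) (∣faces∣⊥ i)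
    ; chain   = λ {i} {j} i<j → ⊆∧∣∣<⇒⊂ (faces-⊆ ⊥ v i<j)
        (ℕ.≤-trans (ℕ.≤-reflexive (cong suc (∣faces∣⊥ i))) (ℕ.≤-trans (s≤s i<j) (ℕ.≤-reflexive (≡.sym (∣faces∣⊥ j)))))
    ; maximal = λ Z face → faces-maximal ⊥ v (cong (_+ n) (Subsetₚ.∣⊥∣≡0 N)) Z face (⊥-elim ∘ Subsetₚ.∉⊥) valid
    }
    where
    ∣faces∣⊥ : ∀ i → ∣ faces ⊥ v i ∣ ≡ suc (toℕ i)
    ∣faces∣⊥ i = ≡.trans (∣faces∣ ⊥ v valid i) (cong (λ k → suc (k + toℕ i)) (Subsetₚ.∣⊥∣≡0 N))

  fromFaces : ∀ {l} X (f : Fin l → Subset N) → IsFace X → (∀ i → IsFace (f i)) → (∀ i → X ⊆ f i) →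
    (∀ {i j} → i <ᶠ j → f i ⊆ f j) → (∀ i → ∣ f i ∣ ≡ suc (∣ X ∣ + toℕ i)) →
    ∃[ v ] Valid X v × (∀ i → faces X v i ≡ f i)
  fromFaces {zero}  X f faceX face X⊆ mono card = [] , faceX , λ ()
  fromFaces {suc l} X f faceX face X⊆ mono card
    with a , a∉ , f0≡ ← ⊂-card-suc (X⊆ zero) (≡.trans (card zero) (cong suc (ℕ.+-identityʳ _)))
    with v , valid , faces≡ ← fromFaces (X ⊕ a) (f ∘ suc) (subst IsFace f0≡ (face zero)) (face ∘ suc)
           (λ i → subst (_⊆ f (suc i)) f0≡ (mono (s≤s z≤n))) (λ i<j → mono (s≤s i<j))
           (λ i → ≡.trans (card (suc i)) (cong suc
             (≡.trans (ℕ.+-suc ∣ X ∣ (toℕ i)) (cong (_+ toℕ i) (≡.sym (∣insert∣ a∉))))))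
    = a ∷ v , (a∉ , valid) , λ { zero → ≡.sym f0≡ ; (suc i) → faces≡ i }

  open FlagEquality P

  codeOf : ∀ F → ∃[ c ] flagOf c ≋ F
  codeOf F with fromFaces ⊥ (face F) (face-⊆ (isFace zero) (⊥-elim ∘ Subsetₚ.∉⊥)) isFace
                 (λ i → ⊥-elim ∘ Subsetₚ.∉⊥) (λ i<j → proj₁ (chain F i<j))
                 (λ i → ≡.trans (rank⇒∣∣ (toℕ i) (face F i) (ranked F i))
                                (cong (λ k → suc (k + toℕ i)) (≡.sym (Subsetₚ.∣⊥∣≡0 N))))
    where
    open Flag
    isFace : ∀ i → IsFace (face F i)
    isFace i = rank⇒face (toℕ i) (face F i) (ranked F i)
  ... | v , valid , eq = (v , valid) , pointwise eq

  -- `X` gathers the vertices already passed, so that at the last entry it is the whole ridge beyond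
  -- which the opposite vertex lies.
  exchange : ∀ {l} → Subset N → Fin l → Vec (Fin N) l → Vec (Fin N) l
  exchange X zero    (a ∷ [])    = opposite X a ∷ []
  exchange X zero    (a ∷ b ∷ v) = b ∷ a ∷ v
  exchange X (suc i) (a ∷ v)     = a ∷ exchange (X ⊕ a) i v

  step-card : ∀ (X : Subset N) {a l} → a ∉ˢ X → ∣ X ∣ + suc l ≡ n → ∣ X ⊕ a ∣ + l ≡ n
  step-card X {l = l} a∉ eq = ≡.trans (cong (_+ l) (∣insert∣ a∉)) (≡.trans (≡.sym (ℕ.+-suc ∣ X ∣ l)) eq)

  ridge-card : ∀ (X : Subset N) → ∣ X ∣ + 1 ≡ n → ∣ X ∣ ≡ m
  ridge-card X eq = ℕ.suc-injective (≡.trans (ℕ.+-comm 1 ∣ X ∣) eq)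

  exchange-valid : ∀ {l} X i (v : Vec (Fin N) l) → ∣ X ∣ + l ≡ n → Valid X v → Valid X (exchange X i v)
  exchange-valid X zero (a ∷ []) eq (a∉ , face) =
    opposite∉ X a a∉ (ridge-card X eq) face , opposite-face X a a∉ (ridge-card X eq) face
  exchange-valid X zero (a ∷ b ∷ v) eq (a∉ , b∉ , valid) with b∉X , b≢a ← ∉-insert⁻ X a b∉ =
    b∉X , ∉-insert a∉ (b≢a ∘ ≡.sym) , subst (λ Y → Valid Y v) (insert-comm X a b) valid
  exchange-valid X (suc i) (a ∷ v) eq (a∉ , valid) = a∉ , exchange-valid (X ⊕ a) i v (step-card X a∉ eq) valid

  ⊥-card : ∣ ⊥ {n = N} ∣ + n ≡ n
  ⊥-card = cong (_+ n) (Subsetₚ.∣⊥∣≡0 N)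

  move : Fin n → Code → Code
  move i (v , valid) = exchange ⊥ i v , exchange-valid ⊥ i v ⊥-card valid

  exchange-differ : ∀ {l} X i (v : Vec (Fin N) l) → ∣ X ∣ + l ≡ n → Valid X v →
    faces X v i ≢ faces X (exchange X i v) i × (∀ j → j ≢ i → faces X v j ≡ faces X (exchange X i v) j)
  exchange-differ X zero (a ∷ []) eq (a∉ , face) =
      (λ e → opposite≢ X a a∉ (ridge-card X eq) face (≡.sym (insert-cancelˡ a∉ e)))
    , λ { zero j≢i → ⊥-elim (j≢i ≡.refl) }
  exchange-differ X zero (a ∷ b ∷ v) eq (a∉ , b∉ , valid) =
      (λ e → proj₂ (∉-insert⁻ X a b∉) (≡.sym (insert-cancelˡ a∉ e)))
    , λ { zero j≢i → ⊥-elim (j≢i ≡.refl)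
        ; (suc zero) _ → insert-comm X a b
        ; (suc (suc j)) _ → cong (λ Y → faces Y v j) (insert-comm X a b) }
  exchange-differ X (suc i) (a ∷ v) eq (a∉ , valid) with ne , agree ← exchange-differ (X ⊕ a) i v (step-card X a∉ eq) valid =
    ne , λ { zero _ → ≡.refl ; (suc j) j≢i → agree j (j≢i ∘ cong suc) }

  faces-injective : ∀ {l} X (v w : Vec (Fin N) l) → Valid X v →
    (∀ i → faces X v i ≡ faces X w i) → v ≡ w
  faces-injective X []      []      _            eq = ≡.refl
  faces-injective X (a ∷ v) (b ∷ w) (a∉ , valid) eq with ≡.refl ← insert-cancelˡ a∉ (eq zero) =
    cong (a ∷_) (faces-injective (X ⊕ a) v w valid (eq ∘ suc))

  exchange-unique : ∀ {l} X i (v w : Vec (Fin N) l) → ∣ X ∣ + l ≡ n → Valid X v → Valid X w →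
    faces X v i ≢ faces X w i → (∀ j → j ≢ i → faces X v j ≡ faces X w j) → exchange X i v ≡ w
  exchange-unique X zero (a ∷ []) (b ∷ []) eq (a∉ , faceA) (b∉ , faceB) ne _ =
    cong (_∷ []) (≡.sym (opposite-unique X a a∉ (ridge-card X eq) faceA b b∉ faceB λ { ≡.refl → ne ≡.refl }))
  exchange-unique X zero (a ∷ b ∷ v) (c ∷ d ∷ w) eq (a∉ , b∉ , valid) (c∉ , d∉ , valid′) ne agree
    with c≡b | d≡a
    where
    ab≡cd : X ⊕ a ⊕ b ≡ X ⊕ c ⊕ d
    ab≡cd = agree (suc zero) λ ()
    a≢c : a ≢ c
    a≢c ≡.refl = ne ≡.refl
    c≡b : c ≡ b
    c≡b with ∈-insert⁻ (X ⊕ a) b (subst (c ∈ˢ_) (≡.sym ab≡cd) (∈-insertˡ d (∈-insertʳ X c)))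
    ... | inj₂ e = e
    ... | inj₁ c∈ = [ ⊥-elim ∘ c∉ , (λ e → ⊥-elim (a≢c (≡.sym e))) ]′ (∈-insert⁻ X a c∈)
    d≡a : d ≡ a
    d≡a with ∈-insert⁻ (X ⊕ c) d (subst (a ∈ˢ_) ab≡cd (∈-insertˡ b (∈-insertʳ X a)))
    ... | inj₂ e = ≡.sym e
    ... | inj₁ a∈ = [ ⊥-elim ∘ a∉ , (λ e → ⊥-elim (a≢c e)) ]′ (∈-insert⁻ X c a∈)
  ... | ≡.refl | ≡.refl = cong (λ u → b ∷ a ∷ u)
    (faces-injective (X ⊕ b ⊕ a) v w (subst (λ Y → Valid Y v) (insert-comm X a b) valid)
      λ j → ≡.trans (cong (λ Y → faces Y v j) (insert-comm X b a)) (agree (suc (suc j)) λ ()))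
  exchange-unique X (suc i) (a ∷ v) (b ∷ w) eq (a∉ , valid) (b∉ , valid′) ne agree
    with ≡.refl ← insert-cancelˡ a∉ (agree zero λ ()) =
    cong (a ∷_) (exchange-unique (X ⊕ a) i v w (step-card X a∉ eq) valid valid′ ne
      λ j j≢i → agree (suc j) (j≢i ∘ Fin.suc-injective))

  flagOf-≡ : ∀ {c d} → proj₁ c ≡ proj₁ d → flagOf c ≋ flagOf d
  flagOf-≡ eq = pointwise λ i → cong (λ v → faces ⊥ v i) eq

  flagOf-injective : ∀ {c d} → flagOf c ≋ flagOf d → proj₁ c ≡ proj₁ d
  flagOf-injective {v , valid} {w , _} p = faces-injective ⊥ v w valid (at p)

  open CodedFlags P flagOf codeOf move
    (λ i (v , valid) → exchange-differ ⊥ i v ⊥-card valid)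
    (λ i (v , valid) (w , valid′) (ne , agree) → flagOf-≡ (exchange-unique ⊥ i v w ⊥-card valid valid′ ne agree))

  exchange-far : ∀ {l} X i j (v : Vec (Fin N) l) → suc (suc (toℕ i)) ≤ toℕ j →
    exchange X j (exchange X i v) ≡ exchange X i (exchange X j v)
  exchange-far X zero    (suc (suc j)) (a ∷ b ∷ v) _ = cong (λ Y → b ∷ a ∷ exchange Y j v) (insert-comm X b a)
  exchange-far X zero    (suc zero)    v           (s≤s ())
  exchange-far X (suc i) (suc j)       (a ∷ v)     (s≤s f) = cong (a ∷_) (exchange-far (X ⊕ a) i j v f)

  -- Away from the end the two moves rotate three consecutive entries, and the third power is the
  -- identity by computation. Only the edge that involves the last entry depends on the polytope;
  -- its order `ℓ` is supplied through `last`.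
  exchange-edge : ∀ {l} ℓ k →
    (∀ X a b → a ∉ˢ X → b ∉ˢ X ⊕ a → suc ∣ X ∣ ≡ m → IsFace (X ⊕ a ⊕ b) →
      iterate (λ u → exchange X (suc zero) (exchange X zero u)) (a ∷ b ∷ []) ℓ ≡ a ∷ b ∷ []) →
    ∀ X i j (v : Vec (Fin N) l) → toℕ j ≡ suc (toℕ i) → ∣ X ∣ + l ≡ n → Valid X v →
    (suc (suc (toℕ i)) ≢ l → k ≡ 3) → (suc (suc (toℕ i)) ≡ l → k ≡ ℓ) →
    iterate (λ u → exchange X j (exchange X i u)) v k ≡ v
  exchange-edge ℓ k last X zero (suc zero) (a ∷ b ∷ []) _ eq (a∉ , b∉ , face) _ kℓ
    rewrite kℓ ≡.refl = last X a b a∉ b∉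
      (ℕ.suc-injective (≡.trans (ℕ.+-comm 2 ∣ X ∣) eq)) face
  exchange-edge ℓ k last X zero (suc zero) (a ∷ b ∷ c ∷ v) _ eq _ k3 _ rewrite k3 (λ ()) = ≡.refl
  exchange-edge ℓ k last X (suc i) (suc j) (a ∷ v) e eq (a∉ , valid) k3 kℓ = ≡.trans (iterate-∷ k v)
    (cong (a ∷_) (exchange-edge ℓ k last (X ⊕ a) i j v (ℕ.suc-injective e) (step-card X a∉ eq) valid
      (λ ne → k3 (ne ∘ ℕ.suc-injective)) (λ e → kℓ (cong suc e))))
    where
    iterate-∷ : ∀ k v → iterate (λ u → exchange X (suc j) (exchange X (suc i) u)) (a ∷ v) k
                      ≡ a ∷ iterate (λ u → exchange (X ⊕ a) j (exchange (X ⊕ a) i u)) v k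
    iterate-∷ zero    v = ≡.refl
    iterate-∷ (suc k) v = iterate-∷ k _

  rotation : ∀ {l} → Subset N → Vec (Fin N) (suc l) → Vec (Fin N) (suc l)
  rotation X (a ∷ v) = v ∷ʳ opposite (insertAll X v) a

  -- The successive swaps carry the first vertex to the end. By then the ridge consists of all the
  -- other vertices, and the vertex is replaced by the one on the other side.
  exchanges : ∀ {l} X (v : Vec (Fin N) (suc l)) →
    foldl (λ u i → exchange X i u) v (allFin (suc l)) ≡ rotation X v
  exchanges X (a ∷ []) = ≡.refl
  exchanges {suc l} X (a ∷ b ∷ v) = begin
    foldl (λ u i → exchange X i u) (b ∷ a ∷ v) (List.tabulate suc)
      ≡⟨ cong (foldl (λ u i → exchange X i u) (b ∷ a ∷ v)) (Listₚ.map-tabulate id suc) ⟨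
    foldl (λ u i → exchange X i u) (b ∷ a ∷ v) (map suc (allFin (suc l)))
      ≡⟨ foldl-∷ (allFin (suc l)) (a ∷ v) ⟩
    b ∷ foldl (λ u i → exchange (X ⊕ b) i u) (a ∷ v) (allFin (suc l))
      ≡⟨ cong (b ∷_) (exchanges (X ⊕ b) (a ∷ v)) ⟩
    rotation X (a ∷ b ∷ v) ∎
    where
    open ≡.≡-Reasoning
    foldl-∷ : ∀ is w → foldl (λ u i → exchange X i u) (b ∷ w) (map suc is)
                     ≡ b ∷ foldl (λ u i → exchange (X ⊕ b) i u) w is
    foldl-∷ []       w = ≡.refl
    foldl-∷ (i ∷ is) w = foldl-∷ is _

  rotate-rotation : ∀ c → proj₁ (rotate c) ≡ rotation ⊥ (proj₁ c)
  rotate-rotation c = ≡.trans (go (allFin n) c) (exchanges ⊥ (proj₁ c))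
    where
    go : ∀ is c → proj₁ (foldl (λ d i → move i d) c is) ≡ foldl (λ u i → exchange ⊥ i u) (proj₁ c) is
    go []       c = ≡.refl
    go (i ∷ is) c = go is (move i c)

  iterate-rotate : ∀ k c → proj₁ (iterate rotate c k) ≡ iterate (rotation ⊥) (proj₁ c) k
  iterate-rotate zero    c = ≡.refl
  iterate-rotate (suc k) c = ≡.trans (iterate-rotate k (rotate c))
    (cong (λ v → iterate (rotation ⊥) v k) (rotate-rotation c))

  rotation-valid : ∀ v → Valid ⊥ v → Valid ⊥ (rotation ⊥ v)
  rotation-valid v valid = subst (Valid ⊥) (rotate-rotation (v , valid)) (proj₂ (rotate (v , valid)))

  head-iterate : ∀ k (v : Vec (Fin N) n) i → toℕ i ≡ k → head (iterate (rotation ⊥) v k) ≡ lookup v i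
  head-iterate zero    (a ∷ v) zero    e = ≡.refl
  head-iterate (suc k) (a ∷ v) (suc i) e = ≡.trans
    (head-iterate k (v ∷ʳ x) (inject₁ i) (≡.trans (Fin.toℕ-inject₁ i) (ℕ.suc-injective e)))
    (lookup-∷ʳ v i)
    where
    x = opposite (insertAll ⊥ v) a
    lookup-∷ʳ : ∀ {l} (v : Vec (Fin N) l) i → lookup (v ∷ʳ x) (inject₁ i) ≡ lookup v i
    lookup-∷ʳ (_ ∷ v) zero    = ≡.refl
    lookup-∷ʳ (_ ∷ v) (suc i) = lookup-∷ʳ v i

  simplicialLengths : (label : ℕ → ℕ) (ℓ : ℕ) →
    (∀ k → suc (suc k) ≢ n → label k ≡ 3) → (∀ k → suc (suc k) ≡ n → label k ≡ ℓ) →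
    (∀ X a b → a ∉ˢ X → b ∉ˢ X ⊕ a → suc ∣ X ∣ ≡ m → IsFace (X ⊕ a ⊕ b) →
      iterate (λ u → exchange X (suc zero) (exchange X zero u)) (a ∷ b ∷ []) ℓ ≡ a ∷ b ∷ []) →
    (h : ℕ) → 0 < h → TrivialPower label n h → ∃[ v ] Valid {n} ⊥ v →
    (∀ v → Valid ⊥ v → ∀ k → 0 < k → k < h → iterate (rotation ⊥) v k ≢ v) →
    IsCoxeterNumber (pathMatrix label n) h × ZigzagsHaveLength P h
  simplicialLengths label ℓ label3 labelℓ last h 0<h power c₀ aperiodic = lengths label
    (λ i j f (v , _) → flagOf-≡ (exchange-far ⊥ i j v f))
    (λ i j e c → flagOf-≡ (≡.trans (iterate-move i j (label (toℕ i)) c)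
      (exchange-edge ℓ (label (toℕ i)) last ⊥ i j (proj₁ c) e ⊥-card (proj₂ c) (label3 (toℕ i)) (labelℓ (toℕ i)))))
    h 0<h power c₀
    (λ c k 0<k k<h p → aperiodic (proj₁ c) (proj₂ c) k 0<k k<h
      (≡.trans (≡.sym (iterate-rotate k c)) (flagOf-injective p)))
    where
    iterate-move : ∀ i j k c → proj₁ (iterate (λ d → move j (move i d)) c k)
                             ≡ iterate (λ u → exchange ⊥ j (exchange ⊥ i u)) (proj₁ c) k
    iterate-move i j zero    c = ≡.refl
    iterate-move i j (suc k) c = iterate-move i j k _

  base⊆insertAll : ∀ {l} X (v : Vec (Fin N) l) → X ⊆ insertAll X v
  base⊆insertAll X []      x∈ = x∈
  base⊆insertAll X (a ∷ v) x∈ = base⊆insertAll (X ⊕ a) v (∈-insertˡ a x∈)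

  lookup∈insertAll : ∀ {l} X (v : Vec (Fin N) l) i → lookup v i ∈ˢ insertAll X v
  lookup∈insertAll X (a ∷ v) zero    = base⊆insertAll (X ⊕ a) v (∈-insertʳ X a)
  lookup∈insertAll X (a ∷ v) (suc i) = lookup∈insertAll (X ⊕ a) v i

  ∈-insertAll⁻ : ∀ {l x} X (v : Vec (Fin N) l) → x ∈ˢ insertAll X v → x ∈ˢ X ⊎ (∃[ i ] x ≡ lookup v i)
  ∈-insertAll⁻ X []      x∈ = inj₁ x∈
  ∈-insertAll⁻ X (a ∷ v) x∈ with ∈-insertAll⁻ (X ⊕ a) v x∈
  ... | inj₂ (i , eq) = inj₂ (suc i , eq)
  ... | inj₁ x∈Xa     = [ inj₁ , (λ eq → inj₂ (zero , eq)) ]′ (∈-insert⁻ X a x∈Xa)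

  insertAll-⊕ : ∀ {l} X a (v : Vec (Fin N) l) → insertAll (X ⊕ a) v ≡ insertAll X v ⊕ a
  insertAll-⊕ X a []      = ≡.refl
  insertAll-⊕ X a (b ∷ v) = ≡.trans (cong (λ Y → insertAll Y v) (insert-comm X a b)) (insertAll-⊕ (X ⊕ b) a v)

  insertAll-face : ∀ {l} X (v : Vec (Fin N) l) → Valid X v → IsFace (insertAll X v)
  insertAll-face X []      face        = face
  insertAll-face X (a ∷ v) (_ , valid) = insertAll-face (X ⊕ a) v valid

  ∣insertAll∣ : ∀ {l} X (v : Vec (Fin N) l) → Valid X v → ∣ insertAll X v ∣ ≡ ∣ X ∣ + l
  ∣insertAll∣ X []      _ = ≡.sym (ℕ.+-identityʳ _)
  ∣insertAll∣ {suc l} X (a ∷ v) (a∉ , valid) = ≡.trans (∣insertAll∣ (X ⊕ a) v valid)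
    (≡.trans (cong (_+ l) (∣insert∣ a∉)) (≡.sym (ℕ.+-suc ∣ X ∣ l)))

  lookup∉base : ∀ {l} X (v : Vec (Fin N) l) → Valid X v → ∀ i → lookup v i ∉ˢ X
  lookup∉base X (a ∷ v) (a∉ , valid) zero    = a∉
  lookup∉base X (a ∷ v) (a∉ , valid) (suc i) = lookup∉base (X ⊕ a) v valid i ∘ ∈-insertˡ a

  lookup≢head : ∀ {l} X a (v : Vec (Fin N) l) → Valid X (a ∷ v) → ∀ i → lookup v i ≢ a
  lookup≢head X a v (_ , valid) i = proj₂ (∉-insert⁻ X a (lookup∉base (X ⊕ a) v valid i))

  head∉insertAll : ∀ {l} a (v : Vec (Fin N) l) → Valid ⊥ (a ∷ v) → a ∉ˢ insertAll ⊥ v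
  head∉insertAll a v valid a∈ with ∈-insertAll⁻ ⊥ v a∈
  ... | inj₁ a∈⊥      = Subsetₚ.∉⊥ a∈⊥
  ... | inj₂ (i , eq) = lookup≢head ⊥ a v valid i (≡.sym eq)

  tail-ridge : ∀ a (v : Vec (Fin N) m) → Valid ⊥ (a ∷ v) →
    a ∉ˢ insertAll ⊥ v × ∣ insertAll ⊥ v ∣ ≡ m × IsFace (insertAll ⊥ v ⊕ a)
  tail-ridge a v valid = head∉insertAll a v valid , card , face
    where
    face : IsFace (insertAll ⊥ v ⊕ a)
    face = subst IsFace (insertAll-⊕ ⊥ a v) (insertAll-face (⊥ ⊕ a) v (proj₂ valid))
    card : ∣ insertAll ⊥ v ∣ ≡ m
    card = ℕ.suc-injective (≡.trans (≡.sym (∣insert∣ (head∉insertAll a v valid)))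
      (≡.trans (cong ∣_∣ (≡.sym (insertAll-⊕ ⊥ a v)))
        (≡.trans (∣insertAll∣ (⊥ ⊕ a) v (proj₂ valid))
          (cong (_+ m) (≡.trans (∣insert∣ {X = ⊥} {a} Subsetₚ.∉⊥) (cong suc (Subsetₚ.∣⊥∣≡0 N)))))))

  iterate-head≢ : ∀ (v : Vec (Fin N) n) → Valid ⊥ v → ∀ k → 0 < k → k < n → head (iterate (rotation ⊥) v k) ≢ head v
  iterate-head≢ (a ∷ v) valid (suc k) _ (s≤s k<m) eq = lookup≢head ⊥ a v valid (fromℕ< k<m)
    (≡.trans (≡.sym (head-iterate (suc k) (a ∷ v) (suc (fromℕ< k<m)) (cong suc (Fin.toℕ-fromℕ< k<m)))) eq)

  iterate-head-n : ∀ (v : Vec (Fin N) n) →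
    head (iterate (rotation ⊥) v n) ≡ opposite (insertAll ⊥ (tail v)) (head v)
  iterate-head-n (a ∷ v) = ≡.trans (head-iterate m (rotation ⊥ (a ∷ v)) (fromℕ m) (Fin.toℕ-fromℕ m)) (lookup-last v)
    where
    lookup-last : ∀ {l} (w : Vec (Fin N) l) {x} → lookup (w ∷ʳ x) (fromℕ l) ≡ x
    lookup-last []      = ≡.refl
    lookup-last (_ ∷ w) = lookup-last w

  -- The first entry runs through the remaining vertices of the facet during the steps before the
  -- `n`-th, and at the `n`-th it is the vertex opposite to the initial one. None of these is the
  -- initial vertex.
  iterate≢-≤ : ∀ v → Valid {n} ⊥ v → ∀ k → 0 < k → k ≤ n → iterate (rotation ⊥) v k ≢ v
  iterate≢-≤ v valid k 0<k k≤n eq with ℕ.m≤n⇒m<n∨m≡n k≤n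
  ... | inj₁ k<n = iterate-head≢ v valid k 0<k k<n (cong head eq)
  iterate≢-≤ (a ∷ v) valid k 0<k k≤n eq | inj₂ ≡.refl with a∉ , card , face ← tail-ridge a v valid =
    opposite≢ (insertAll ⊥ v) a a∉ card face (≡.trans (≡.sym (iterate-head-n (a ∷ v))) (cong head eq))

  iterate-+ : ∀ (v : Vec (Fin N) n) j k →
    iterate (rotation ⊥) v (j + k) ≡ iterate (rotation ⊥) (iterate (rotation ⊥) v j) k
  iterate-+ v zero    k = ≡.refl
  iterate-+ v (suc j) k = iterate-+ (rotation ⊥ v) j k

  iterate-head-+n : ∀ (v : Vec (Fin N) n) j → let w = iterate (rotation ⊥) v j in
    head (iterate (rotation ⊥) v (j + n)) ≡ opposite (insertAll ⊥ (tail w)) (head w)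
  iterate-head-+n v j = ≡.trans (cong head (iterate-+ v j n)) (iterate-head-n (iterate (rotation ⊥) v j))

  -- The link of `X` is a polygon with edge `a`, `b`, and the two moves together pass to its next
  -- edge, from `b` to the vertex opposite to `a`. The order is thus the number of sides, here of a
  -- triangle.
  exchange-cycle₃ : ∀ X a b t → opposite (X ⊕ b) a ≡ t → opposite (X ⊕ t) b ≡ a → opposite (X ⊕ a) t ≡ b →
    iterate (λ u → exchange X (suc zero) (exchange X zero u)) (a ∷ b ∷ []) 3 ≡ a ∷ b ∷ []
  exchange-cycle₃ X a b t p q r rewrite p | q | r = ≡.refl

  exchange-cycle₄ : ∀ X a b c d →
    opposite (X ⊕ b) a ≡ c → opposite (X ⊕ c) b ≡ d → opposite (X ⊕ d) c ≡ a → opposite (X ⊕ a) d ≡ b →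
    iterate (λ u → exchange X (suc zero) (exchange X zero u)) (a ∷ b ∷ []) 4 ≡ a ∷ b ∷ []
  exchange-cycle₄ X a b c d p q r t rewrite p | q | r | t = ≡.refl

-- The simplex and the cross-polytope

module SimplexZigzags (m : ℕ) where
  private
    n N : ℕ
    n = suc m
    N = suc n
  open FaceComplex (simplex n) using (IsFace)

  ∣∣≤⇒face : ∀ {X : Subset N} → ∣ X ∣ ≤ n → IsFace X
  ∣∣≤⇒face {X} le = ⊆∧∣∣<⇒⊂ Subsetₚ.⊆⊤ (ℕ.≤-trans (s≤s le) (ℕ.≤-reflexive (≡.sym (Subsetₚ.∣⊤∣≡n N))))

  face⇒∣∣≤ : ∀ {X : Subset N} → IsFace X → ∣ X ∣ ≤ n
  face⇒∣∣≤ face = s≤s⁻¹ (ℕ.≤-trans (Subsetₚ.p⊂q⇒∣p∣<∣q∣ face) (ℕ.≤-reflexive (Subsetₚ.∣⊤∣≡n N)))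

  missing-unique : ∀ {Y : Subset N} {x y} → ∣ Y ∣ ≡ n → x ∉ˢ Y → y ∉ˢ Y → x ≡ y
  missing-unique {Y} {x} {y} card x∉ y∉ = [ ⊥-elim ∘ x∉ , id ]′ (∈-insert⁻ Y y
    (subst (x ∈ˢ_) (≡.sym (Subsetₚ.∣p∣≡n⇒p≡⊤ (≡.trans (∣insert∣ y∉) (cong suc card)))) Subsetₚ.∈⊤))

  missing? : (Y : Subset N) → Dec (∃[ x ] x ∉ˢ Y)
  missing? Y = Fin.any? (λ x → ¬? (x Subsetₚ.∈? Y))

  opposite : Subset N → Fin N → Fin N
  opposite X a with missing? (X ⊕ a)
  ... | yes (x , _) = x
  -- Arbitrary: a face is a proper subset, so `X ⊕ a` misses a vertex wherever the function is used.
  ... | no  _       = a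

  opposite∉facet : ∀ (X : Subset N) a → IsFace (X ⊕ a) → opposite X a ∉ˢ X ⊕ a
  opposite∉facet X a (_ , x , _ , x∉) with missing? (X ⊕ a)
  ... | yes (_ , y∉) = y∉
  ... | no  none     = ⊥-elim (none (x , x∉))

  opposite≡ : ∀ {X : Subset N} {a y} → ∣ X ⊕ a ∣ ≡ n → y ∉ˢ X ⊕ a → opposite X a ≡ y
  opposite≡ {X} {a} card y∉ = missing-unique card (opposite∉facet X a (∣∣≤⇒face (ℕ.≤-reflexive card))) y∉

  opposite∉ : ∀ (X : Subset N) a → a ∉ˢ X → ∣ X ∣ ≡ m → IsFace (X ⊕ a) → opposite X a ∉ˢ X
  opposite∉ X a _ _ face = proj₁ (∉-insert⁻ X a (opposite∉facet X a face))

  opposite≢ : ∀ (X : Subset N) a → a ∉ˢ X → ∣ X ∣ ≡ m → IsFace (X ⊕ a) → opposite X a ≢ a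
  opposite≢ X a _ _ face = proj₂ (∉-insert⁻ X a (opposite∉facet X a face))

  opposite-face : ∀ (X : Subset N) a → a ∉ˢ X → ∣ X ∣ ≡ m → IsFace (X ⊕ a) → IsFace (X ⊕ opposite X a)
  opposite-face X a a∉ card face =
    ∣∣≤⇒face (ℕ.≤-reflexive (≡.trans (∣insert∣ (opposite∉ X a a∉ card face)) (cong suc card)))

  opposite-unique : ∀ (X : Subset N) a → a ∉ˢ X → ∣ X ∣ ≡ m → IsFace (X ⊕ a) →
    ∀ b → b ∉ˢ X → IsFace (X ⊕ b) → b ≢ a → b ≡ opposite X a
  opposite-unique X a a∉ card face b b∉ _ b≢a =
    ≡.sym (opposite≡ (≡.trans (∣insert∣ a∉) (cong suc card)) (∉-insert b∉ b≢a))

  open SimplicialFlags (simplex n) (λ face X⊆Y → Subsetₚ.⊆-⊂-trans X⊆Y face) face⇒∣∣≤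
    opposite opposite∉ opposite≢ opposite-face opposite-unique

  someValid : ∀ l (X : Subset N) → ∣ X ∣ + l ≡ n → ∃[ v ] Valid {l} X v
  someValid zero X eq = [] , ∣∣≤⇒face (ℕ.≤-reflexive (≡.trans (≡.sym (ℕ.+-identityʳ _)) eq))
  someValid (suc l) X eq =
    let _ , a , _ , a∉ = ∣∣≤⇒face {X} (ℕ.≤-trans (ℕ.m≤m+n _ (suc l)) (ℕ.≤-reflexive eq))
        v , valid      = someValid l (X ⊕ a) (step-card X a∉ eq)
    in a ∷ v , a∉ , valid

  ∣insert₂∣ : ∀ {X : Subset N} {x y} → suc ∣ X ∣ ≡ m → x ∉ˢ X → y ∉ˢ X ⊕ x → ∣ X ⊕ x ⊕ y ∣ ≡ n
  ∣insert₂∣ card x∉ y∉ = ≡.trans (∣insert∣ y∉) (cong suc (≡.trans (∣insert∣ x∉) card))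

  -- The facet `X ⊕ a ⊕ b` misses just one vertex `t`, so the link of `X` is the triangle on `a`,
  -- `b`, `t`.
  last-edge : ∀ X a b → a ∉ˢ X → b ∉ˢ X ⊕ a → suc ∣ X ∣ ≡ m → IsFace (X ⊕ a ⊕ b) →
    iterate (λ u → exchange X (suc zero) (exchange X zero u)) (a ∷ b ∷ []) 3 ≡ a ∷ b ∷ []
  last-edge X a b a∉ b∉ card (_ , t , _ , t∉) =
    let b∉X  , b≢a = ∉-insert⁻ X a b∉
        t∉Xa , t≢b = ∉-insert⁻ (X ⊕ a) b t∉
        t∉X  , t≢a = ∉-insert⁻ X a t∉Xa
    in exchange-cycle₃ X a b t
      (opposite≡ (∣insert₂∣ card b∉X (∉-insert a∉ (b≢a ∘ ≡.sym))) (∉-insert (∉-insert t∉X t≢b) t≢a))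
      (opposite≡ (∣insert₂∣ card t∉X (∉-insert b∉X (t≢b ∘ ≡.sym)))
        (∉-insert (∉-insert a∉ (t≢a ∘ ≡.sym)) (b≢a ∘ ≡.sym)))
      (opposite≡ (∣insert₂∣ card a∉ t∉Xa) (∉-insert b∉ (t≢b ∘ ≡.sym)))

  zigzags : IsCoxeterNumber (A-matrix n) (n + 1) × ZigzagsHaveLength (simplex n) (n + 1)
  zigzags = simplicialLengths (λ _ → 3) 3 (λ _ _ → ≡.refl) (λ _ _ → ≡.refl) last-edge
    (n + 1) z<s (A-power n) (someValid n ⊥ ⊥-card)
    λ v valid k 0<k k<h → iterate≢-≤ v valid k 0<k (s≤s⁻¹ (subst (k <_) (ℕ.+-comm n 1) k<h))

module CrossPolytopeZigzags (m : ℕ) where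
  private
    n N : ℕ
    n = suc m
    N = n + n
  open FaceComplex (crossPolytope n) using (IsFace)

  negate : Fin N → Fin N
  negate x = [ n ↑ʳ_ , _↑ˡ n ]′ (splitAt n x)

  data Sign : Fin N → Set where
    plus  : (i : Fin n) → Sign (i ↑ˡ n)
    minus : (i : Fin n) → Sign (n ↑ʳ i)

  sign : ∀ x → Sign x
  sign x = subst Sign (Fin.join-splitAt n n x) (go (splitAt n x))
    where
    go : ∀ s → Sign (join n n s)
    go (inj₁ i) = plus i
    go (inj₂ i) = minus i

  negate-plus : ∀ i → negate (i ↑ˡ n) ≡ n ↑ʳ i
  negate-plus i = cong [ n ↑ʳ_ , _↑ˡ n ]′ (Fin.splitAt-↑ˡ n i n)

  negate-minus : (i : Fin n) → negate (n ↑ʳ i) ≡ i ↑ˡ n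
  negate-minus i = cong [ n ↑ʳ_ , _↑ˡ n ]′ (Fin.splitAt-↑ʳ n n i)

  negate-involutive : ∀ x → negate (negate x) ≡ x
  negate-involutive x with sign x
  ... | plus i  = ≡.trans (cong negate (negate-plus i)) (negate-minus i)
  ... | minus i = ≡.trans (cong negate (negate-minus i)) (negate-plus i)

  negate≢ : ∀ x → negate x ≢ x
  negate≢ x eq with sign x
  ... | plus i with () ← ≡.trans (≡.sym (Fin.splitAt-↑ʳ n n i))
                          (≡.trans (cong (splitAt n) (≡.trans (≡.sym (negate-plus i)) eq)) (Fin.splitAt-↑ˡ n i n))
  ... | minus i with () ← ≡.trans (≡.sym (Fin.splitAt-↑ˡ n i n))
                          (≡.trans (cong (splitAt n) (≡.trans (≡.sym (negate-minus i)) eq)) (Fin.splitAt-↑ʳ n n i))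

  face⇒negate∉ : ∀ {X} → IsFace X → ∀ {x} → x ∈ˢ X → negate x ∉ˢ X
  face⇒negate∉ face {x} x∈ −x∈ with sign x
  ... | plus i  = face i (x∈ , subst (_∈ˢ _) (negate-plus i) −x∈)
  ... | minus i = face i (subst (_∈ˢ _) (negate-minus i) −x∈ , x∈)

  negate∉⇒face : ∀ {X} → (∀ {x} → x ∈ˢ X → negate x ∉ˢ X) → IsFace X
  negate∉⇒face p i (x∈ , −x∈) = p x∈ (subst (_∈ˢ _) (≡.sym (negate-plus i)) −x∈)

  face-⊕ : ∀ {X x} → IsFace X → x ∉ˢ X → negate x ∉ˢ X → IsFace (X ⊕ x)
  face-⊕ {X} {x} face x∉ −x∉ = negate∉⇒face λ {y} y∈ −y∈ → go (∈-insert⁻ X x y∈) (∈-insert⁻ X x −y∈)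
    where
    go : ∀ {y} → y ∈ˢ X ⊎ y ≡ x → negate y ∈ˢ X ⊎ negate y ≡ x → Data.Empty.⊥
    go (inj₁ y∈)    (inj₁ −y∈)   = face⇒negate∉ face y∈ −y∈
    go (inj₁ y∈)    (inj₂ ≡.refl) = −x∉ (subst (_∈ˢ X) (≡.sym (negate-involutive _)) y∈)
    go (inj₂ ≡.refl) (inj₁ −y∈)  = −x∉ −y∈
    go (inj₂ ≡.refl) (inj₂ eq)   = negate≢ _ eq

  ∈-++ˡ : ∀ (p q : Subset n) {i} → i ∈ˢ p → i ↑ˡ n ∈ˢ p Vec.++ q
  ∈-++ˡ p q {i} i∈ = Vecₚ.lookup⇒[]= _ _ (≡.trans (Vecₚ.lookup-++ˡ p q i) (Vecₚ.[]=⇒lookup i∈))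

  ∈-++ʳ : ∀ (p q : Subset n) {i} → i ∈ˢ q → n ↑ʳ i ∈ˢ p Vec.++ q
  ∈-++ʳ p q {i} i∈ = Vecₚ.lookup⇒[]= _ _ (≡.trans (Vecₚ.lookup-++ʳ p q i) (Vecₚ.[]=⇒lookup i∈))

  ∣++∣ : ∀ {k l} (p : Subset k) (q : Subset l) → ∣ p Vec.++ q ∣ ≡ ∣ p ∣ + ∣ q ∣
  ∣++∣ []          q = ≡.refl
  ∣++∣ (true  ∷ p) q = cong suc (∣++∣ p q)
  ∣++∣ (false ∷ p) q = ∣++∣ p q

  disjoint-∣∣ : ∀ {k} (p q : Subset k) → (∀ i → i ∈ˢ p → i ∉ˢ q) → ∣ p ∣ + ∣ q ∣ ≤ k
  disjoint-∣∣ []          []          _ = z≤n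
  disjoint-∣∣ (true  ∷ p) (true  ∷ q) d = ⊥-elim (d zero Vec.here Vec.here)
  disjoint-∣∣ (true  ∷ p) (false ∷ q) d = s≤s (disjoint-∣∣ p q λ i i∈ i∈′ → d (suc i) (Vec.there i∈) (Vec.there i∈′))
  disjoint-∣∣ {suc k} (false ∷ p) (true ∷ q) d = subst (_≤ suc k) (≡.sym (ℕ.+-suc ∣ p ∣ ∣ q ∣))
    (s≤s (disjoint-∣∣ p q λ i i∈ i∈′ → d (suc i) (Vec.there i∈) (Vec.there i∈′)))
  disjoint-∣∣ (false ∷ p) (false ∷ q) d =
    ℕ.m≤n⇒m≤1+n (disjoint-∣∣ p q λ i i∈ i∈′ → d (suc i) (Vec.there i∈) (Vec.there i∈′))

  covering-∣∣ : ∀ {k} (p q : Subset k) → (∀ i → i ∈ˢ p ⊎ i ∈ˢ q) → k ≤ ∣ p ∣ + ∣ q ∣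
  covering-∣∣ []          []          _ = z≤n
  covering-∣∣ {suc k} (x ∷ p) (y ∷ q) c = go x y c
    where
    rest : k ≤ ∣ p ∣ + ∣ q ∣
    rest = covering-∣∣ p q λ i → drop (c (suc i))
      where
      drop : ∀ {i} → suc i ∈ˢ x ∷ p ⊎ suc i ∈ˢ y ∷ q → i ∈ˢ p ⊎ i ∈ˢ q
      drop (inj₁ (Vec.there i∈)) = inj₁ i∈
      drop (inj₂ (Vec.there i∈)) = inj₂ i∈
    go : ∀ x y → (∀ i → i ∈ˢ x ∷ p ⊎ i ∈ˢ y ∷ q) → suc k ≤ ∣ x ∷ p ∣ + ∣ y ∷ q ∣
    go true  true  c = s≤s (ℕ.≤-trans rest (ℕ.+-monoʳ-≤ ∣ p ∣ (ℕ.n≤1+n _)))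
    go true  false c = s≤s rest
    go false true  c = ℕ.≤-trans (s≤s rest) (ℕ.≤-reflexive (≡.sym (ℕ.+-suc ∣ p ∣ ∣ q ∣)))
    go false false c with c zero
    ... | inj₁ ()
    ... | inj₂ ()

  face⇒∣∣≤ : ∀ {X} → IsFace X → ∣ X ∣ ≤ n
  face⇒∣∣≤ {X} face with p , q , ≡.refl ← Vec.splitAt n X = ℕ.≤-trans (ℕ.≤-reflexive (∣++∣ p q))
    (disjoint-∣∣ p q λ i i∈ i∈′ → face i (∈-++ˡ p q i∈ , ∈-++ʳ p q i∈′))

  negate∈facet : ∀ {X x} → IsFace X → ∣ X ∣ ≡ n → x ∉ˢ X → negate x ∈ˢ X
  negate∈facet {X} {x} face card x∉ with negate x Subsetₚ.∈? X
  ... | yes −x∈ = −x∈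
  ... | no  −x∉ = ⊥-elim (ℕ.<⇒≱ (ℕ.≤-reflexive (≡.trans (cong suc (≡.sym card)) (≡.sym (∣insert∣ x∉))))
                    (face⇒∣∣≤ (face-⊕ face x∉ −x∉)))

  unused : ∀ (X : Subset N) → ∣ X ∣ < n → ∃[ x ] x ∉ˢ X × negate x ∉ˢ X
  unused X lt with Fin.any? (λ i → ¬? (i ↑ˡ n Subsetₚ.∈? X) ×-dec ¬? (n ↑ʳ i Subsetₚ.∈? X))
  ... | yes (i , p , q) = i ↑ˡ n , p , q ∘ subst (_∈ˢ X) (negate-plus i)
  ... | no none with p , q , ≡.refl ← Vec.splitAt n X = ⊥-elim (ℕ.<⇒≱ lt
    (ℕ.≤-trans (covering-∣∣ p q covers) (ℕ.≤-reflexive (≡.sym (∣++∣ p q)))))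
    where
    covers : ∀ i → i ∈ˢ p ⊎ i ∈ˢ q
    covers i with i Subsetₚ.∈? p | i Subsetₚ.∈? q
    ... | yes i∈ | _      = inj₁ i∈
    ... | no  _  | yes i∈ = inj₂ i∈
    ... | no  i∉ | no i∉′ = ⊥-elim (none (i
          , (λ i∈ → i∉ (Vecₚ.lookup⇒[]= _ _ (≡.trans (≡.sym (Vecₚ.lookup-++ˡ p q i)) (Vecₚ.[]=⇒lookup i∈))))
          , (λ i∈ → i∉′ (Vecₚ.lookup⇒[]= _ _ (≡.trans (≡.sym (Vecₚ.lookup-++ʳ p q i)) (Vecₚ.[]=⇒lookup i∈))))))

  opposite : Subset N → Fin N → Fin N
  opposite _ = negate

  negate∉ridge : ∀ X a → IsFace (X ⊕ a) → negate a ∉ˢ X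
  negate∉ridge X a face −a∈ = face⇒negate∉ face (∈-insertʳ X a) (∈-insertˡ a −a∈)

  face-⊆ : ∀ {X Y} → IsFace Y → X ⊆ Y → IsFace X
  face-⊆ face X⊆Y i (x∈ , −x∈) = face i (X⊆Y x∈ , X⊆Y −x∈)

  opposite-unique : ∀ X a → a ∉ˢ X → ∣ X ∣ ≡ m → IsFace (X ⊕ a) →
    ∀ b → b ∉ˢ X → IsFace (X ⊕ b) → b ≢ a → b ≡ negate a
  opposite-unique X a a∉ card face b b∉ face′ b≢a
    with ∈-insert⁻ X a (negate∈facet face (≡.trans (∣insert∣ a∉) (cong suc card)) (∉-insert b∉ b≢a))
  ... | inj₁ −b∈ = ⊥-elim (negate∉ridge X b face′ −b∈)
  ... | inj₂ eq  = ≡.trans (≡.sym (negate-involutive b)) (cong negate eq)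

  opposite∉ : ∀ X a → a ∉ˢ X → ∣ X ∣ ≡ m → IsFace (X ⊕ a) → opposite X a ∉ˢ X
  opposite∉ X a _ _ face = negate∉ridge X a face

  opposite≢ : ∀ X a → a ∉ˢ X → ∣ X ∣ ≡ m → IsFace (X ⊕ a) → opposite X a ≢ a
  opposite≢ X a _ _ _ = negate≢ a

  opposite-face : ∀ X a → a ∉ˢ X → ∣ X ∣ ≡ m → IsFace (X ⊕ a) → IsFace (X ⊕ opposite X a)
  opposite-face X a a∉ _ face = face-⊕ (face-⊆ face (∈-insertˡ a)) (negate∉ridge X a face)
    (a∉ ∘ subst (_∈ˢ X) (negate-involutive a))

  open SimplicialFlags (crossPolytope n) face-⊆ face⇒∣∣≤
    opposite opposite∉ opposite≢ opposite-face opposite-unique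

  someValid : ∀ l (X : Subset N) → IsFace X → ∣ X ∣ + l ≡ n → ∃[ v ] Valid {l} X v
  someValid zero X face eq = [] , face
  someValid (suc l) X face eq =
    let a , a∉ , −a∉ = unused X (ℕ.≤-trans (s≤s (ℕ.m≤m+n ∣ X ∣ l)) (ℕ.≤-reflexive (≡.trans (≡.sym (ℕ.+-suc ∣ X ∣ l)) eq)))
        v , valid    = someValid l (X ⊕ a) (face-⊕ face a∉ −a∉) (step-card X a∉ eq)
    in a ∷ v , a∉ , valid

  -- The link of `X` is the square with consecutive vertices `a`, `b`, `negate a`, `negate b`.
  last-edge : ∀ X a b → a ∉ˢ X → b ∉ˢ X ⊕ a → suc ∣ X ∣ ≡ m → IsFace (X ⊕ a ⊕ b) →
    iterate (λ u → exchange X (suc zero) (exchange X zero u)) (a ∷ b ∷ []) 4 ≡ a ∷ b ∷ []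
  last-edge X a b _ _ _ _ = exchange-cycle₄ X a b (negate a) (negate b)
    ≡.refl ≡.refl (negate-involutive a) (negate-involutive b)

  negate-lookup≢head : ∀ a v → Valid {n} ⊥ (a ∷ v) → ∀ i → negate (lookup (a ∷ v) i) ≢ a
  negate-lookup≢head a v valid i eq = face⇒negate∉ (insertAll-face ⊥ (a ∷ v) valid)
    (lookup∈insertAll ⊥ (a ∷ v) i) (subst (_∈ˢ insertAll ⊥ (a ∷ v)) (≡.sym eq) (lookup∈insertAll ⊥ (a ∷ v) zero))

  -- After j + n steps with j < n the first entry is the negative of the entry number j of the
  -- initial flag. If it were the initial vertex, the facet would contain an antipodal pair.
  aperiodic : ∀ v → Valid {n} ⊥ v → ∀ k → 0 < k → k < 2 * n → iterate (rotation ⊥) v k ≢ v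
  aperiodic v@(a ∷ w) valid k 0<k k<2n eq =
    [ (λ k≤n → iterate≢-≤ v valid k 0<k k≤n eq) , beyond ]′ (ℕ.≤-<-connex k n)
    where
    open ≡.≡-Reasoning
    beyond : n < k → Data.Empty.⊥
    beyond n<k = negate-lookup≢head a w valid (fromℕ< j<n) (begin
      negate (lookup v (fromℕ< j<n))            ≡⟨ cong negate (head-iterate j v (fromℕ< j<n) (Fin.toℕ-fromℕ< j<n)) ⟨
      negate (head (iterate (rotation ⊥) v j))  ≡⟨ iterate-head-+n v j ⟨
      head (iterate (rotation ⊥) v (j + n))     ≡⟨ cong (λ k → head (iterate (rotation ⊥) v k)) j+n≡k ⟩
      head (iterate (rotation ⊥) v k)           ≡⟨ cong head eq ⟩
      a                                         ∎)
      where
      j = k ∸ n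
      j+n≡k : j + n ≡ k
      j+n≡k = ℕ.m∸n+n≡m (ℕ.<⇒≤ n<k)
      j<n : j < n
      j<n = ℕ.+-cancelʳ-< n j n (≡.subst₂ _<_ (≡.sym j+n≡k) (cong (λ k → n + k) (ℕ.+-identityʳ n)) k<2n)

  zigzags : IsCoxeterNumber (B-matrix n) (2 * n) × ZigzagsHaveLength (crossPolytope n) (2 * n)
  zigzags = simplicialLengths (B-label n) 4 B-label≡3 B-label≡4 last-edge
    (2 * n) z<s (B-power m) (someValid n ⊥ (λ i (x∈ , _) → Subsetₚ.∉⊥ x∈) ⊥-card) aperiodic

simplex-zigzags : ∀ n → .{{_ : NonZero n}} →
  IsCoxeterNumber (A-matrix n) (n + 1) × ZigzagsHaveLength (simplex n) (n + 1)
simplex-zigzags (suc m) = SimplexZigzags.zigzags m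

crossPolytope-zigzags : ∀ n → .{{_ : NonZero n}} →
  IsCoxeterNumber (B-matrix n) (2 * n) × ZigzagsHaveLength (crossPolytope n) (2 * n)
crossPolytope-zigzags (suc m) = CrossPolytopeZigzags.zigzags m

-- The ordered ring ℤ[φ]

neg : ℤ[φ] → ℤ[φ]
neg x = 0φ -φ x


+φ-assoc : ∀ x y z → (x +φ y) +φ z ≡ x +φ (y +φ z)
+φ-assoc (a ⊹ b φ) (c ⊹ d φ) (e ⊹ f φ) = cong₂ _⊹_φ (ℤ.+-assoc a c e) (ℤ.+-assoc b d f)

+φ-comm : ∀ x y → x +φ y ≡ y +φ x
+φ-comm (a ⊹ b φ) (c ⊹ d φ) = cong₂ _⊹_φ (ℤ.+-comm a c) (ℤ.+-comm b d)

+φ-identityˡ : ∀ x → 0φ +φ x ≡ x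
+φ-identityˡ (a ⊹ b φ) = cong₂ _⊹_φ (ℤ.+-identityˡ a) (ℤ.+-identityˡ b)

+φ-identityʳ : ∀ x → x +φ 0φ ≡ x
+φ-identityʳ x = ≡.trans (+φ-comm x 0φ) (+φ-identityˡ x)

+φ-inverseʳ : ∀ x → x +φ neg x ≡ 0φ
+φ-inverseʳ (a ⊹ b φ) = cong₂ _⊹_φ (cancel a) (cancel b)
  where
  cancel : ∀ a → a ℤ.+ (ℤ.0ℤ ℤ.- a) ≡ ℤ.0ℤ
  cancel a = ≡.trans (cong (λ x → a ℤ.+ x) (ℤ.+-identityˡ (ℤ.- a))) (ℤ.+-inverseʳ a)

*φ-assoc : ∀ x y z → (x *φ y) *φ z ≡ x *φ (y *φ z)
*φ-assoc (a ⊹ b φ) (c ⊹ d φ) (e ⊹ f φ) = cong₂ _⊹_φ (int a b c d e f) (coef a b c d e f)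
  where
  int : ∀ a b c d e f → (a ℤ.* c ℤ.+ b ℤ.* d) ℤ.* e ℤ.+ (a ℤ.* d ℤ.+ b ℤ.* c ℤ.+ b ℤ.* d) ℤ.* f
                      ≡ a ℤ.* (c ℤ.* e ℤ.+ d ℤ.* f) ℤ.+ b ℤ.* (c ℤ.* f ℤ.+ d ℤ.* e ℤ.+ d ℤ.* f)
  int = solve-∀
  coef : ∀ a b c d e f →
    (a ℤ.* c ℤ.+ b ℤ.* d) ℤ.* f ℤ.+ (a ℤ.* d ℤ.+ b ℤ.* c ℤ.+ b ℤ.* d) ℤ.* e ℤ.+ (a ℤ.* d ℤ.+ b ℤ.* c ℤ.+ b ℤ.* d) ℤ.* f
    ≡ a ℤ.* (c ℤ.* f ℤ.+ d ℤ.* e ℤ.+ d ℤ.* f) ℤ.+ b ℤ.* (c ℤ.* e ℤ.+ d ℤ.* f) ℤ.+ b ℤ.* (c ℤ.* f ℤ.+ d ℤ.* e ℤ.+ d ℤ.* f)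
  coef = solve-∀

*φ-comm : ∀ x y → x *φ y ≡ y *φ x
*φ-comm (a ⊹ b φ) (c ⊹ d φ) = cong₂ _⊹_φ (int a b c d) (coef a b c d)
  where
  int : ∀ a b c d → a ℤ.* c ℤ.+ b ℤ.* d ≡ c ℤ.* a ℤ.+ d ℤ.* b
  int = solve-∀
  coef : ∀ a b c d → a ℤ.* d ℤ.+ b ℤ.* c ℤ.+ b ℤ.* d ≡ c ℤ.* b ℤ.+ d ℤ.* a ℤ.+ d ℤ.* b
  coef = solve-∀

*φ-identityˡ : ∀ x → 1φ *φ x ≡ x
*φ-identityˡ (a ⊹ b φ) = cong₂ _⊹_φ (int a b) (coef a b)
  where
  int : ∀ a b → ℤ.1ℤ ℤ.* a ℤ.+ ℤ.0ℤ ℤ.* b ≡ a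
  int = solve-∀
  coef : ∀ a b → ℤ.1ℤ ℤ.* b ℤ.+ ℤ.0ℤ ℤ.* a ℤ.+ ℤ.0ℤ ℤ.* b ≡ b
  coef = solve-∀

*φ-distribʳ : ∀ x y z → (y +φ z) *φ x ≡ y *φ x +φ z *φ x
*φ-distribʳ (a ⊹ b φ) (c ⊹ d φ) (e ⊹ f φ) = cong₂ _⊹_φ (int a b c d e f) (coef a b c d e f)
  where
  int : ∀ a b c d e f → (c ℤ.+ e) ℤ.* a ℤ.+ (d ℤ.+ f) ℤ.* b ≡ (c ℤ.* a ℤ.+ d ℤ.* b) ℤ.+ (e ℤ.* a ℤ.+ f ℤ.* b)
  int = solve-∀
  coef : ∀ a b c d e f → (c ℤ.+ e) ℤ.* b ℤ.+ (d ℤ.+ f) ℤ.* a ℤ.+ (d ℤ.+ f) ℤ.* b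
                       ≡ (c ℤ.* b ℤ.+ d ℤ.* a ℤ.+ d ℤ.* b) ℤ.+ (e ℤ.* b ℤ.+ f ℤ.* a ℤ.+ f ℤ.* b)
  coef = solve-∀

commutativeRing-φ : CommutativeRing 0ℓ 0ℓ
commutativeRing-φ = record
  { Carrier = ℤ[φ] ; _≈_ = _≡_ ; _+_ = _+φ_ ; _*_ = _*φ_ ; -_ = neg ; 0# = 0φ ; 1# = 1φ
  ; isCommutativeRing = record
    { isRing = record
      { +-isAbelianGroup = record
        { isGroup = record
          { isMonoid = record
            { isSemigroup = record
              { isMagma = ≡.isMagma _+φ_
              ; assoc   = +φ-assoc
              }
            ; identity = +φ-identityˡ , +φ-identityʳ
            }
          ; inverse = (λ x → ≡.trans (+φ-comm (neg x) x) (+φ-inverseʳ x)) , +φ-inverseʳ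
          ; ⁻¹-cong = cong neg
          }
        ; comm = +φ-comm
        }
      ; *-cong     = cong₂ _*φ_
      ; *-assoc    = *φ-assoc
      ; *-identity = *φ-identityˡ , λ x → ≡.trans (*φ-comm x 1φ) (*φ-identityˡ x)
      ; distrib    = (λ x y z → ≡.trans (*φ-comm x (y +φ z))
                       (≡.trans (*φ-distribʳ x y z) (cong₂ _+φ_ (*φ-comm y x) (*φ-comm z x))))
                   , *φ-distribʳ
      }
    ; *-comm = *φ-comm
    }
  }

ring-φ : AlmostCommutativeRing 0ℓ 0ℓ
ring-φ = fromCommutativeRing commutativeRing-φ λ { ((+ 0) ⊹ (+ 0) φ) → just ≡.refl ; _ → nothing }


-- The ring structure given to the solver has `neg` but no subtraction, so identities with `_-φ_`
-- are brought to this form first.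
-φ-neg : ∀ x y → x -φ y ≡ x +φ neg y
-φ-neg (a ⊹ b φ) (c ⊹ d φ) = cong₂ (λ p q → (a ℤ.+ p) ⊹ (b ℤ.+ q) φ) (≡.sym (ℤ.+-identityˡ (ℤ.- c))) (≡.sym (ℤ.+-identityˡ (ℤ.- d)))

-φ-self : ∀ x → x -φ x ≡ 0φ
-φ-self x = ≡.trans (-φ-neg x x) (+φ-inverseʳ x)

neg-involutive : ∀ x → neg (neg x) ≡ x
neg-involutive x = ≡.trans (-φ-neg 0φ (neg x)) (lemma x)
  where
  lemma : ∀ x → 0φ +φ neg (neg x) ≡ x
  lemma = Solver.solve-∀ ring-φ

-φ-≡0 : ∀ {x y} → x -φ y ≡ 0φ → x ≡ y
-φ-≡0 {x} {y} eq = ≡.trans (lemma x y) (≡.trans (cong (y +φ_) (≡.trans (≡.sym (-φ-neg x y)) eq)) (≡.trans (+φ-comm y 0φ) (+φ-identityˡ y)))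
  where
  lemma : ∀ x y → x ≡ y +φ (x +φ neg y)
  lemma = Solver.solve-∀ ring-φ

-φ-+φ : ∀ x y → y -φ (x +φ y) ≡ neg x
-φ-+φ x y = ≡.trans (-φ-neg y (x +φ y)) (lemma x y)
  where
  lemma : ∀ x y → y +φ neg (x +φ y) ≡ neg x
  lemma = Solver.solve-∀ ring-φ

+φ--φ : ∀ x y z → (x +φ y) -φ z ≡ x +φ (y -φ z)
+φ--φ x y z = ≡.trans (-φ-neg (x +φ y) z) (≡.trans (+φ-assoc x y (neg z)) (cong (x +φ_) (≡.sym (-φ-neg y z))))

-1φ : ℤ[φ]
-1φ = ℤ.-1ℤ ⊹ ℤ.0ℤ φ

-1φ-* : ∀ x → -1φ *φ x ≡ neg x
-1φ-* = Solver.solve-∀ ring-φ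

-φ-interchange : ∀ a x b y → (a -φ x) +φ (b -φ y) ≡ (a +φ b) -φ (x +φ y)
-φ-interchange a x b y = ≡.trans (cong₂ _+φ_ (-φ-neg a x) (-φ-neg b y))
  (≡.trans (lemma a x b y) (≡.sym (-φ-neg (a +φ b) (x +φ y))))
  where
  lemma : ∀ a x b y → (a +φ neg x) +φ (b +φ neg y) ≡ (a +φ b) +φ neg (x +φ y)
  lemma = Solver.solve-∀ ring-φ

NatCoefficients : ℤ[φ] → Set
NatCoefficients z = ∃[ m ] ∃[ n ] z ≡ (+ m) ⊹ (+ n) φ

-- Multiplication by φ, since φ² = φ + 1.
shift : ℤ[φ] → ℤ[φ]
shift (a ⊹ b φ) = b ⊹ (a ℤ.+ b) φ

shifts : ℕ → ℤ[φ] → ℤ[φ]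
shifts zero    z = z
shifts (suc k) z = shifts k (shift z)

-- An element of ℤ[φ] is nonnegative iff some φᵏ times it has nonnegative coefficients.  In this
-- form, sums and products of nonnegative elements are visibly nonnegative.
Pos : ℤ[φ] → Set
Pos z = ∃[ k ] NatCoefficients (shifts k z)

shifts-Nat : ∀ k {z} → NatCoefficients z → NatCoefficients (shifts k z)
shifts-Nat zero    p                  = p
shifts-Nat (suc k) (m , n , ≡.refl) = shifts-Nat k (n , m + n , ≡.refl)

shifts-+ : ∀ j k z → shifts (j + k) z ≡ shifts k (shifts j z)
shifts-+ zero    k z = ≡.refl
shifts-+ (suc j) k z = shifts-+ j k (shift z)


shift-+φ : ∀ x y → shift (x +φ y) ≡ shift x +φ shift y
shift-+φ (a ⊹ b φ) (c ⊹ d φ) = cong (b ℤ.+ d ⊹_φ) (coef a b c d)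
  where
  coef : ∀ a b c d → a ℤ.+ c ℤ.+ (b ℤ.+ d) ≡ a ℤ.+ b ℤ.+ (c ℤ.+ d)
  coef = solve-∀

shift-*φˡ : ∀ x y → shift (x *φ y) ≡ shift x *φ y
shift-*φˡ (a ⊹ b φ) (c ⊹ d φ) = cong₂ _⊹_φ (int a b c d) (coef a b c d)
  where
  int : ∀ a b c d → a ℤ.* d ℤ.+ b ℤ.* c ℤ.+ b ℤ.* d ≡ b ℤ.* c ℤ.+ (a ℤ.+ b) ℤ.* d
  int = solve-∀
  coef : ∀ a b c d → a ℤ.* c ℤ.+ b ℤ.* d ℤ.+ (a ℤ.* d ℤ.+ b ℤ.* c ℤ.+ b ℤ.* d) ≡ b ℤ.* d ℤ.+ (a ℤ.+ b) ℤ.* c ℤ.+ (a ℤ.+ b) ℤ.* d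
  coef = solve-∀

shift-injective : ∀ {z} → shift z ≡ 0φ → z ≡ 0φ
shift-injective {a ⊹ b φ} eq with ≡.refl ← cong ℤ[φ].int eq =
  cong (_⊹ ℤ.0ℤ φ) (≡.trans (≡.sym (ℤ.+-identityʳ a)) (cong ℤ[φ].coef eq))

shifts-+φ : ∀ k x y → shifts k (x +φ y) ≡ shifts k x +φ shifts k y
shifts-+φ zero    x y = ≡.refl
shifts-+φ (suc k) x y = ≡.trans (cong (shifts k) (shift-+φ x y)) (shifts-+φ k (shift x) (shift y))

shifts-*φˡ : ∀ k x y → shifts k (x *φ y) ≡ shifts k x *φ y
shifts-*φˡ zero    x y = ≡.refl
shifts-*φˡ (suc k) x y = ≡.trans (cong (shifts k) (shift-*φˡ x y)) (shifts-*φˡ k (shift x) y)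

shifts-injective : ∀ k {z} → shifts k z ≡ 0φ → z ≡ 0φ
shifts-injective zero    eq = eq
shifts-injective (suc k) eq = shift-injective (shifts-injective k eq)

Pos-shift : ∀ {z} → Pos (shift z) → Pos z
Pos-shift (k , p) = suc k , p

Nat⇒Pos : ∀ m n → Pos ((+ m) ⊹ (+ n) φ)
Nat⇒Pos m n = 0 , m , n , ≡.refl

Pos-0 : Pos 0φ
Pos-0 = Nat⇒Pos 0 0

Pos-+ : ∀ {x y} → Pos x → Pos y → Pos (x +φ y)
Pos-+ {x} {y} (j , p) (k , q)
  with a , b , eq  ← subst NatCoefficients (≡.sym (shifts-+ j k x)) (shifts-Nat k p)
  with c , d , eq′ ← subst NatCoefficients (≡.trans (≡.sym (shifts-+ k j y)) (cong (λ i → shifts i y) (ℕ.+-comm k j)))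
                       (shifts-Nat j q) =
  j + k , a + c , b + d , ≡.trans (shifts-+φ (j + k) x y) (cong₂ _+φ_ eq eq′)

Pos-* : ∀ {x y} → Pos x → Pos y → Pos (x *φ y)
Pos-* {x} {y} (j , a , b , eq) (k , c , d , eq′) =
  k + j , a * c + b * d , a * d + b * c + b * d , (begin
    shifts (k + j) (x *φ y)        ≡⟨ shifts-+ k j (x *φ y) ⟩
    shifts j (shifts k (x *φ y))     ≡⟨ cong (shifts j ∘ shifts k) (*φ-comm x y) ⟩
    shifts j (shifts k (y *φ x))     ≡⟨ cong (shifts j) (shifts-*φˡ k y x) ⟩
    shifts j (shifts k y *φ x)       ≡⟨ cong (shifts j) (*φ-comm (shifts k y) x) ⟩
    shifts j (x *φ shifts k y)       ≡⟨ shifts-*φˡ j x (shifts k y) ⟩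
    shifts j x *φ shifts k y         ≡⟨ cong₂ _*φ_ eq eq′ ⟩
    ((+ a) ⊹ (+ b) φ) *φ ((+ c) ⊹ (+ d) φ)
      ≡⟨ cong₂ _⊹_φ (cong₂ ℤ._+_ (ℤ.pos-* a c) (ℤ.pos-* b d))
           (cong₂ ℤ._+_ (cong₂ ℤ._+_ (ℤ.pos-* a d) (ℤ.pos-* b c)) (ℤ.pos-* b d)) ⟨
    (+ (a * c + b * d)) ⊹ (+ (a * d + b * c + b * d)) φ ∎)
  where open ≡.≡-Reasoning

-- At a common power of φ both elements have natural coefficients. These add up to zero, so they
-- vanish, and multiplication by φ is injective.
Pos-antisym : ∀ {z} → Pos z → Pos (neg z) → z ≡ 0φ
Pos-antisym {z} (j , p) (k , q)
  with a , b , eq  ← subst NatCoefficients (≡.sym (shifts-+ j k z)) (shifts-Nat k p)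
  with c , d , eq′ ← subst NatCoefficients (≡.trans (≡.sym (shifts-+ k j (neg z))) (cong (λ i → shifts i (neg z)) (ℕ.+-comm k j)))
                       (shifts-Nat j q) =
  shifts-injective (j + k) (≡.trans eq (cong₂ (λ a b → (+ a) ⊹ (+ b) φ)
    (ℕ.m+n≡0⇒m≡0 a (ℤ.+-injective (cong ℤ[φ].int sum≡0)))
    (ℕ.m+n≡0⇒m≡0 b (ℤ.+-injective (cong ℤ[φ].coef sum≡0)))))
  where
  open ≡.≡-Reasoning
  shifts-0 : ∀ k → shifts k 0φ ≡ 0φ
  shifts-0 zero    = ≡.refl
  shifts-0 (suc k) = shifts-0 k
  sum≡0 : (+ (a + c)) ⊹ (+ (b + d)) φ ≡ 0φ
  sum≡0 = begin
    (+ (a + c)) ⊹ (+ (b + d)) φ                     ≡⟨ cong₂ _+φ_ eq eq′ ⟨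
    shifts (j + k) z +φ shifts (j + k) (neg z)       ≡⟨ shifts-+φ (j + k) z (neg z) ⟨
    shifts (j + k) (z +φ neg z)                        ≡⟨ cong (shifts (j + k)) (+φ-inverseʳ z) ⟩
    shifts (j + k) 0φ                                  ≡⟨ shifts-0 (j + k) ⟩
    0φ                                                   ∎

-- Descent: nφ − m = φ⁻²((2n − m)φ − (m − n)), and the condition says m ≤ nφ.
Pos-descent : ∀ m n → Acc _<_ m → m * m ≤ m * n + n * n → Pos ((ℤ.- + m) ⊹ (+ n) φ)
Pos-descent m n (acc rec) m≤nφ with m ℕ.≤? n
... | yes m≤n = Pos-shift (subst (λ b → Pos ((+ n) ⊹ b φ)) n-m≡ (Nat⇒Pos n (n ∸ m)))
  where
  n-m≡ : + (n ∸ m) ≡ ℤ.- + m ℤ.+ + n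
  n-m≡ = ≡.trans (≡.sym (ℤ.⊖-≥ m≤n)) (≡.trans (≡.sym (ℤ.m-n≡m⊖n n m)) (ℤ.+-comm (+ n) (ℤ.- + m)))
... | no m≰n with m ℕ.≤? n + n
...   | no m≰2n = ⊥-elim (ℕ.<⇒≱ too-large m≤nφ)
  where
  d = m ∸ suc (n + n)
  m≡ : suc (n + n) + d ≡ m
  m≡ = ℕ.m+[n∸m]≡n (ℕ.≰⇒> m≰2n)
  expand : ∀ n d → (suc (n + n) + d) * (suc (n + n) + d) ≡
    suc ((suc (n + n) + d) * n + n * n + (n * n + 3 * n + 3 * (n * d) + d * d + 2 * d))
  expand = ℕSolver.solve-∀
  too-large : m * n + n * n < m * m
  too-large = subst (λ m → m * n + n * n < m * m) m≡
    (ℕ.≤-trans (s≤s (ℕ.m≤m+n _ _)) (ℕ.≤-reflexive (≡.sym (expand n d))))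
...   | yes m≤2n = Pos-shift (Pos-shift (≡.subst₂ (λ a b → Pos (a ⊹ b φ)) a≡ b≡
                     (Pos-descent m′ n′ (rec m′<m) m′≤n′φ)))
  where
  m′ = m ∸ n
  n′ = n ∸ m′
  m≡ : n + m′ ≡ m
  m≡ = ℕ.m+[n∸m]≡n (ℕ.<⇒≤ (ℕ.≰⇒> m≰n))
  n≡ : m′ + n′ ≡ n
  n≡ = ℕ.m+[n∸m]≡n (ℕ.+-cancelˡ-≤ n m′ n (ℕ.≤-trans (ℕ.≤-reflexive m≡) m≤2n))
  0<n : 0 < n
  0<n = ℕ.n≢0⇒n>0 λ { ≡.refl → m≰n (subst (m ℕ.≤_) ≡.refl m≤2n) }
  m′<m : m′ < m
  m′<m = ℕ.≤-trans (ℕ.+-monoˡ-≤ m′ 0<n) (ℕ.≤-reflexive m≡)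
  -- With x = m′ and y = n′ one has m = 2x + y and n = x + y. Both sides of the condition contain
  -- 3x² + 4xy + y², and what remains is the same condition for m′ and n′.
  lhs : ∀ x y → (x + y + x) * (x + y + x) ≡
    3 * (x * x) + 4 * (x * y) + y * y + x * x
  lhs = ℕSolver.solve-∀
  rhs : ∀ x y → (x + y + x) * (x + y) + (x + y) * (x + y) ≡
    3 * (x * x) + 4 * (x * y) + y * y + (x * y + y * y)
  rhs = ℕSolver.solve-∀
  m′≤n′φ : m′ * m′ ≤ m′ * n′ + n′ * n′
  m′≤n′φ = ℕ.+-cancelˡ-≤ (3 * (m′ * m′) + 4 * (m′ * n′) + n′ * n′) _ _
    (≡.subst₂ _≤_ (lhs m′ n′) (rhs m′ n′)
      (≡.subst₂ (λ m n → m * m ≤ m * n + n * n) (≡.sym (≡.trans (cong (_+ m′) n≡) m≡)) (≡.sym n≡) m≤nφ))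
  a-lemma : ∀ x y → ℤ.- x ≡ ℤ.- (x ℤ.+ y ℤ.+ x) ℤ.+ (x ℤ.+ y)
  a-lemma = solve-∀
  b-lemma : ∀ x y → y ≡ x ℤ.+ y ℤ.+ (ℤ.- (x ℤ.+ y ℤ.+ x) ℤ.+ (x ℤ.+ y))
  b-lemma = solve-∀
  a≡ : ℤ.- + m′ ≡ ℤ.- + m ℤ.+ + n
  a≡ = ≡.trans (a-lemma (+ m′) (+ n′)) (≡.cong₂ (λ m n → ℤ.- + m ℤ.+ + n) (≡.trans (cong (_+ m′) n≡) m≡) n≡)
  b≡ : + n′ ≡ + n ℤ.+ (ℤ.- + m ℤ.+ + n)
  b≡ = ≡.trans (b-lemma (+ m′) (+ n′))
    (≡.cong₂ (λ m n → + n ℤ.+ (ℤ.- + m ℤ.+ + n)) (≡.trans (cong (_+ m′) n≡) m≡) n≡)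

signedSquare-+ : ∀ k → signedSquare (+ k) ≡ + (k * k)
signedSquare-+ k = ≡.sym (ℤ.pos-* k k)

signedSquare-neg : ∀ x → signedSquare (ℤ.- x) ≡ ℤ.- signedSquare x
signedSquare-neg x = ≡.trans (cong (λ k → ℤ.- x ℤ.* + k) (ℤ.∣-i∣≡∣i∣ x)) (≡.sym (ℤ.neg-distribˡ-* x (+ ℤ.∣ x ∣)))

signedSquare≤ : ∀ x → signedSquare x ℤ.≤ + (ℤ.∣ x ∣ * ℤ.∣ x ∣)
signedSquare≤ (+ k)    = ℤ.≤-reflexive (signedSquare-+ k)
signedSquare≤ -[1+ k ] = ℤ.-≤+

-- With M = m + 1, completing the square turns the condition M² ≤ Mn + n² of the descent into (2M -
-- n)² ≤ 5n², which is what `NonNegative` says once M exceeds n. For M ≤ n the condition is clear.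
Pos-mixed₁ : ∀ m n → NonNegative (-[1+ m ] ⊹ (+ n) φ) → Pos (-[1+ m ] ⊹ (+ n) φ)
Pos-mixed₁ m n 0≤ with suc m ℕ.≤? n
... | yes m<n = Pos-descent (suc m) n (<-wellFounded _)
        (ℕ.≤-trans (ℕ.*-monoʳ-≤ (suc m) m<n) (ℕ.m≤m+n _ _))
... | no m≮n = Pos-descent (suc m) n (<-wellFounded _)
        (subst (λ M → M * M ≤ M * n + n * n) n+d≡ (ℕ.*-cancelˡ-≤ 4 scaled))
  where
  d = suc m ∸ n
  n+d≡ : n + d ≡ suc m
  n+d≡ = ℕ.m+[n∸m]≡n (ℕ.<⇒≤ (ℕ.≰⇒> m≮n))
  e = n + (d + d)
  x≡ : (+ 2) ℤ.* -[1+ m ] ℤ.+ + n ≡ ℤ.- + e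
  x≡ = ≡.trans (cong (λ M → (+ 2) ℤ.* (ℤ.- + M) ℤ.+ + n) (≡.sym n+d≡)) (lemma (+ n) (+ d))
    where
    lemma : ∀ n d → (+ 2) ℤ.* (ℤ.- (n ℤ.+ d)) ℤ.+ n ≡ ℤ.- (n ℤ.+ (d ℤ.+ d))
    lemma = solve-∀
  e²≤5n² : e * e ≤ 5 * (n * n)
  e²≤5n² = ℤ.drop‿+≤+ (ℤ.0≤i-j⇒j≤i (subst (ℤ.0ℤ ℤ.≤_) eq 0≤))
    where
    eq : signedSquare ((+ 2) ℤ.* -[1+ m ] ℤ.+ + n) ℤ.+ (+ 5) ℤ.* signedSquare (+ n)
         ≡ + (5 * (n * n)) ℤ.- + (e * e)
    eq = ≡.trans (cong₂ ℤ._+_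
      (≡.trans (cong signedSquare x≡) (≡.trans (signedSquare-neg (+ e)) (cong ℤ.-_ (signedSquare-+ e))))
      (≡.trans (cong ((+ 5) ℤ.*_) (signedSquare-+ n)) (≡.sym (ℤ.pos-* 5 (n * n)))))
      (ℤ.+-comm (ℤ.- + (e * e)) (+ (5 * (n * n))))
  scaled : 4 * ((n + d) * (n + d)) ≤ 4 * ((n + d) * n + n * n)
  scaled = ≡.subst₂ _≤_ (lhs n d) (rhs n d) (ℕ.+-monoˡ-≤ (3 * (n * n) + 4 * (n * d)) e²≤5n²)
    where
    lhs : ∀ n d → (n + (d + d)) * (n + (d + d)) + (3 * (n * n) + 4 * (n * d)) ≡ 4 * ((n + d) * (n + d))
    lhs = ℕSolver.solve-∀
    rhs : ∀ n d → 5 * (n * n) + (3 * (n * n) + 4 * (n * d)) ≡ 4 * ((n + d) * n + n * n)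
    rhs = ℕSolver.solve-∀

-- With N = n + 1, multiplication by φ takes m - Nφ to -N + (m - N)φ, the shape treated by the
-- descent, provided that N ≤ m. Otherwise 2m - N has absolute value at most N, and the term -5N²
-- makes the defining expression negative.
Pos-mixed₂ : ∀ m n → NonNegative ((+ m) ⊹ -[1+ n ] φ) → Pos ((+ m) ⊹ -[1+ n ] φ)
Pos-mixed₂ m n 0≤ with suc n ℕ.≤? m
... | yes n<m = Pos-shift (subst (λ b → Pos (-[1+ n ] ⊹ b φ)) f≡ (Pos-descent N f (<-wellFounded _) condition))
  where
  N = suc n
  f = m ∸ N
  N+f≡ : N + f ≡ m
  N+f≡ = ℕ.m+[n∸m]≡n n<m
  f≡ : + f ≡ + m ℤ.+ -[1+ n ]
  f≡ = ≡.trans (lemma (+ f) (+ N)) (cong (λ m → + m ℤ.+ -[1+ n ]) N+f≡)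
    where
    lemma : ∀ f N → f ≡ N ℤ.+ f ℤ.+ ℤ.- N
    lemma = solve-∀
  e = N + (f + f)
  x≡ : (+ 2) ℤ.* (+ m) ℤ.+ -[1+ n ] ≡ + e
  x≡ = ≡.trans (cong (λ m → (+ 2) ℤ.* + m ℤ.+ -[1+ n ]) (≡.sym N+f≡)) (lemma (+ N) (+ f))
    where
    lemma : ∀ N f → (+ 2) ℤ.* (N ℤ.+ f) ℤ.+ ℤ.- N ≡ N ℤ.+ (f ℤ.+ f)
    lemma = solve-∀
  5N²≤e² : 5 * (N * N) ≤ e * e
  5N²≤e² = ℤ.drop‿+≤+ (ℤ.0≤i-j⇒j≤i (subst (ℤ.0ℤ ℤ.≤_) eq 0≤))
    where
    eq : signedSquare ((+ 2) ℤ.* (+ m) ℤ.+ -[1+ n ]) ℤ.+ (+ 5) ℤ.* signedSquare -[1+ n ]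
         ≡ + (e * e) ℤ.- + (5 * (N * N))
    eq = cong₂ ℤ._+_ (≡.trans (cong signedSquare x≡) (signedSquare-+ e))
      (≡.trans (cong ((+ 5) ℤ.*_) (≡.trans (signedSquare-neg (+ N)) (cong ℤ.-_ (signedSquare-+ N))))
        (≡.trans (≡.sym (ℤ.neg-distribʳ-* (+ 5) (+ (N * N)))) (cong ℤ.-_ (≡.sym (ℤ.pos-* 5 (N * N))))))
  condition : N * N ≤ N * f + f * f
  condition = ℕ.*-cancelˡ-≤ 4 (ℕ.+-cancelˡ-≤ (N * N) _ _ (≡.subst₂ _≤_ (lhs N) (rhs N f) 5N²≤e²))
    where
    lhs : ∀ N → 5 * (N * N) ≡ N * N + 4 * (N * N)
    lhs = ℕSolver.solve-∀
    rhs : ∀ N f → (N + (f + f)) * (N + (f + f)) ≡ N * N + 4 * (N * f + f * f)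
    rhs = ℕSolver.solve-∀
... | no n≮m = ⊥-elim (ℤ.<⇒≱ s<0 0≤)
  where
  N = suc n
  x = (+ 2) ℤ.* (+ m) ℤ.+ -[1+ n ]
  g = N ∸ m
  m+g≡ : m + g ≡ N
  m+g≡ = ℕ.m+[n∸m]≡n (ℕ.<⇒≤ (ℕ.≰⇒> n≮m))
  ∣x∣≤N : ℤ.∣ x ∣ ≤ N
  ∣x∣≤N = ℕ.≤-trans (ℕ.≤-reflexive (cong ℤ.∣_∣ x≡))
    (ℕ.≤-trans (ℤ.∣i-j∣≤∣i∣+∣j∣ (+ m) (+ g)) (ℕ.≤-reflexive m+g≡))
    where
    lemma : ∀ m g → (+ 2) ℤ.* m ℤ.+ ℤ.- (m ℤ.+ g) ≡ m ℤ.- g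
    lemma = solve-∀
    x≡ : x ≡ + m ℤ.- + g
    x≡ = ≡.trans (cong (λ N → (+ 2) ℤ.* + m ℤ.+ ℤ.- + N) (≡.sym m+g≡)) (lemma (+ m) (+ g))
  s<0 : signedSquare x ℤ.+ (+ 5) ℤ.* signedSquare -[1+ n ] ℤ.< ℤ.0ℤ
  s<0 = ℤ.≤-<-trans (ℤ.+-monoˡ-≤ _ (ℤ.≤-trans (signedSquare≤ x) (ℤ.+≤+ (ℕ.*-mono-≤ ∣x∣≤N ∣x∣≤N))))
    (subst (ℤ._< ℤ.0ℤ) (≡.trans (lemma (+ (N * N))) (cong (λ y → + (N * N) ℤ.+ (+ 5) ℤ.* y)
      (≡.sym (≡.trans (signedSquare-neg (+ N)) (cong ℤ.-_ (signedSquare-+ N))))))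
      ℤ.-<+)
    where
    lemma : ∀ y → ℤ.- ((+ 4) ℤ.* y) ≡ y ℤ.+ (+ 5) ℤ.* (ℤ.- y)
    lemma = solve-∀

NonNegative⇒Pos : ∀ z → NonNegative z → Pos z
NonNegative⇒Pos ((+ m) ⊹ (+ n) φ)       _  = Nat⇒Pos m n
NonNegative⇒Pos (-[1+ m ] ⊹ (+ n) φ)    0≤ = Pos-mixed₁ m n 0≤
NonNegative⇒Pos ((+ m) ⊹ -[1+ n ] φ)    0≤ = Pos-mixed₂ m n 0≤
NonNegative⇒Pos (-[1+ m ] ⊹ -[1+ n ] φ) ()

NonNegative-total : ∀ z → ¬ NonNegative z → NonNegative (neg z)
NonNegative-total (a ⊹ b φ) ¬0≤ = subst (ℤ.0ℤ ℤ.≤_) eq (ℤ.neg-mono-≤ (ℤ.<⇒≤ (ℤ.≰⇒> ¬0≤)))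
  where
  lemma : ∀ a b → ℤ.- ((+ 2) ℤ.* a ℤ.+ b) ≡ (+ 2) ℤ.* (ℤ.0ℤ ℤ.- a) ℤ.+ (ℤ.0ℤ ℤ.- b)
  lemma = solve-∀
  distrib : ∀ p q → ℤ.- (p ℤ.+ (+ 5) ℤ.* q) ≡ ℤ.- p ℤ.+ (+ 5) ℤ.* (ℤ.- q)
  distrib = solve-∀
  eq : ℤ.- (signedSquare ((+ 2) ℤ.* a ℤ.+ b) ℤ.+ (+ 5) ℤ.* signedSquare b)
     ≡ signedSquare ((+ 2) ℤ.* (ℤ.0ℤ ℤ.- a) ℤ.+ (ℤ.0ℤ ℤ.- b)) ℤ.+ (+ 5) ℤ.* signedSquare (ℤ.0ℤ ℤ.- b)
  eq = ≡.trans (distrib (signedSquare ((+ 2) ℤ.* a ℤ.+ b)) (signedSquare b)) (cong₂ (λ p q → p ℤ.+ (+ 5) ℤ.* q)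
    (≡.trans (≡.sym (signedSquare-neg ((+ 2) ℤ.* a ℤ.+ b))) (cong signedSquare (lemma a b)))
    (≡.trans (≡.sym (signedSquare-neg b)) (cong signedSquare (≡.sym (ℤ.+-identityˡ (ℤ.- b))))))

-- If `z` failed to be `NonNegative`, its negative would be so and hence `Pos`; antisymmetry then
-- gives z = 0, which is `NonNegative` after all.
Pos⇒NonNegative : ∀ {z} → Pos z → NonNegative z
Pos⇒NonNegative {z@(a ⊹ b φ)} p
  with ℤ.0ℤ ℤ.≤? signedSquare ((+ 2) ℤ.* a ℤ.+ b) ℤ.+ (+ 5) ℤ.* signedSquare b
... | yes 0≤ = 0≤
... | no ¬0≤ = ⊥-elim (¬0≤ (subst NonNegative (≡.sym z≡0) ℤ.≤-refl))
  where
  z≡0 : z ≡ 0φ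
  z≡0 = Pos-antisym p (NonNegative⇒Pos (neg z) (NonNegative-total z ¬0≤))

-- Polytopes whose faces are cliques

infixl 6 _⊞_
infixr 7 _⊡_

_⊞_ : ∀ {d} → Vec ℤ[φ] d → Vec ℤ[φ] d → Vec ℤ[φ] d
_⊞_ = Vec.zipWith _+φ_

_⊡_ : ∀ {d} → ℤ[φ] → Vec ℤ[φ] d → Vec ℤ[φ] d
k ⊡ v = Vec.map (k *φ_) v

0ᵛ : ∀ {d} → Vec ℤ[φ] d
0ᵛ = Vec.replicate _ 0φ

_≟φ_ : DecidableEquality ℤ[φ]
(a ⊹ b φ) ≟φ (c ⊹ d φ) = map′ (λ (p , q) → cong₂ _⊹_φ p q) (λ eq → cong ℤ[φ].int eq , cong ℤ[φ].coef eq)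
  (a ℤ.≟ c ×-dec b ℤ.≟ d)

_≟ᵛ_ : ∀ {d} → DecidableEquality (Vec ℤ[φ] d)
_≟ᵛ_ = Vecₚ.≡-dec _≟φ_

nonNegative? : ∀ z → Dec (NonNegative z)
nonNegative? (a ⊹ b φ) = ℤ.0ℤ ℤ.≤? _


dot-comm : ∀ {d} (u v : Vec ℤ[φ] d) → dot u v ≡ dot v u
dot-comm []      []      = ≡.refl
dot-comm (x ∷ u) (y ∷ v) = cong₂ _+φ_ (*φ-comm x y) (dot-comm u v)

dot-⊞ʳ : ∀ {d} (f u v : Vec ℤ[φ] d) → dot f (u ⊞ v) ≡ dot f u +φ dot f v
dot-⊞ʳ []      []      []      = ≡.refl
dot-⊞ʳ (x ∷ f) (y ∷ u) (z ∷ v) = ≡.trans (cong (x *φ (y +φ z) +φ_) (dot-⊞ʳ f u v)) (lemma x y z (dot f u) (dot f v))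
  where
  lemma : ∀ x y z p q → x *φ (y +φ z) +φ (p +φ q) ≡ (x *φ y +φ p) +φ (x *φ z +φ q)
  lemma = Solver.solve-∀ ring-φ

dot-⊡ʳ : ∀ {d} k (f v : Vec ℤ[φ] d) → dot f (k ⊡ v) ≡ k *φ dot f v
dot-⊡ʳ k []      []      = lemma k
  where
  lemma : ∀ k → 0φ ≡ k *φ 0φ
  lemma = Solver.solve-∀ ring-φ
dot-⊡ʳ k (x ∷ f) (y ∷ v) = ≡.trans (cong (x *φ (k *φ y) +φ_) (dot-⊡ʳ k f v)) (lemma k x y (dot f v))
  where
  lemma : ∀ k x y p → x *φ (k *φ y) +φ k *φ p ≡ k *φ (x *φ y +φ p)
  lemma = Solver.solve-∀ ring-φ

dot-0ʳ : ∀ {d} (f : Vec ℤ[φ] d) → dot f 0ᵛ ≡ 0φ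
dot-0ʳ []      = ≡.refl
dot-0ʳ (x ∷ f) = ≡.trans (cong (x *φ 0φ +φ_) (dot-0ʳ f)) (lemma x)
  where
  lemma : ∀ x → x *φ 0φ +φ 0φ ≡ 0φ
  lemma = Solver.solve-∀ ring-φ

dot-⊞ˡ : ∀ {d} (u v f : Vec ℤ[φ] d) → dot (u ⊞ v) f ≡ dot u f +φ dot v f
dot-⊞ˡ u v f = ≡.trans (dot-comm (u ⊞ v) f) (≡.trans (dot-⊞ʳ f u v) (cong₂ _+φ_ (dot-comm f u) (dot-comm f v)))

dot-0ˡ : ∀ {d} (f : Vec ℤ[φ] d) → dot 0ᵛ f ≡ 0φ
dot-0ˡ f = ≡.trans (dot-comm 0ᵛ f) (dot-0ʳ f)

⊞-identityˡ : ∀ {d} (v : Vec ℤ[φ] d) → 0ᵛ ⊞ v ≡ v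
⊞-identityˡ []      = ≡.refl
⊞-identityˡ (x ∷ v) = cong₂ _∷_ (+φ-identityˡ x) (⊞-identityˡ v)

⊞-comm : ∀ {d} (u v : Vec ℤ[φ] d) → u ⊞ v ≡ v ⊞ u
⊞-comm []      []      = ≡.refl
⊞-comm (x ∷ u) (y ∷ v) = cong₂ _∷_ (+φ-comm x y) (⊞-comm u v)

⊞-assoc : ∀ {d} (u v w : Vec ℤ[φ] d) → (u ⊞ v) ⊞ w ≡ u ⊞ (v ⊞ w)
⊞-assoc []      []      []      = ≡.refl
⊞-assoc (x ∷ u) (y ∷ v) (z ∷ w) = cong₂ _∷_ (+φ-assoc x y z) (⊞-assoc u v w)

⊡-⊞ : ∀ {d} k (u v : Vec ℤ[φ] d) → k ⊡ (u ⊞ v) ≡ k ⊡ u ⊞ k ⊡ v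
⊡-⊞ k []      []      = ≡.refl
⊡-⊞ k (x ∷ u) (y ∷ v) = cong₂ _∷_ (lemma k x y) (⊡-⊞ k u v)
  where
  lemma : ∀ k x y → k *φ (x +φ y) ≡ k *φ x +φ k *φ y
  lemma = Solver.solve-∀ ring-φ

⊞-cancel : ∀ {d} (t u : Vec ℤ[φ] d) → (t ⊞ u) ⊞ -1φ ⊡ t ≡ u
⊞-cancel []      []      = ≡.refl
⊞-cancel (x ∷ t) (y ∷ u) = cong₂ _∷_ (lemma x y) (⊞-cancel t u)
  where
  lemma : ∀ x y → (x +φ y) +φ -1φ *φ x ≡ y
  lemma = Solver.solve-∀ ring-φ

-- The vertex beyond a ridge with vertex sum s, in the simplicial polytopes considered: there
-- t + t′ = φ⁻¹s for the two vertices completing the ridge to a facet.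
reflect : ∀ {d} → Vec ℤ[φ] d → Vec ℤ[φ] d → Vec ℤ[φ] d
reflect s t = φ⁻¹ ⊡ s ⊞ -1φ ⊡ t

-- The successive vertices of the link polygon of a face with vertex sum `s`: adding the current
-- vertex to that face gives the ridge across which the preceding vertex is reflected.
reflections : ∀ {d} → Vec ℤ[φ] d → Vec ℤ[φ] d → Vec ℤ[φ] d → ℕ → Vec ℤ[φ] d
reflections s a b zero          = a
reflections s a b (suc zero)    = b
reflections s a b (suc (suc k)) = reflect (s ⊞ reflections s a b (suc k)) (reflections s a b k)

private
  reflection₃ : ∀ s a b → φ⁻¹ *φ (s +φ (φ⁻¹ *φ (s +φ b) +φ -1φ *φ a)) +φ -1φ *φ b ≡ s +φ -1φ *φ (φ⁻¹ *φ (a +φ b))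
  reflection₃ = Solver.solve-∀ ring-φ

  reflection₄ : ∀ s a b → φ⁻¹ *φ (s +φ (s +φ -1φ *φ (φ⁻¹ *φ (a +φ b)))) +φ -1φ *φ (φ⁻¹ *φ (s +φ b) +φ -1φ *φ a) ≡ φ⁻¹ *φ s +φ φ⁻¹ *φ a +φ -1φ *φ b
  reflection₄ = Solver.solve-∀ ring-φ

  reflection₅ : ∀ s a b → φ⁻¹ *φ (s +φ (φ⁻¹ *φ s +φ φ⁻¹ *φ a +φ -1φ *φ b)) +φ -1φ *φ (s +φ -1φ *φ (φ⁻¹ *φ (a +φ b))) ≡ a
  reflection₅ = Solver.solve-∀ ring-φ

  reflection₆ : ∀ s a b → φ⁻¹ *φ (s +φ a) +φ -1φ *φ (φ⁻¹ *φ s +φ φ⁻¹ *φ a +φ -1φ *φ b) ≡ b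
  reflection₆ = Solver.solve-∀ ring-φ

-- Up to a translation the recurrence is x″ = φ⁻¹x′ - x with φ⁻¹ = 2 cos 72°, a rotation by a fifth
-- of a turn. The terms numbered 3 and 4 are first brought to closed forms, which keeps the
-- expressions small.
reflections-5 : ∀ {d} (s a b : Vec ℤ[φ] d) → reflections s a b 5 ≡ a
reflections-5 []      []      []      = ≡.refl
reflections-5 (s ∷ u) (a ∷ v) (b ∷ w) = cong₂ _∷_ eq (reflections-5 u v w)
  where
  eq : φ⁻¹ *φ (s +φ (φ⁻¹ *φ (s +φ (φ⁻¹ *φ (s +φ (φ⁻¹ *φ (s +φ b) +φ -1φ *φ a)) +φ -1φ *φ b)) +φ -1φ *φ (φ⁻¹ *φ (s +φ b) +φ -1φ *φ a))) +φ
       -1φ *φ (φ⁻¹ *φ (s +φ (φ⁻¹ *φ (s +φ b) +φ -1φ *φ a)) +φ -1φ *φ b) ≡ a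
  eq = ≡.trans (cong (λ x₃ → φ⁻¹ *φ (s +φ (φ⁻¹ *φ (s +φ x₃) +φ -1φ *φ (φ⁻¹ *φ (s +φ b) +φ -1φ *φ a))) +φ -1φ *φ x₃) (reflection₃ s a b))
    (≡.trans (cong (λ x₄ → φ⁻¹ *φ (s +φ x₄) +φ -1φ *φ (s +φ -1φ *φ (φ⁻¹ *φ (a +φ b)))) (reflection₄ s a b)) (reflection₅ s a b))

reflections-6 : ∀ {d} (s a b : Vec ℤ[φ] d) → reflections s a b 6 ≡ b
reflections-6 s a b = ≡.trans (cong (λ x → reflect (s ⊞ x) (reflections s a b 4)) (reflections-5 s a b)) (go s a b)
  where
  go : ∀ {d} (s a b : Vec ℤ[φ] d) → reflect (s ⊞ a) (reflections s a b 4) ≡ b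
  go []      []      []      = ≡.refl
  go (s ∷ u) (a ∷ v) (b ∷ w) = cong₂ _∷_ eq (go u v w)
    where
    eq : φ⁻¹ *φ (s +φ a) +φ -1φ *φ (φ⁻¹ *φ (s +φ (φ⁻¹ *φ (s +φ (φ⁻¹ *φ (s +φ b) +φ -1φ *φ a)) +φ -1φ *φ b)) +φ -1φ *φ (φ⁻¹ *φ (s +φ b) +φ -1φ *φ a)) ≡ b
    eq = ≡.trans (cong (λ x₃ → φ⁻¹ *φ (s +φ a) +φ -1φ *φ (φ⁻¹ *φ (s +φ x₃) +φ -1φ *φ (φ⁻¹ *φ (s +φ b) +φ -1φ *φ a))) (reflection₃ s a b))
      (≡.trans (cong (λ x₄ → φ⁻¹ *φ (s +φ a) +φ -1φ *φ x₄) (reflection₄ s a b)) (reflection₆ s a b))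

mult : ℕ → ℤ[φ] → ℤ[φ]
mult zero    a = 0φ
mult (suc k) a = a +φ mult k a

module _ {d : ℕ} where

  vsum : ∀ {N} → (Fin N → Vec ℤ[φ] d) → Subset N → Vec ℤ[φ] d
  vsum p []          = 0ᵛ
  vsum p (true  ∷ X) = p zero ⊞ vsum (p ∘ suc) X
  vsum p (false ∷ X) = vsum (p ∘ suc) X

  vsum-⊕ : ∀ {N} (p : Fin N → Vec ℤ[φ] d) X a → a ∉ˢ X → vsum p (X ⊕ a) ≡ vsum p X ⊞ p a
  vsum-⊕ p (true  ∷ X) zero    a∉ = ⊥-elim (a∉ Vec.here)
  vsum-⊕ p (false ∷ X) zero    a∉ =
    ≡.trans (cong (λ Y → p zero ⊞ vsum (p ∘ suc) Y) (Subsetₚ.∪-identityʳ X)) (⊞-comm _ _)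
  vsum-⊕ p (true  ∷ X) (suc a) a∉ =
    ≡.trans (cong (p zero ⊞_) (vsum-⊕ (p ∘ suc) X a (a∉ ∘ Vec.there))) (≡.sym (⊞-assoc _ _ _))
  vsum-⊕ p (false ∷ X) (suc a) a∉ = vsum-⊕ (p ∘ suc) X a (a∉ ∘ Vec.there)

  vsum-⊥ : ∀ {N} (p : Fin N → Vec ℤ[φ] d) → vsum p ⊥ ≡ 0ᵛ
  vsum-⊥ {zero}  p = ≡.refl
  vsum-⊥ {suc N} p = vsum-⊥ (p ∘ suc)

  dot-vsum-≡ : ∀ {N} (p : Fin N → Vec ℤ[φ] d) X q A → (∀ {i} → i ∈ˢ X → dot (p i) q ≡ A) →
    dot (vsum p X) q ≡ mult (∣ X ∣) A
  dot-vsum-≡ p []          q A eq = dot-0ˡ q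
  dot-vsum-≡ p (true  ∷ X) q A eq = ≡.trans (dot-⊞ˡ (p zero) (vsum (p ∘ suc) X) q)
    (cong₂ _+φ_ (eq Vec.here) (dot-vsum-≡ (p ∘ suc) X q A (eq ∘ Vec.there)))
  dot-vsum-≡ p (false ∷ X) q A eq = dot-vsum-≡ (p ∘ suc) X q A (eq ∘ Vec.there)

  dot-vsum-≤ : ∀ {N} (p : Fin N → Vec ℤ[φ] d) X q A → (∀ {i} → i ∈ˢ X → Pos (A -φ dot (p i) q)) →
    Pos (mult (∣ X ∣) A -φ dot (vsum p X) q)
  dot-vsum-≤ p []          q A le = subst (λ x → Pos (0φ -φ x)) (≡.sym (dot-0ˡ q)) Pos-0
  dot-vsum-≤ p (true  ∷ X) q A le = subst Pos
    (≡.trans (-φ-interchange A (dot (p zero) q) (mult (∣ X ∣) A) (dot (vsum (p ∘ suc) X) q))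
             (cong (A +φ mult (∣ X ∣) A -φ_) (≡.sym (dot-⊞ˡ (p zero) _ q))))
    (Pos-+ (le Vec.here) (dot-vsum-≤ (p ∘ suc) X q A (le ∘ Vec.there)))
  dot-vsum-≤ p (false ∷ X) q A le = dot-vsum-≤ (p ∘ suc) X q A (le ∘ Vec.there)

subset-of-size : ∀ {N} k (X : Subset N) → k ≤ ∣ X ∣ → ∃[ Y ] Y ⊆ X × ∣ Y ∣ ≡ k
subset-of-size {N} zero X       _       = ⊥ , (⊥-elim ∘ Subsetₚ.∉⊥) , Subsetₚ.∣⊥∣≡0 N
subset-of-size (suc k) (true  ∷ X) (s≤s p) =
  let Y , Y⊆X , card = subset-of-size k X p in true ∷ Y , Subsetₚ.in⊆in Y⊆X , cong suc card
subset-of-size (suc k) (false ∷ X) p       =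
  let Y , Y⊆X , card = subset-of-size (suc k) X p in false ∷ Y , Subsetₚ.s⊆s Y⊆X , card

module SphericalPoints {d} (points : List (Vec ℤ[φ] d)) (A : ℤ[φ]) where

  Bounded : Vec ℤ[φ] d → ℤ[φ] → Set
  Bounded f c = ∀ {z} → z ∈ points → Pos (c -φ dot f z)

  -- By `separate`, a hyperplane that supports the hull at both `x` and `y` passes through the
  -- origin. The hyperplane of a proper face never does, so such a pair lies in no proper face. The
  -- other two fields put the product strictly below that of adjacent vertices.
  record Far (x y : Vec ℤ[φ] d) : Set where
    field
      below    : Pos (A -φ dot x y)
      apart    : dot x y ≢ A
      separate : ∀ f c → Bounded f c → dot f x ≡ c → dot f y ≡ c → c ≡ 0φ

  Pair : Vec ℤ[φ] d → Vec ℤ[φ] d → Set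
  Pair x y = x ≡ y ⊎ dot x y ≡ A ⊎ Far x y

  pair⇒below : ∀ {x y} → dot x y ≡ A ⊎ Far x y → Pos (A -φ dot x y)
  pair⇒below (inj₁ adj)     = subst (λ z → Pos (A -φ z)) (≡.sym adj) (subst Pos (≡.sym (-φ-self A)) Pos-0)
  pair⇒below (inj₂ distant) = Far.below distant

  -- M is the set of vertices adjacent to some vertices with sum s.  Any k further ones that form a
  -- clique with them are completed to a facet by exactly two vertices t and t′.
  Links : ℕ → Vec ℤ[φ] d → (Vec ℤ[φ] d → Set) → Set
  Links zero    s M = ∃[ t ] ∃[ t′ ] M t × M t′ × t ⊞ t′ ≡ φ⁻¹ ⊡ s × (∀ {y} → M y → y ≡ t ⊎ y ≡ t′)
  Links (suc k) s M = ∀ {w} → M w → Links k (s ⊞ w) (λ z → M z × dot w z ≡ A)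

sumφ : ∀ {l} → Vec ℤ[φ] l → ℤ[φ]
sumφ = Vec.foldr _ _+φ_ 0φ

-- How the products of the vertices of a flag with a fixed vector change along a zigzag.
rotateDots : ∀ {l} → Vec ℤ[φ] (suc l) → Vec ℤ[φ] (suc l)
rotateDots (x ∷ w) = w ∷ʳ (φ⁻¹ *φ sumφ w +φ neg x)

-- The fixed vector is here the first vertex of the flag: its product with itself is `R`, with each
-- of the other vertices `A`.
initialDots : ∀ m → ℤ[φ] → ℤ[φ] → Vec ℤ[φ] (suc m)
initialDots m R A = R ∷ Vec.replicate m A

module CliqueFaces {n : ℕ} (points : List (Vec ℤ[φ] n)) (R A : ℤ[φ])
  (lookup-injective : ∀ {i j} → List.lookup points i ≡ List.lookup points j → i ≡ j)
  (norm : ∀ {x} → x ∈ points → dot x x ≡ R)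
  (antipode : ∀ {x} → x ∈ points → -1φ ⊡ x ∈ points)
  (below : ∀ {x y} → x ∈ points → y ∈ points → x ≡ y ⊎ Pos (A -φ dot x y))
  (A<R : Pos (R -φ A)) (A≢R : A ≢ R) (-R≢A : neg R ≢ A) (-R≢R : neg R ≢ R)
  (vertex : Fin (List.length points))
  where
  open FaceComplex (convexHull points) using (IsFace)

  private
    N : ℕ
    N = List.length points

  pt : Fin N → Vec ℤ[φ] n
  pt = List.lookup points

  pt∈ : ∀ i → pt i ∈ points
  pt∈ i = ∈ₗ.∈-lookup i

  index : ∀ {x} → x ∈ points → ∃[ i ] pt i ≡ x
  index x∈ = Any.index x∈ , ≡.sym (Anyₚ.lookup-index x∈)

  norm-pt : ∀ i → dot (pt i) (pt i) ≡ R
  norm-pt i = norm (pt∈ i)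

  Adjacent : Fin N → Fin N → Set
  Adjacent i j = dot (pt i) (pt j) ≡ A

  adjacent-sym : ∀ {i j} → Adjacent i j → Adjacent j i
  adjacent-sym {i} {j} p = ≡.trans (dot-comm (pt j) (pt i)) p

  ¬adjacent-refl : ∀ {i} → ¬ Adjacent i i
  ¬adjacent-refl {i} p = A≢R (≡.trans (≡.sym p) (norm-pt i))

  Clique : Subset N → Set
  Clique X = ∀ {i j} → i ∈ˢ X → j ∈ˢ X → i ≢ j → Adjacent i j

  clique-⊆ : ∀ {X Y} → X ⊆ Y → Clique Y → Clique X
  clique-⊆ X⊆Y clique i∈ j∈ = clique (X⊆Y i∈) (X⊆Y j∈)

  clique-⊕ : ∀ {X a} → Clique X → (∀ {i} → i ∈ˢ X → Adjacent i a) → Clique (X ⊕ a)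
  clique-⊕ {X} {a} clique adjacent i∈ j∈ i≢j with ∈-insert⁻ X a i∈ | ∈-insert⁻ X a j∈
  ... | inj₁ i∈X    | inj₁ j∈X    = clique i∈X j∈X i≢j
  ... | inj₁ i∈X    | inj₂ ≡.refl = adjacent i∈X
  ... | inj₂ ≡.refl | inj₁ j∈X    = adjacent-sym (adjacent j∈X)
  ... | inj₂ ≡.refl | inj₂ ≡.refl = ⊥-elim (i≢j ≡.refl)

  clique-adjacent : ∀ {X a} → a ∉ˢ X → Clique (X ⊕ a) → ∀ {i} → i ∈ˢ X → Adjacent i a
  clique-adjacent {X} {a} a∉ clique i∈ = clique (∈-insertˡ a i∈) (∈-insertʳ X a) λ { ≡.refl → a∉ i∈ }

  dot-antipode : ∀ (f x : Vec ℤ[φ] n) → dot f (-1φ ⊡ x) ≡ neg (dot f x)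
  dot-antipode f x = ≡.trans (dot-⊡ʳ -1φ f x) (-1φ-* (dot f x))

  dot-antipode-self : ∀ i → dot (pt i) (-1φ ⊡ pt i) ≡ neg R
  dot-antipode-self i = ≡.trans (dot-antipode (pt i) (pt i)) (cong neg (norm-pt i))

  -- The hyperplane of a proper face does not pass through the origin, as the hull is centrally
  -- symmetric.
  exposed⇒c≢0 : ∀ {X : Subset N} f c → X ⊂ ⊤ → (∀ i → NonNegative (c -φ dot f (pt i))) →
    (∀ i → (i ∈ˢ X) ⇔ (dot f (pt i) ≡ c)) → c ≢ 0φ
  exposed⇒c≢0 f c (_ , k , _ , k∉X) bound iff c≡0 = k∉X (Equivalence.from (iff k) (≡.trans f·k≡0 (≡.sym c≡0)))
    where
    f·k≡0 : dot f (pt k) ≡ 0φ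
    f·k≡0 with j , eq ← index (antipode (pt∈ k)) = Pos-antisym
      (subst Pos (≡.trans (cong₂ _-φ_ c≡0 (≡.trans (cong (dot f) eq) (dot-antipode f (pt k)))) (neg-involutive (dot f (pt k))))
        (NonNegative⇒Pos (c -φ dot f (pt j)) (bound j)))
      (subst (λ c → Pos (c -φ dot f (pt k))) c≡0 (NonNegative⇒Pos (c -φ dot f (pt k)) (bound k)))

  -- The functional is the product with the sum of the clique. A member contributes `R` once and `A`
  -- otherwise; a vertex outside contributes at most `A` for every member, and so falls short by at
  -- least R - A > 0. The empty clique is covered too, with functional 0 and the positive bound R -
  -- A.
  clique⇒face : ∀ {X} → Clique X → IsFace X
  clique⇒face {X} clique = (Subsetₚ.⊆⊤ , outside) , f , c , bound , iff
    where
    outside : ∃[ x ] x ∈ˢ ⊤ × x ∉ˢ X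
    outside with vertex Subsetₚ.∈? X
    ... | no  v∉ = vertex , Subsetₚ.∈⊤ , v∉
    ... | yes v∈ with j , eq ← index (antipode (pt∈ vertex)) = j , Subsetₚ.∈⊤ , j∉
      where
      dot≡ : dot (pt vertex) (pt j) ≡ neg R
      dot≡ = ≡.trans (cong (dot (pt vertex)) eq)
        (dot-antipode-self vertex)
      j∉ : j ∉ˢ X
      j∉ j∈ with vertex Fin.≟ j
      ... | yes ≡.refl = -R≢R (≡.trans (≡.sym dot≡) (norm-pt vertex))
      ... | no  v≢j    = -R≢A (≡.trans (≡.sym dot≡) (clique v∈ j∈ v≢j))
    f : Vec ℤ[φ] n
    f = vsum pt X
    c : ℤ[φ]
    c = (R -φ A) +φ mult (∣ X ∣) A
    inside : ∀ {i} → i ∈ˢ X → dot f (pt i) ≡ c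
    inside {i} i∈ with Y , i∉Y , ≡.refl ← remove-insert {X = X} i∈ = begin
      dot (vsum pt (Y ⊕ i)) (pt i)                ≡⟨ cong (λ v → dot v (pt i)) (vsum-⊕ pt Y i i∉Y) ⟩
      dot (vsum pt Y ⊞ pt i) (pt i)               ≡⟨ dot-⊞ˡ (vsum pt Y) (pt i) (pt i) ⟩
      dot (vsum pt Y) (pt i) +φ dot (pt i) (pt i) ≡⟨ cong₂ _+φ_ (dot-vsum-≡ pt Y (pt i) A (clique-adjacent i∉Y clique)) (norm-pt i) ⟩
      mult (∣ Y ∣) A +φ R                           ≡⟨ lemma (mult (∣ Y ∣) A) R A ⟩
      (R -φ A) +φ (A +φ mult (∣ Y ∣) A)             ≡⟨ cong (λ k → (R -φ A) +φ mult k A) (∣insert∣ i∉Y) ⟨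
      (R -φ A) +φ mult (∣ Y ⊕ i ∣) A                ∎
      where
      open ≡.≡-Reasoning
      lemma : ∀ y r a → y +φ r ≡ (r -φ a) +φ (a +φ y)
      lemma y r a = ≡.trans (ring y r a) (cong (_+φ (a +φ y)) (≡.sym (-φ-neg r a)))
        where
        ring : ∀ y r a → y +φ r ≡ (r +φ neg a) +φ (a +φ y)
        ring = Solver.solve-∀ ring-φ
    near : ∀ {i} → i ∉ˢ X → Pos (mult (∣ X ∣) A -φ dot f (pt i))
    near {i} i∉ = dot-vsum-≤ pt X (pt i) A λ {j} j∈ →
      [ (λ eq → ⊥-elim (i∉ (subst (_∈ˢ X) (lookup-injective eq) j∈))) , id ]′ (below (pt∈ j) (pt∈ i))
    strictly : ∀ {i} → i ∉ˢ X → dot f (pt i) ≢ c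
    strictly {i} i∉ eq = A≢R (≡.sym (-φ-≡0 (Pos-antisym A<R
      (subst Pos (≡.trans (cong (mult (∣ X ∣) A -φ_) eq) (-φ-+φ (R -φ A) (mult (∣ X ∣) A))) (near i∉)))))
    bound : ∀ i → NonNegative (c -φ dot f (pt i))
    bound i with i Subsetₚ.∈? X
    ... | yes i∈ = Pos⇒NonNegative (subst Pos (≡.sym (≡.trans (cong (c -φ_) (inside i∈)) (-φ-self c))) Pos-0)
    ... | no  i∉ = Pos⇒NonNegative (subst Pos (≡.sym (+φ--φ (R -φ A) (mult (∣ X ∣) A) (dot f (pt i)))) (Pos-+ A<R (near i∉)))
    iff : ∀ i → (i ∈ˢ X) ⇔ (dot f (pt i) ≡ c)
    iff i = mk⇔ inside λ eq → decide eq (i Subsetₚ.∈? X)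
      where
      decide : dot f (pt i) ≡ c → Dec (i ∈ˢ X) → i ∈ˢ X
      decide eq (yes i∈) = i∈
      decide eq (no  i∉) = ⊥-elim (strictly i∉ eq)

module SphericalComplex {m : ℕ} (points : List (Vec ℤ[φ] (suc m))) (R A : ℤ[φ])
  (lookup-injective : ∀ {i j} → List.lookup points i ≡ List.lookup points j → i ≡ j)
  (norm : ∀ {x} → x ∈ points → dot x x ≡ R)
  (antipode : ∀ {x} → x ∈ points → -1φ ⊡ x ∈ points)
  (pair : ∀ {x y} → x ∈ points → y ∈ points → SphericalPoints.Pair points A x y)
  (links : SphericalPoints.Links points A m 0ᵛ (_∈ points))
  (A<R : Pos (R -φ A)) (A≢R : A ≢ R) (-R≢A : neg R ≢ A) (-R≢R : neg R ≢ R)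
  (reflected≢A : φ⁻¹ *φ mult m A -φ R ≢ A) (reflected≢R : φ⁻¹ *φ mult m A -φ R ≢ R)
  (vertex : Fin (List.length points))
  where
  open SphericalPoints points A
  open FaceComplex (convexHull points) using (IsFace)

  private
    N n : ℕ
    N = List.length points
    n = suc m

  open CliqueFaces points R A lookup-injective norm antipode (λ x∈ y∈ → Sum.map₂ pair⇒below (pair x∈ y∈))
    A<R A≢R -R≢A -R≢R vertex public

  face⇒clique : ∀ {X} → IsFace X → Clique X
  face⇒clique {X} (proper , f , c , bound , iff) {i} {j} i∈X j∈X i≢j
    with pair (pt∈ i) (pt∈ j)
  ... | inj₁ eq             = ⊥-elim (i≢j (lookup-injective eq))
  ... | inj₂ (inj₁ adj)     = adj
  ... | inj₂ (inj₂ distant) = ⊥-elim (exposed⇒c≢0 f c proper bound iff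
    (Far.separate distant f c bounded (Equivalence.to (iff i) i∈X) (Equivalence.to (iff j) j∈X)))
    where
    bounded : Bounded f c
    bounded z∈ with k , ≡.refl ← index z∈ = NonNegative⇒Pos (c -φ dot f (pt k)) (bound k)

  face-⊆ : ∀ {X Y} → IsFace Y → X ⊆ Y → IsFace X
  face-⊆ face X⊆Y = clique⇒face (clique-⊆ X⊆Y (face⇒clique face))

  -- What `Links` gives for a clique presented as a set rather than as vertices chosen one after
  -- another.
  record Completion (X : Subset N) (s : Vec ℤ[φ] n) (M : Vec ℤ[φ] n → Set) : Set where
    field
      t t′    : Vec ℤ[φ] n
      t∈      : M t
      t′∈     : M t′
      sum     : t ⊞ t′ ≡ φ⁻¹ ⊡ (s ⊞ vsum pt X)
      t-adj   : ∀ {i} → i ∈ˢ X → dot (pt i) t ≡ A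
      t′-adj  : ∀ {i} → i ∈ˢ X → dot (pt i) t′ ≡ A
      only    : ∀ {y} → M y → (∀ {i} → i ∈ˢ X → dot (pt i) y ≡ A) → y ≡ t ⊎ y ≡ t′

  complete : ∀ k X s M → Links k s M → ∣ X ∣ ≡ k → Clique X → (∀ {i} → i ∈ˢ X → M (pt i)) → Completion X s M
  complete zero X s M (t , t′ , t∈ , t′∈ , sum , only) card clique X⊆M = record
    { t = t ; t′ = t′ ; t∈ = t∈ ; t′∈ = t′∈ ; sum = ≡.trans sum (cong (φ⁻¹ ⊡_) s≡)
    ; t-adj = λ i∈ → ⊥-elim (empty i∈) ; t′-adj = λ i∈ → ⊥-elim (empty i∈) ; only = λ My _ → only My }
    where
    empty : ∀ {i} → i ∉ˢ X
    empty {i} i∈ with Y , i∉ , ≡.refl ← remove-insert {X = X} i∈ = ℕ.1+n≢0 (≡.trans (≡.sym (∣insert∣ i∉)) card)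
    s≡ : s ≡ s ⊞ vsum pt X
    s≡ = ≡.sym (≡.trans (cong (s ⊞_) (≡.trans (cong (vsum pt) (Subsetₚ.Empty-unique λ (_ , i∈) → empty i∈)) (vsum-⊥ pt)))
           (≡.trans (⊞-comm s 0ᵛ) (⊞-identityˡ s)))
  complete (suc k) X s M link card clique X⊆M
    with w , w∈ ← ∣X∣≡1+k⇒nonempty {X = X} card
    with Y , w∉ , ≡.refl ← remove-insert {X = X} w∈ = record
    { t = t ; t′ = t′ ; t∈ = proj₁ t∈ ; t′∈ = proj₁ t′∈
    ; sum = ≡.trans sum (cong (φ⁻¹ ⊡_) s≡)
    ; t-adj = extend (proj₂ t∈) t-adj ; t′-adj = extend (proj₂ t′∈) t′-adj
    ; only = λ My adj → only (My , adj (∈-insertʳ Y w)) (adj ∘ ∈-insertˡ w) }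
    where
    open Completion (complete k Y (s ⊞ pt w) (λ z → M z × dot (pt w) z ≡ A) (link (X⊆M (∈-insertʳ Y w)))
      (ℕ.suc-injective (≡.trans (≡.sym (∣insert∣ w∉)) card)) (clique-⊆ (∈-insertˡ w) clique)
      (λ i∈ → X⊆M (∈-insertˡ w i∈) , adjacent-sym (clique-adjacent w∉ clique i∈)))
    extend : ∀ {z} → dot (pt w) z ≡ A → (∀ {i} → i ∈ˢ Y → dot (pt i) z ≡ A) → ∀ {i} → i ∈ˢ Y ⊕ w → dot (pt i) z ≡ A
    extend p q i∈ = [ q , (λ { ≡.refl → p }) ]′ (∈-insert⁻ Y w i∈)
    s≡ : (s ⊞ pt w) ⊞ vsum pt Y ≡ s ⊞ vsum pt (Y ⊕ w)
    s≡ = ≡.trans (⊞-assoc s (pt w) _) (cong (s ⊞_) (≡.trans (⊞-comm (pt w) _) (≡.sym (vsum-⊕ pt Y w w∉))))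

  -- The value in `reflected` is the same for all ridges. As it is neither `R` nor `A`, the vertex
  -- beyond the ridge is distinct from `a` and not adjacent to it.
  record Ridge (X : Subset N) (a : Fin N) : Set where
    field
      reflect∈   : reflect (vsum pt X) (pt a) ∈ points
      reflectAdj : ∀ {i} → i ∈ˢ X → dot (pt i) (reflect (vsum pt X) (pt a)) ≡ A
      only       : ∀ b → (∀ {i} → i ∈ˢ X → Adjacent i b) → b ≡ a ⊎ pt b ≡ reflect (vsum pt X) (pt a)
      reflected  : dot (pt a) (reflect (vsum pt X) (pt a)) ≡ φ⁻¹ *φ mult m A -φ R

  ridge : ∀ X a → a ∉ˢ X → ∣ X ∣ ≡ m → Clique (X ⊕ a) → Ridge X a
  ridge X a a∉ card clique = result (only (pt∈ a) adj)
    where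
    adj : ∀ {i} → i ∈ˢ X → Adjacent i a
    adj = clique-adjacent a∉ clique
    open Completion (complete m X 0ᵛ (_∈ points) links card (clique-⊆ (∈-insertˡ a) clique) λ {i} _ → pt∈ i)
    reflect-t : reflect (vsum pt X) t ≡ t′
    reflect-t = ≡.trans (cong (_⊞ -1φ ⊡ t) (≡.sym (≡.trans sum (cong (φ⁻¹ ⊡_) (⊞-identityˡ _))))) (⊞-cancel t t′)
    reflect-t′ : reflect (vsum pt X) t′ ≡ t
    reflect-t′ = ≡.trans (cong (_⊞ -1φ ⊡ t′) (≡.trans (≡.sym (≡.trans sum (cong (φ⁻¹ ⊡_) (⊞-identityˡ _)))) (⊞-comm t t′)))
      (⊞-cancel t′ t)
    dot-reflect : dot (pt a) (reflect (vsum pt X) (pt a)) ≡ φ⁻¹ *φ mult m A -φ R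
    dot-reflect = begin
      dot (pt a) (φ⁻¹ ⊡ vsum pt X ⊞ -1φ ⊡ pt a)             ≡⟨ dot-⊞ʳ (pt a) _ _ ⟩
      dot (pt a) (φ⁻¹ ⊡ vsum pt X) +φ dot (pt a) (-1φ ⊡ pt a)
        ≡⟨ cong₂ _+φ_ (dot-⊡ʳ φ⁻¹ (pt a) _) (dot-antipode-self a) ⟩
      φ⁻¹ *φ dot (pt a) (vsum pt X) +φ neg R
        ≡⟨ cong (λ x → φ⁻¹ *φ x +φ neg R) (≡.trans (dot-comm (pt a) _)
             (≡.trans (dot-vsum-≡ pt X (pt a) A adj) (cong (λ k → mult k A) card))) ⟩
      φ⁻¹ *φ mult m A +φ neg R                               ≡⟨ -φ-neg (φ⁻¹ *φ mult m A) R ⟨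
      φ⁻¹ *φ mult m A -φ R                                   ∎
      where open ≡.≡-Reasoning
    result : pt a ≡ t ⊎ pt a ≡ t′ → Ridge X a
    result (inj₁ a≡t) = record
      { reflect∈   = subst (_∈ points) t′≡ t′∈
      ; reflectAdj = λ {i} i∈ → ≡.trans (cong (dot (pt i)) (≡.sym t′≡)) (t′-adj i∈)
      ; only       = λ b b-adj → [ (λ b≡t → inj₁ (lookup-injective (≡.trans b≡t (≡.sym a≡t))))
                                 , (λ b≡t′ → inj₂ (≡.trans b≡t′ t′≡)) ]′ (only (pt∈ b) b-adj)
      ; reflected  = dot-reflect }
      where
      t′≡ : t′ ≡ reflect (vsum pt X) (pt a)
      t′≡ = ≡.sym (≡.trans (cong (reflect (vsum pt X)) a≡t) reflect-t)
    result (inj₂ a≡t′) = record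
      { reflect∈   = subst (_∈ points) t≡ t∈
      ; reflectAdj = λ {i} i∈ → ≡.trans (cong (dot (pt i)) (≡.sym t≡)) (t-adj i∈)
      ; only       = λ b b-adj → [ (λ b≡t → inj₂ (≡.trans b≡t t≡))
                                 , (λ b≡t′ → inj₁ (lookup-injective (≡.trans b≡t′ (≡.sym a≡t′)))) ]′ (only (pt∈ b) b-adj)
      ; reflected  = dot-reflect }
      where
      t≡ : t ≡ reflect (vsum pt X) (pt a)
      t≡ = ≡.sym (≡.trans (cong (reflect (vsum pt X)) a≡t′) reflect-t′)

  -- A larger clique would contain a ridge `Y` together with two vertices `a` and `b` completing it.
  -- Then `b` is the reflection of `a`, yet adjacent to it, against the known product of the two.
  ∣face∣≤ : ∀ {X} → IsFace X → ∣ X ∣ ≤ n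
  ∣face∣≤ {X} face = ℕ.≮⇒≥ contradiction
    where
    clique : Clique X
    clique = face⇒clique face
    contradiction : ¬ (n < ∣ X ∣)
    contradiction n<
      with Y , Y⊆X , card ← subset-of-size m X (ℕ.≤-trans (ℕ.n≤1+n m) (ℕ.<⇒≤ n<))
      with _ , a , a∈X , a∉Y ← ⊆∧∣∣<⇒⊂ Y⊆X (ℕ.≤-trans (ℕ.≤-reflexive (cong suc card)) (ℕ.<⇒≤ n<))
      with _ , b , b∈X , b∉Ya ← ⊆∧∣∣<⇒⊂ (insert-⊆ Y⊆X a∈X)
             (ℕ.≤-trans (ℕ.≤-reflexive (cong suc (≡.trans (∣insert∣ a∉Y) (cong suc card)))) n<)
      with b∉Y , b≢a ← ∉-insert⁻ Y a b∉Ya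
      with Ridge.only (ridge Y a a∉Y card (clique-⊆ (insert-⊆ Y⊆X a∈X) clique)) b
             (λ {i} i∈ → clique (Y⊆X i∈) b∈X λ { ≡.refl → b∉Y i∈ })
    ... | inj₁ b≡a = b≢a b≡a
    ... | inj₂ b≡  = reflected≢A (≡.trans
      (≡.sym (Ridge.reflected (ridge Y a a∉Y card (clique-⊆ (insert-⊆ Y⊆X a∈X) clique))))
      (≡.trans (cong (dot (pt a)) (≡.sym b≡)) (clique a∈X b∈X (b≢a ∘ ≡.sym))))

  point? : (v : Vec ℤ[φ] n) → Dec (∃[ i ] pt i ≡ v)
  point? v = Fin.any? (λ i → pt i ≟ᵛ v)

  opposite : Subset N → Fin N → Fin N
  opposite X a with point? (reflect (vsum pt X) (pt a))
  ... | yes (i , _) = i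
  -- Never reached at a ridge, where the reflected vector is one of the points.
  ... | no  _       = a

  module _ (X : Subset N) (a : Fin N) (a∉ : a ∉ˢ X) (card : ∣ X ∣ ≡ m) (face : IsFace (X ⊕ a)) where
    private
      open module R = Ridge (ridge X a a∉ card (face⇒clique face))

    pt-opposite : pt (opposite X a) ≡ reflect (vsum pt X) (pt a)
    pt-opposite with point? (reflect (vsum pt X) (pt a))
    ... | yes (_ , eq) = eq
    ... | no  none     = ⊥-elim (none (index reflect∈))

    opposite-adjacent : ∀ {i} → i ∈ˢ X → Adjacent i (opposite X a)
    opposite-adjacent {i} i∈ = ≡.trans (cong (dot (pt i)) pt-opposite) (reflectAdj i∈)

    opposite∉ : opposite X a ∉ˢ X
    opposite∉ i∈ = ¬adjacent-refl (opposite-adjacent i∈)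

    opposite≢ : opposite X a ≢ a
    opposite≢ eq = reflected≢R (≡.trans (≡.sym reflected)
      (≡.trans (cong (dot (pt a)) (≡.trans (≡.sym pt-opposite) (cong pt eq))) (norm-pt a)))

    opposite-face : IsFace (X ⊕ opposite X a)
    opposite-face = clique⇒face (clique-⊕ (clique-⊆ (∈-insertˡ a) (face⇒clique face)) opposite-adjacent)

    opposite-unique : ∀ b → b ∉ˢ X → IsFace (X ⊕ b) → b ≢ a → b ≡ opposite X a
    opposite-unique b b∉ face′ b≢a with only b (clique-adjacent b∉ (face⇒clique face′))
    ... | inj₁ b≡a = ⊥-elim (b≢a b≡a)
    ... | inj₂ b≡  = lookup-injective (≡.trans b≡ (≡.sym pt-opposite))

  open SimplicialFlags (convexHull points) face-⊆ ∣face∣≤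
    opposite opposite∉ opposite≢ opposite-face opposite-unique public

  -- The link of `X` is a pentagon: at every step the two entries are consecutive terms of
  -- `reflections`, which has period 5.
  last-edge : ∀ X a b → a ∉ˢ X → b ∉ˢ X ⊕ a → suc ∣ X ∣ ≡ m → IsFace (X ⊕ a ⊕ b) →
    iterate (λ u → exchange X (suc zero) (exchange X zero u)) (a ∷ b ∷ []) 5 ≡ a ∷ b ∷ []
  last-edge X a b a∉ b∉ card face =
    cycle (track 5 (a ∷ b ∷ []) zero (a∉ , b∉ , face) (≡.refl , ≡.refl))
    where
    r : ℕ → Vec ℤ[φ] n
    r = reflections (vsum pt X) (pt a) (pt b)
    step : Vec (Fin N) 2 → Vec (Fin N) 2
    step u = exchange X (suc zero) (exchange X zero u)
    At : ℕ → Vec (Fin N) 2 → Set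
    At k (p ∷ q ∷ []) = pt p ≡ r k × pt q ≡ r (suc k)
    card₂ : ∣ X ∣ + 2 ≡ n
    card₂ = ≡.trans (ℕ.+-comm ∣ X ∣ 2) (cong suc card)
    step-at : ∀ k u → Valid X u → At k u → At (suc k) (step u)
    step-at k (p ∷ q ∷ []) (p∉ , q∉ , face) (p≡ , q≡) = q≡ , (begin
      pt (opposite (X ⊕ q) p)              ≡⟨ pt-opposite (X ⊕ q) p p∉Xq card-Xq face′ ⟩
      reflect (vsum pt (X ⊕ q)) (pt p)     ≡⟨ cong₂ reflect (≡.trans (vsum-⊕ pt X q q∉X) (cong (vsum pt X ⊞_) q≡)) p≡ ⟩
      r (suc (suc k))                      ∎)
      where
      open ≡.≡-Reasoning
      q∉X : q ∉ˢ X
      q∉X = proj₁ (∉-insert⁻ X p q∉)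
      p∉Xq : p ∉ˢ X ⊕ q
      p∉Xq = ∉-insert p∉ (proj₂ (∉-insert⁻ X p q∉) ∘ ≡.sym)
      card-Xq : ∣ X ⊕ q ∣ ≡ m
      card-Xq = ≡.trans (∣insert∣ q∉X) card
      face′ : IsFace (X ⊕ q ⊕ p)
      face′ = subst IsFace (insert-comm X p q) face
    track : ∀ k u j → Valid X u → At j u → At (j + k) (iterate step u k)
    track zero    u j valid at = subst (λ i → At i u) (≡.sym (ℕ.+-identityʳ j)) at
    track (suc k) u j valid at = subst (λ i → At i (iterate step (step u) k)) (≡.sym (ℕ.+-suc j k))
      (track k (step u) (suc j) (exchange-valid X (suc zero) (exchange X zero u) card₂ (exchange-valid X zero u card₂ valid))
        (step-at j u valid at))
    cycle : ∀ {u} → At 5 u → u ≡ a ∷ b ∷ []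
    cycle {p ∷ q ∷ []} (p≡ , q≡) = cong₂ (λ p q → p ∷ q ∷ [])
      (lookup-injective (≡.trans p≡ (reflections-5 (vsum pt X) (pt a) (pt b)))) (lookup-injective (≡.trans q≡ (reflections-6 (vsum pt X) (pt a) (pt b))))

  module _ (x : Vec ℤ[φ] n) where

    dots : ∀ {l} → Vec (Fin N) l → Vec ℤ[φ] l
    dots = Vec.map (λ i → dot x (pt i))

    dot-insertAll : ∀ {l} X (v : Vec (Fin N) l) → Valid X v →
      dot x (vsum pt (insertAll X v)) ≡ dot x (vsum pt X) +φ sumφ (dots v)
    dot-insertAll X []      _            = ≡.sym (+φ-identityʳ (dot x (vsum pt X)))
    dot-insertAll X (a ∷ v) (a∉ , valid) = ≡.trans (dot-insertAll (X ⊕ a) v valid)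
      (≡.trans (cong (_+φ sumφ (dots v)) (≡.trans (cong (dot x) (vsum-⊕ pt X a a∉)) (dot-⊞ʳ x (vsum pt X) (pt a))))
               (+φ-assoc (dot x (vsum pt X)) (dot x (pt a)) (sumφ (dots v))))

    dots-rotation : ∀ v → Valid {n} ⊥ v → dots (rotation ⊥ v) ≡ rotateDots (dots v)
    dots-rotation (a ∷ v) valid = ≡.trans (Vecₚ.map-∷ʳ (λ i → dot x (pt i)) _ v) (cong (dots v ∷ʳ_) (begin
        dot x (pt (opposite Y a))                            ≡⟨ cong (dot x) (pt-opposite Y a a∉ card face) ⟩
        dot x (φ⁻¹ ⊡ vsum pt Y ⊞ -1φ ⊡ pt a)                 ≡⟨ dot-⊞ʳ x (φ⁻¹ ⊡ vsum pt Y) (-1φ ⊡ pt a) ⟩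
        dot x (φ⁻¹ ⊡ vsum pt Y) +φ dot x (-1φ ⊡ pt a)        ≡⟨ cong₂ _+φ_ (dot-⊡ʳ φ⁻¹ x (vsum pt Y)) (dot-antipode x (pt a)) ⟩
        φ⁻¹ *φ dot x (vsum pt Y) +φ neg (dot x (pt a))       ≡⟨ cong (λ s → φ⁻¹ *φ s +φ neg (dot x (pt a))) sum≡ ⟩
        φ⁻¹ *φ sumφ (dots v) +φ neg (dot x (pt a))           ∎))
      where
      open ≡.≡-Reasoning
      Y = insertAll ⊥ v
      a∉ : a ∉ˢ Y
      a∉ = proj₁ (tail-ridge a v valid)
      card : ∣ Y ∣ ≡ m
      card = proj₁ (proj₂ (tail-ridge a v valid))
      face : IsFace (Y ⊕ a)
      face = proj₂ (proj₂ (tail-ridge a v valid))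
      tail-valid : ∀ {l} X Z (v : Vec (Fin N) l) → X ⊆ Z → Valid Z v → Valid X v
      tail-valid X Z []      X⊆Z face         = face-⊆ face X⊆Z
      tail-valid X Z (a ∷ v) X⊆Z (a∉ , valid) = a∉ ∘ X⊆Z ,
        tail-valid (X ⊕ a) (Z ⊕ a) v (insert-⊆ (∈-insertˡ a ∘ X⊆Z) (∈-insertʳ Z a)) valid
      sum≡ : dot x (vsum pt Y) ≡ sumφ (dots v)
      sum≡ = ≡.trans (dot-insertAll ⊥ v (tail-valid ⊥ (⊥ ⊕ a) v (⊥-elim ∘ Subsetₚ.∉⊥) (proj₂ valid)))
        (≡.trans (cong (_+φ sumφ (dots v)) (≡.trans (cong (dot x) (vsum-⊥ pt)) (dot-0ʳ x))) (+φ-identityˡ (sumφ (dots v))))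

    dots-iterate : ∀ k v → Valid {n} ⊥ v → dots (iterate (rotation ⊥) v k) ≡ iterate rotateDots (dots v) k
    dots-iterate zero    v valid = ≡.refl
    dots-iterate (suc k) v valid = ≡.trans (dots-iterate k (rotation ⊥ v) (rotation-valid v valid))
      (cong (λ D → iterate rotateDots D k) (dots-rotation v valid))

  dots-valid : ∀ a v → Valid ⊥ (a ∷ v) → dots (pt a) (a ∷ v) ≡ initialDots m R A
  dots-valid a v valid = cong₂ _∷_ (norm-pt a) (all-A v λ i →
    face⇒clique (insertAll-face ⊥ (a ∷ v) valid) (lookup∈insertAll ⊥ (a ∷ v) zero) (lookup∈insertAll ⊥ (a ∷ v) (suc i))
      (lookup≢head ⊥ a v valid i ∘ ≡.sym))
    where
    all-A : ∀ {l} (v : Vec (Fin N) l) → (∀ i → Adjacent a (lookup v i)) → dots (pt a) v ≡ Vec.replicate l A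
    all-A []      _ = ≡.refl
    all-A (b ∷ v) p = cong₂ _∷_ (p zero) (all-A v (p ∘ suc))

  -- All flags have the same products with their first vertex, so one finite computation serves for
  -- every flag. A flag that returns would bring the product back to `R`.
  aperiodic : ∀ h → (∀ k → 0 < k → k < h → head (iterate rotateDots (initialDots m R A) k) ≢ R) →
    ∀ v → Valid {n} ⊥ v → ∀ k → 0 < k → k < h → iterate (rotation ⊥) v k ≢ v
  aperiodic h apart v@(a ∷ w) valid k 0<k k<h eq = apart k 0<k k<h (cong head (begin
    iterate rotateDots (initialDots m R A) k          ≡⟨ cong (λ D → iterate rotateDots D k) (dots-valid a w valid) ⟨
    iterate rotateDots (dots (pt a) v) k      ≡⟨ dots-iterate (pt a) k v valid ⟨
    dots (pt a) (iterate (rotation ⊥) v k)    ≡⟨ cong (dots (pt a)) eq ⟩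
    dots (pt a) v                             ≡⟨ dots-valid a w valid ⟩
    initialDots m R A                               ∎))
    where open ≡.≡-Reasoning

  pairwise-adjacent⇒valid : ∀ {l} (v : Vec (Fin N) l) X → Clique X → (∀ {i} → i ∈ˢ X → ∀ j → Adjacent i (lookup v j)) →
    (∀ i j → i <ᶠ j → Adjacent (lookup v i) (lookup v j)) → Valid X v
  pairwise-adjacent⇒valid []      X clique _   _        = clique⇒face clique
  pairwise-adjacent⇒valid (a ∷ v) X clique adj pairwise =
      (λ a∈ → ¬adjacent-refl (adj a∈ zero))
    , pairwise-adjacent⇒valid v (X ⊕ a) (clique-⊕ clique λ i∈ → adj i∈ zero)
        (λ i∈ j → [ (λ i∈X → adj i∈X (suc j)) , (λ { ≡.refl → pairwise zero (suc j) z<s }) ]′ (∈-insert⁻ X a i∈))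
        (λ i j i<j → pairwise (suc i) (suc j) (s≤s i<j))

  sphericalLengths : (label : ℕ → ℕ) →
    (∀ k → suc (suc k) ≢ n → label k ≡ 3) → (∀ k → suc (suc k) ≡ n → label k ≡ 5) →
    (h : ℕ) → 0 < h → TrivialPower label n h →
    (∀ k → 0 < k → k < h → head (iterate rotateDots (initialDots m R A) k) ≢ R) →
    (v : Vec (Fin N) n) → (∀ i j → i <ᶠ j → Adjacent (lookup v i) (lookup v j)) →
    IsCoxeterNumber (pathMatrix label n) h × ZigzagsHaveLength (convexHull points) h
  sphericalLengths label label3 label5 h 0<h power apart v pairwise = simplicialLengths label 5 label3 label5 last-edge
    h 0<h power (v , pairwise-adjacent⇒valid v ⊥ (λ i∈ → ⊥-elim (Subsetₚ.∉⊥ i∈)) (λ i∈ → ⊥-elim (Subsetₚ.∉⊥ i∈)) pairwise)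
    (aperiodic h apart)

-- Verification by computation, and its transport by symmetries

Unique⇒lookup-injective : ∀ {a} {A : Set a} {l : List A} → Unique l →
  ∀ {i j} → List.lookup l i ≡ List.lookup l j → i ≡ j
Unique⇒lookup-injective {l = x ∷ l} (p ∷ q) {zero}  {zero}  eq = ≡.refl
Unique⇒lookup-injective {l = x ∷ l} (p ∷ q) {zero}  {suc j} eq = ⊥-elim (All.lookup p (∈ₗ.∈-lookup j) eq)
Unique⇒lookup-injective {l = x ∷ l} (p ∷ q) {suc i} {zero}  eq = ⊥-elim (All.lookup p (∈ₗ.∈-lookup i) (≡.sym eq))
Unique⇒lookup-injective {l = x ∷ l} (p ∷ q) {suc i} {suc j} eq = cong suc (Unique⇒lookup-injective q eq)

sumᵛ : ∀ {d} → List (Vec ℤ[φ] d) → Vec ℤ[φ] d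
sumᵛ = foldr _⊞_ 0ᵛ

-- The smallest excess of a + b over the number of summands among the certificates below is 2φ - 3 =
-- φ⁻³, so multiplication by φ⁸ lifts every excess above 1.
φ⁸ : ℤ[φ]
φ⁸ = (+ 13) ⊹ (+ 21) φ

natφ : ℕ → ℤ[φ]
natφ k = (+ k) ⊹ (+ 0) φ

-- Σ ms = ax + by with a + b greater than the length of ms shows that the segment from x to y is
-- not in the boundary of the hull; the factor φ⁸ turns the strict inequality into one with room.
record Certificate : Set where
  constructor certificate
  field
    product threshold a b : ℤ[φ]

module PointChecks {d} (points : List (Vec ℤ[φ] d)) (R A : ℤ[φ]) (certificates : List Certificate) where
  open SphericalPoints points A
  open DecMembership (_≟ᵛ_ {d}) using (_∈?_)

  neighbours : Vec ℤ[φ] d → List (Vec ℤ[φ] d) → List (Vec ℤ[φ] d)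
  neighbours w = filter (λ z → dot w z ≟φ A)

  Certified : List (Vec ℤ[φ] d) → Vec ℤ[φ] d → Vec ℤ[φ] d → Certificate → Set
  Certified ms x y (certificate _ _ a b) =
    sumᵛ ms ≡ a ⊡ x ⊞ b ⊡ y × NonNegative (φ⁸ *φ ((a +φ b) -φ natφ (length ms)) -φ 1φ)

  towards : List (Vec ℤ[φ] d) → Vec ℤ[φ] d → Certificate → List (Vec ℤ[φ] d)
  towards nb y cert = filter (λ w → dot w y ≟φ Certificate.threshold cert) nb

  FarCheck : List (Vec ℤ[φ] d) → Vec ℤ[φ] d → Vec ℤ[φ] d → ℤ[φ] → Set
  FarCheck nb x y xy = NonNegative (A -φ xy) × xy ≢ A ×
    Any (λ cert → xy ≡ Certificate.product cert × Certified (towards nb y cert) x y cert) certificates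

  PairCheck : List (Vec ℤ[φ] d) → Vec ℤ[φ] d → Vec ℤ[φ] d → ℤ[φ] → Set
  PairCheck nb x y xy = x ≡ y ⊎ xy ≡ A ⊎ FarCheck nb x y xy

  farCheck? : ∀ nb x y xy → Dec (FarCheck nb x y xy)
  farCheck? nb x y xy = nonNegative? (A -φ xy) ×-dec ¬? (xy ≟φ A) ×-dec
    Any.any? (λ cert → xy ≟φ Certificate.product cert ×-dec certified? (towards nb y cert) cert) certificates
    where
    certified? : ∀ ms cert → Dec (Certified ms x y cert)
    certified? ms (certificate _ _ a b) = sumᵛ ms ≟ᵛ (a ⊡ x ⊞ b ⊡ y) ×-dec
      nonNegative? (φ⁸ *φ ((a +φ b) -φ natφ (length ms)) -φ 1φ)

  pairCheck? : ∀ nb x y xy → Dec (PairCheck nb x y xy)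
  pairCheck? nb x y xy = x ≟ᵛ y ⊎-dec xy ≟φ A ⊎-dec farCheck? nb x y xy

  LinksCheck : ℕ → Vec ℤ[φ] d → List (Vec ℤ[φ] d) → Set
  LinksCheck zero    s (t ∷ t′ ∷ []) = t ⊞ t′ ≡ φ⁻¹ ⊡ s
  LinksCheck zero    s _             = Data.Empty.⊥
  LinksCheck (suc k) s L             = All (λ w → LinksCheck k (s ⊞ w) (neighbours w L)) L

  linksCheck? : ∀ k s L → Dec (LinksCheck k s L)
  linksCheck? zero    s []              = no λ ()
  linksCheck? zero    s (t ∷ [])        = no λ ()
  linksCheck? zero    s (t ∷ t′ ∷ [])   = (t ⊞ t′) ≟ᵛ (φ⁻¹ ⊡ s)
  linksCheck? zero    s (_ ∷ _ ∷ _ ∷ _) = no λ ()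
  linksCheck? (suc k) s L               = All.all? (λ w → linksCheck? k (s ⊞ w) (neighbours w L)) L

  linksCheck⇒Links : ∀ k s L {M : Vec ℤ[φ] d → Set} → (∀ {z} → M z → z ∈ L) → (∀ {z} → z ∈ L → M z) →
    LinksCheck k s L → Links k s M
  linksCheck⇒Links zero s (t ∷ t′ ∷ []) M⇒∈ ∈⇒M eq =
    t , t′ , ∈⇒M (here ≡.refl) , ∈⇒M (there (here ≡.refl)) , eq , λ My → split (M⇒∈ My)
    where
    split : ∀ {y} → y ∈ t ∷ t′ ∷ [] → y ≡ t ⊎ y ≡ t′
    split (here eq)         = inj₁ eq
    split (there (here eq)) = inj₂ eq
  linksCheck⇒Links (suc k) s L M⇒∈ ∈⇒M checks {w} Mw = linksCheck⇒Links k (s ⊞ w) (neighbours w L)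
    (λ (Mz , adj) → ∈ₗ.∈-filter⁺ (λ z → dot w z ≟φ A) (M⇒∈ Mz) adj)
    (λ z∈ → let z∈L , adj = ∈ₗ.∈-filter⁻ (λ z → dot w z ≟φ A) {xs = L} z∈ in ∈⇒M z∈L , adj)
    (All.lookup checks (M⇒∈ Mw))

  dot-sumᵛ : ∀ (f : Vec ℤ[φ] d) c ms → (∀ {z} → z ∈ ms → Pos (c -φ dot f z)) → Pos (natφ (length ms) *φ c -φ dot f (sumᵛ ms))
  dot-sumᵛ f c []       le = subst Pos (≡.sym (≡.trans (cong (0φ *φ c -φ_) (dot-0ʳ f)) (zero* c))) Pos-0
    where
    zero* : ∀ c → 0φ *φ c -φ 0φ ≡ 0φ
    zero* c = ≡.trans (-φ-neg (0φ *φ c) 0φ) (lemma c)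
      where
      lemma : ∀ c → 0φ *φ c +φ neg 0φ ≡ 0φ
      lemma = Solver.solve-∀ ring-φ
  dot-sumᵛ f c (z ∷ ms) le = subst Pos
    (≡.trans (-φ-interchange c (dot f z) (natφ (length ms) *φ c) (dot f (sumᵛ ms)))
             (cong₂ _-φ_ (suc* (natφ (length ms)) c) (≡.sym (dot-⊞ʳ f z (sumᵛ ms)))))
    (Pos-+ (le (here ≡.refl)) (dot-sumᵛ f c ms (le ∘ there)))
    where
    suc* : ∀ k c → c +φ k *φ c ≡ (1φ +φ k) *φ c
    suc* = Solver.solve-∀ ring-φ

  -- Evaluating the functional at the certified sum gives (a + b)c, and also at most `c` for each
  -- summand. As a + b exceeds the number of summands, c ≤ 0. The antipode of `x` has value -c ≤ c,
  -- so c ≥ 0.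
  certified⇒separate : ∀ ms x y cert → (∀ {z} → z ∈ ms → z ∈ points) → -1φ ⊡ x ∈ points → Certified ms x y cert →
    ∀ f c → Bounded f c → dot f x ≡ c → dot f y ≡ c → c ≡ 0φ
  certified⇒separate ms x y (certificate _ _ a b) ms⊆ −x∈ (sum , strict) f c bounded fx≡ fy≡ =
    halve (Pos-antisym 2c≥0 (subst Pos combine
      (Pos-+ (Pos-* (NonNegative⇒Pos (φ⁸ *φ δ -φ 1φ) strict) 2c≥0) (Pos-* (Nat⇒Pos 13 21) (Pos-+ slack≥0 slack≥0)))))
    where
    k = natφ (length ms)
    δ = (a +φ b) -φ k
    halve : ∀ {c} → c +φ c ≡ 0φ → c ≡ 0φ
    halve {p ⊹ q φ} eq = cong₂ _⊹_φ (double p (cong ℤ[φ].int eq)) (double q (cong ℤ[φ].coef eq))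
      where
      double : ∀ p → p ℤ.+ p ≡ + 0 → p ≡ + 0
      double (+ zero) _ = ≡.refl
    2c≥0 : Pos (c +φ c)
    2c≥0 = subst Pos (≡.trans (-φ-neg c (dot f (-1φ ⊡ x))) (cong (c +φ_) (≡.trans (cong neg
      (≡.trans (dot-⊡ʳ -1φ f x) (≡.trans (-1φ-* (dot f x)) (cong neg fx≡)))) (neg-involutive c)))) (bounded −x∈)
    slack≥0 : Pos (k *φ c +φ neg ((a +φ b) *φ c))
    slack≥0 = subst Pos (≡.trans (-φ-neg (k *φ c) (dot f (sumᵛ ms))) (cong (λ s → k *φ c +φ neg s) (begin
      dot f (sumᵛ ms)                   ≡⟨ cong (dot f) sum ⟩
      dot f (a ⊡ x ⊞ b ⊡ y)             ≡⟨ dot-⊞ʳ f (a ⊡ x) (b ⊡ y) ⟩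
      dot f (a ⊡ x) +φ dot f (b ⊡ y)    ≡⟨ cong₂ _+φ_ (dot-⊡ʳ a f x) (dot-⊡ʳ b f y) ⟩
      a *φ dot f x +φ b *φ dot f y      ≡⟨ cong₂ (λ u v → a *φ u +φ b *φ v) fx≡ fy≡ ⟩
      a *φ c +φ b *φ c                  ≡⟨ *φ-distribʳ c a b ⟨
      (a +φ b) *φ c                     ∎))) (dot-sumᵛ f c ms (bounded ∘ ms⊆))
      where open ≡.≡-Reasoning
    -- Twice the slack is -2δc. Multiplied by φ⁸ it cancels the leading part of the first summand,
    -- leaving -2c as a sum of nonnegative terms without any division by δ.
    combine : (φ⁸ *φ δ -φ 1φ) *φ (c +φ c) +φ φ⁸ *φ ((k *φ c +φ neg ((a +φ b) *φ c)) +φ (k *φ c +φ neg ((a +φ b) *φ c)))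
              ≡ neg (c +φ c)
    combine = ≡.trans (cong (λ e → e *φ (c +φ c) +φ φ⁸ *φ ((k *φ c +φ neg ((a +φ b) *φ c)) +φ (k *φ c +φ neg ((a +φ b) *φ c))))
                (≡.trans (-φ-neg (φ⁸ *φ δ) 1φ) (cong (λ e → φ⁸ *φ e +φ neg 1φ) (-φ-neg (a +φ b) k))))
              (ring φ⁸ (a +φ b) k c)
      where
      ring : ∀ e s k c → (e *φ (s +φ neg k) +φ neg 1φ) *φ (c +φ c) +φ
        e *φ ((k *φ c +φ neg (s *φ c)) +φ (k *φ c +φ neg (s *φ c))) ≡ neg (c +φ c)
      ring = Solver.solve-∀ ring-φ

  farCheck⇒Far : ∀ {x y} → -1φ ⊡ x ∈ points → FarCheck (neighbours x points) x y (dot x y) → Far x y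
  farCheck⇒Far {x} {y} −x∈ (below , apart , certified) = let cert , _ , holds = Any.satisfied certified in record
    { below    = NonNegative⇒Pos (A -φ dot x y) below
    ; apart    = apart
    ; separate = certified⇒separate (towards (neighbours x points) y cert) x y cert
        (λ z∈ → proj₁ (∈ₗ.∈-filter⁻ (λ z → dot x z ≟φ A) {xs = points}
          (proj₁ (∈ₗ.∈-filter⁻ (λ w → dot w y ≟φ Certificate.threshold cert) {xs = neighbours x points} z∈))))
        −x∈ holds
    }

  record Regular (k : ℕ) (x : Vec ℤ[φ] d) : Set where
    field
      norm     : dot x x ≡ R
      antipode : -1φ ⊡ x ∈ points
      pairs    : ∀ {y} → y ∈ points → Pair x y
      links    : Links k x (λ z → z ∈ points × dot x z ≡ A)

  RegularCheck : ℕ → Vec ℤ[φ] d → List (Vec ℤ[φ] d) → Set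
  RegularCheck k x nb = dot x x ≡ R × -1φ ⊡ x ∈ points × All (λ y → PairCheck nb x y (dot x y)) points × LinksCheck k x nb

  regularCheck? : ∀ k x → Dec (RegularCheck k x (neighbours x points))
  regularCheck? k x = go (neighbours x points)
    where
    go : ∀ nb → Dec (RegularCheck k x nb)
    go nb = dot x x ≟φ R ×-dec (-1φ ⊡ x) ∈? points ×-dec
      All.all? (λ y → pairCheck? nb x y (dot x y)) points ×-dec linksCheck? k x nb

  regularCheck⇒Regular : ∀ {k x} → RegularCheck k x (neighbours x points) → Regular k x
  regularCheck⇒Regular {k} {x} (norm , antipode , pairs , links) = record
    { norm     = norm
    ; antipode = antipode
    ; pairs    = λ y∈ → pair (All.lookup pairs y∈)
    ; links    = linksCheck⇒Links k x (neighbours x points) (λ (z∈ , adj) → ∈ₗ.∈-filter⁺ adjacent? z∈ adj)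
                   (∈ₗ.∈-filter⁻ adjacent? {xs = points}) links
    }
    where
    adjacent? : ∀ z → Dec (dot x z ≡ A)
    adjacent? z = dot x z ≟φ A
    pair : ∀ {y} → PairCheck (neighbours x points) x y (dot x y) → Pair x y
    pair (inj₁ eq)         = inj₁ eq
    pair (inj₂ (inj₁ adj)) = inj₂ (inj₁ adj)
    pair {y} (inj₂ (inj₂ check)) = inj₂ (inj₂ (farCheck⇒Far antipode check))

  -- Restricted to involutions, which are both their own inverse and their own adjoint: every
  -- condition on `g x` can then be pulled back to `x` by `g` itself. Regularity needs to be
  -- computed at one vertex only for each orbit of such maps.
  record Symmetry (g : Vec ℤ[φ] d → Vec ℤ[φ] d) : Set where
    field
      involutive : ∀ v → g (g v) ≡ v
      isometric  : ∀ u v → dot (g u) (g v) ≡ dot u v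
      additive   : ∀ u v → g (u ⊞ v) ≡ g u ⊞ g v
      homogeneous : ∀ k v → g (k ⊡ v) ≡ k ⊡ g v
      stable     : ∀ {z} → z ∈ points → g z ∈ points

    adjoint : ∀ u v → dot (g u) v ≡ dot u (g v)
    adjoint u v = ≡.trans (≡.sym (isometric (g u) v)) (cong (λ u → dot u (g v)) (involutive u))

    links-image : ∀ k {s} {M M′ : Vec ℤ[φ] d → Set} → (∀ {z} → M z → M′ (g z)) → (∀ {z} → M′ z → M (g z)) →
      Links k s M → Links k (g s) M′
    links-image zero {s} {M} {M′} to from (t , t′ , Mt , Mt′ , sum , only) =
        g t , g t′ , to Mt , to Mt′
      , ≡.trans (≡.sym (additive t t′)) (≡.trans (cong g sum) (homogeneous φ⁻¹ s))
      , λ {y} M′y → Sum.map (λ eq → ≡.trans (≡.sym (involutive y)) (cong g eq))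
                            (λ eq → ≡.trans (≡.sym (involutive y)) (cong g eq)) (only (from M′y))
    links-image (suc k) {s} {M} {M′} to from links {w} M′w =
      subst (λ s → Links k s (λ z → M′ z × dot w z ≡ A))
        (≡.trans (additive s (g w)) (cong (g s ⊞_) (involutive w)))
        (links-image k
          (λ {z} (Mz , adj) → to Mz , ≡.trans (≡.sym (adjoint w z)) adj)
          (λ {z} (M′z , adj) → from M′z , ≡.trans (isometric w z) adj)
          (links (from M′w)))

    pair-image : ∀ {x y} → Pair x (g y) → Pair (g x) y
    pair-image {x} {y} (inj₁ eq)         = inj₁ (≡.trans (cong g eq) (involutive y))
    pair-image {x} {y} (inj₂ (inj₁ adj)) = inj₂ (inj₁ (≡.trans (adjoint x y) adj))
    pair-image {x} {y} (inj₂ (inj₂ distant)) = inj₂ (inj₂ (record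
      { below    = subst (λ xy → Pos (A -φ xy)) (≡.sym (adjoint x y)) (Far.below distant)
      ; apart    = λ adj → Far.apart distant (≡.trans (≡.sym (adjoint x y)) adj)
      ; separate = λ f c bounded fx fy → Far.separate distant (g f) c
          (λ {z} z∈ → subst (λ v → Pos (c -φ v)) (≡.sym (adjoint f z)) (bounded (stable z∈)))
          (≡.trans (adjoint f x) fx) (≡.trans (isometric f y) fy)
      }))

    regular-image : ∀ {k x} → Regular k x → Regular k (g x)
    regular-image {k} {x} regular = record
      { norm     = ≡.trans (isometric x x) norm
      ; antipode = subst (_∈ points) (homogeneous -1φ x) (stable antipode)
      ; pairs    = λ y∈ → pair-image (pairs (stable y∈))
      ; links    = links-image k
          (λ {z} (z∈ , adj) → stable z∈ , ≡.trans (isometric x z) adj)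
          (λ {z} (z∈ , adj) → stable z∈ , ≡.trans (≡.sym (adjoint x z)) adj) links
      }
      where open Regular regular

  all-regular⇒links : ∀ {k} → (∀ {x} → x ∈ points → Regular k x) → Links (suc k) 0ᵛ (_∈ points)
  all-regular⇒links {k} regular {w} w∈ =
    subst (λ s → Links k s (λ z → z ∈ points × dot w z ≡ A)) (≡.sym (⊞-identityˡ w)) (Regular.links (regular w∈))

-- The icosahedron and the 600-cell

module IcosahedronZigzags where
  private
    -- The squared circumradius 1 + φ² and the product of two adjacent vertices.
    R A : ℤ[φ]
    R = (+ 2) ⊹ (+ 1) φ
    A = φ

  -- For each remaining product of `x` and `y`, the neighbours of `x` with the given product with
  -- `y` have their sum in the span of `x` and `y`, which determines `a` and `b`. For y = -x only
  -- the difference a - b is determined; the five neighbours of `x` sum to (2φ - 1)x, and a common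
  -- amount is added to both coefficients to make a + b exceed 5.
  certificates : List Certificate
  certificates =
      certificate ((+ 0) ⊹ -[1+ 0 ] φ)    ((+ 0) ⊹ (+ 1) φ)    ((+ 0) ⊹ (+ 1) φ)    ((+ 0) ⊹ (+ 1) φ)
    ∷ certificate (-[1+ 1 ] ⊹ -[1+ 0 ] φ) ((+ 0) ⊹ -[1+ 0 ] φ) (-[1+ 0 ] ⊹ (+ 3) φ) ((+ 0) ⊹ (+ 1) φ)
    ∷ []

  open PointChecks icosahedronVertices R A certificates

  regular : ∀ {x} → x ∈ icosahedronVertices → Regular 1 x
  regular x∈ = regularCheck⇒Regular (All.lookup (toWitness {a? = All.all? (regularCheck? 1) icosahedronVertices} _) x∈)

  vertices-distinct : Unique icosahedronVertices
  vertices-distinct = toWitness {a? = DecUnique.unique? _≟ᵛ_ icosahedronVertices} _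

  open SphericalComplex icosahedronVertices R A
    (Unique⇒lookup-injective vertices-distinct) (Regular.norm ∘ regular) (Regular.antipode ∘ regular)
    (λ x∈ → Regular.pairs (regular x∈)) (all-regular⇒links regular)
    (NonNegative⇒Pos (R -φ A) (toWitness {a? = nonNegative? (R -φ A)} _))
    (λ ()) (λ ()) (λ ()) (λ ()) (λ ()) zero

  zigzags : IsCoxeterNumber H₃-matrix 10 × ZigzagsHaveLength icosahedron 10
  zigzags = sphericalLengths (λ k → if k ≡ᵇ 1 then 5 else 3)
    (λ { zero _ → ≡.refl ; (suc zero) ne → ⊥-elim (ne ≡.refl) ; (suc (suc _)) _ → ≡.refl })
    (λ { (suc zero) _ → ≡.refl }) 10 z<s H₃-power
    (λ { (suc k) _ (s≤s k<9) → toWitness {a? = ℕ.allUpTo? (λ k → ¬? (head (iterate rotateDots (initialDots 2 R A) (suc k)) ≟φ R)) 9} _ k<9 })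
    flag (λ i j → toWitness {a? = Fin.all? λ i → Fin.all? λ j → i Fin.<? j →-dec
      dot (pt (lookup flag i)) (pt (lookup flag j)) ≟φ A} _ i j)
    where
    flag : Vec (Fin (length icosahedronVertices)) 3
    -- The three cyclic permutations of (0, 1, φ).
    flag = # 0 ∷ # 1 ∷ # 2 ∷ []

-- Up to the sign changes and double transpositions of coordinates there are five vertices.
module 600-cellZigzags where
  private
    -- Adjacent vertices span an angle of 36°, whose cosine is φ/2, and the circumradius is 2.
    R A : ℤ[φ]
    R = (+ 4) ⊹ (+ 0) φ
    A = (+ 0) ⊹ (+ 2) φ

  -- One entry for each angle 90°, 180°, 60°, 120°, 72°, 108°, 144° between `x` and `y`, in this
  -- order. The numbers of summands are 2, 12, 3, 3, 1, 1, 1. For the antipode the twelve neighbours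
  -- sum to 6φx, written as 7φx + φy so that the coefficients add up to 8φ > 12.
  certificates : List Certificate
  certificates =
      certificate ((+ 0) ⊹ (+ 0) φ) ((+ 2) ⊹ (+ 0) φ) ((+ 0) ⊹ (+ 1) φ) ((+ 1) ⊹ (+ 0) φ)
    ∷ certificate (-[1+ 3 ] ⊹ (+ 0) φ) ((+ 0) ⊹ -[1+ 1 ] φ) ((+ 0) ⊹ (+ 7) φ) ((+ 0) ⊹ (+ 1) φ)
    ∷ certificate ((+ 2) ⊹ (+ 0) φ) ((+ 0) ⊹ (+ 2) φ) ((+ 0) ⊹ (+ 1) φ) ((+ 0) ⊹ (+ 1) φ)
    ∷ certificate (-[1+ 1 ] ⊹ (+ 0) φ) ((+ 0) ⊹ (+ 0) φ) ((+ 0) ⊹ (+ 2) φ) ((+ 0) ⊹ (+ 1) φ)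
    ∷ certificate (-[1+ 1 ] ⊹ (+ 2) φ) ((+ 0) ⊹ (+ 2) φ) (-[1+ 0 ] ⊹ (+ 1) φ) (-[1+ 0 ] ⊹ (+ 1) φ)
    ∷ certificate ((+ 2) ⊹ -[1+ 1 ] φ) (-[1+ 1 ] ⊹ (+ 2) φ) ((+ 1) ⊹ (+ 0) φ) (-[1+ 0 ] ⊹ (+ 1) φ)
    ∷ certificate ((+ 0) ⊹ -[1+ 1 ] φ) ((+ 2) ⊹ -[1+ 1 ] φ) ((+ 0) ⊹ (+ 1) φ) ((+ 1) ⊹ (+ 0) φ)
    ∷ []

  open PointChecks 600-cellVertices R A certificates
  open DecMembership (_≟ᵛ_ {4}) using (_∈?_)

  flip swap₁ swap₂ : Vec ℤ[φ] 4 → Vec ℤ[φ] 4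
  flip  (a ∷ b ∷ c ∷ d ∷ []) = -1φ *φ a ∷ b ∷ c ∷ d ∷ []
  swap₁ (a ∷ b ∷ c ∷ d ∷ []) = b ∷ a ∷ d ∷ c ∷ []
  swap₂ (a ∷ b ∷ c ∷ d ∷ []) = c ∷ d ∷ a ∷ b ∷ []

  private
    all-∈? : ∀ (K L : List (Vec ℤ[φ] 4)) → Dec (All (_∈ L) K)
    all-∈? K L = All.all? (_∈? L) K

    stable-by-check : ∀ (g : Vec ℤ[φ] 4 → Vec ℤ[φ] 4) → All (_∈ 600-cellVertices) (map g 600-cellVertices) →
      ∀ {z} → z ∈ 600-cellVertices → g z ∈ 600-cellVertices
    stable-by-check g all z∈ = All.lookup all (∈ₗ.∈-map⁺ g z∈)

  flip-symmetry : Symmetry flip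
  flip-symmetry = record
    { involutive  = λ { (a ∷ b ∷ c ∷ d ∷ []) → cong (_∷ b ∷ c ∷ d ∷ []) (twice a) }
    ; isometric   = λ { (a ∷ b ∷ c ∷ d ∷ []) (a′ ∷ b′ ∷ c′ ∷ d′ ∷ []) → cong (_+φ _) (signs a a′) }
    ; additive    = λ { (a ∷ _ ∷ _ ∷ _ ∷ []) (a′ ∷ _ ∷ _ ∷ _ ∷ []) → cong (_∷ _) (distrib a a′) }
    ; homogeneous = λ { k (a ∷ _ ∷ _ ∷ _ ∷ []) → cong (_∷ _) (commute k a) }
    ; stable      = stable-by-check flip (toWitness {a? = all-∈? (map flip 600-cellVertices) 600-cellVertices} _)
    }
    where
    twice : ∀ a → -1φ *φ (-1φ *φ a) ≡ a
    twice = Solver.solve-∀ ring-φ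
    signs : ∀ a b → (-1φ *φ a) *φ (-1φ *φ b) ≡ a *φ b
    signs = Solver.solve-∀ ring-φ
    distrib : ∀ a b → -1φ *φ (a +φ b) ≡ -1φ *φ a +φ -1φ *φ b
    distrib = Solver.solve-∀ ring-φ
    commute : ∀ k a → -1φ *φ (k *φ a) ≡ k *φ (-1φ *φ a)
    commute = Solver.solve-∀ ring-φ

  swap₁-symmetry : Symmetry swap₁
  swap₁-symmetry = record
    { involutive  = λ { (a ∷ b ∷ c ∷ d ∷ []) → ≡.refl }
    ; isometric   = λ { (a ∷ b ∷ c ∷ d ∷ []) (a′ ∷ b′ ∷ c′ ∷ d′ ∷ []) →
                        permute (a *φ a′) (b *φ b′) (c *φ c′) (d *φ d′) }
    ; additive    = λ { (a ∷ b ∷ c ∷ d ∷ []) (a′ ∷ b′ ∷ c′ ∷ d′ ∷ []) → ≡.refl }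
    ; homogeneous = λ { k (a ∷ b ∷ c ∷ d ∷ []) → ≡.refl }
    ; stable      = stable-by-check swap₁ (toWitness {a? = all-∈? (map swap₁ 600-cellVertices) 600-cellVertices} _)
    }
    where
    permute : ∀ a b c d → b +φ (a +φ (d +φ (c +φ 0φ))) ≡ a +φ (b +φ (c +φ (d +φ 0φ)))
    permute = Solver.solve-∀ ring-φ

  swap₂-symmetry : Symmetry swap₂
  swap₂-symmetry = record
    { involutive  = λ { (a ∷ b ∷ c ∷ d ∷ []) → ≡.refl }
    ; isometric   = λ { (a ∷ b ∷ c ∷ d ∷ []) (a′ ∷ b′ ∷ c′ ∷ d′ ∷ []) →
                        permute (a *φ a′) (b *φ b′) (c *φ c′) (d *φ d′) }
    ; additive    = λ { (a ∷ b ∷ c ∷ d ∷ []) (a′ ∷ b′ ∷ c′ ∷ d′ ∷ []) → ≡.refl }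
    ; homogeneous = λ { k (a ∷ b ∷ c ∷ d ∷ []) → ≡.refl }
    ; stable      = stable-by-check swap₂ (toWitness {a? = all-∈? (map swap₂ 600-cellVertices) 600-cellVertices} _)
    }
    where
    permute : ∀ a b c d → c +φ (d +φ (a +φ (b +φ 0φ))) ≡ a +φ (b +φ (c +φ (d +φ 0φ)))
    permute = Solver.solve-∀ ring-φ

  representatives : List (Vec ℤ[φ] 4)
  representatives =
      (2φ ∷ 0φ ∷ 0φ ∷ 0φ ∷ []) ∷ (1φ ∷ 1φ ∷ 1φ ∷ 1φ ∷ [])
    ∷ (φ ∷ 1φ ∷ φ⁻¹ ∷ 0φ ∷ []) ∷ (φ ∷ φ⁻¹ ∷ 0φ ∷ 1φ ∷ []) ∷ (φ ∷ 0φ ∷ 1φ ∷ φ⁻¹ ∷ []) ∷ []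

  adjoin : (Vec ℤ[φ] 4 → Vec ℤ[φ] 4) → List (Vec ℤ[φ] 4) → List (Vec ℤ[φ] 4)
  adjoin g L = L ++ map g L

  -- Each coordinate is brought to the front once and possibly negated there.
  images : List (Vec ℤ[φ] 4)
  images = adjoin swap₂ (adjoin swap₁ (adjoin flip (map swap₁ (adjoin flip (map swap₂
    (adjoin flip (map swap₁ (adjoin flip representatives))))))))

  regular-representatives : All (Regular 2) representatives
  regular-representatives = All.map regularCheck⇒Regular
    (toWitness {a? = All.all? (regularCheck? 2) representatives} _)

  regular-map : ∀ {g L} → Symmetry g → All (Regular 2) L → All (Regular 2) (map g L)
  regular-map symmetry regular = Allₚ.map⁺ (All.map (Symmetry.regular-image symmetry) regular)

  regular-adjoin : ∀ {g L} → Symmetry g → All (Regular 2) L → All (Regular 2) (adjoin g L)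
  regular-adjoin symmetry regular = Allₚ.++⁺ regular (regular-map symmetry regular)

  regular-images : All (Regular 2) images
  regular-images = regular-adjoin swap₂-symmetry (regular-adjoin swap₁-symmetry
    (regular-adjoin flip-symmetry (regular-map swap₁-symmetry (regular-adjoin flip-symmetry (regular-map swap₂-symmetry
    (regular-adjoin flip-symmetry (regular-map swap₁-symmetry (regular-adjoin flip-symmetry regular-representatives))))))))

  regular : ∀ {x} → x ∈ 600-cellVertices → Regular 2 x
  regular x∈ = All.lookup regular-images
    (All.lookup (toWitness {a? = all-∈? 600-cellVertices images} _) x∈)

  vertices-distinct : Unique 600-cellVertices
  vertices-distinct = toWitness {a? = DecUnique.unique? _≟ᵛ_ 600-cellVertices} _

  open SphericalComplex 600-cellVertices R A
    (Unique⇒lookup-injective vertices-distinct) (Regular.norm ∘ regular) (Regular.antipode ∘ regular)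
    (λ x∈ → Regular.pairs (regular x∈)) (all-regular⇒links regular)
    (NonNegative⇒Pos (R -φ A) (toWitness {a? = nonNegative? (R -φ A)} _))
    (λ ()) (λ ()) (λ ()) (λ ()) (λ ()) zero

  zigzags : IsCoxeterNumber H₄-matrix 30 × ZigzagsHaveLength 600-cell 30
  zigzags = sphericalLengths (λ k → if k ≡ᵇ 2 then 5 else 3)
    (λ { zero _ → ≡.refl ; (suc zero) _ → ≡.refl ; (suc (suc zero)) ne → ⊥-elim (ne ≡.refl)
       ; (suc (suc (suc _))) _ → ≡.refl })
    (λ { (suc (suc zero)) _ → ≡.refl }) 30 z<s H₄-power
    (λ { (suc k) _ (s≤s k<29) →
      toWitness {a? = ℕ.allUpTo? (λ k → ¬? (head (iterate rotateDots (initialDots 3 R A) (suc k)) ≟φ R)) 29} _ k<29 })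
    flag (λ i j → toWitness {a? = Fin.all? λ i → Fin.all? λ j → i Fin.<? j →-dec
      dot (pt (lookup flag i)) (pt (lookup flag j)) ≟φ A} _ i j)
    where
    flag : Vec (Fin (length 600-cellVertices)) 4
    -- The vertex (2, 0, 0, 0) and the images of (φ, 1, φ⁻¹, 0) under cyclic permutation of the last
    -- three coordinates.
    flag = # 0 ∷ # 24 ∷ # 28 ∷ # 29 ∷ []

-- The 24-cell

-- The 24-cell with circumradius √2 and edge length √2.
R₂₄ A₂₄ : ℤ[φ]
R₂₄ = (+ 2) ⊹ (+ 0) φ
A₂₄ = (+ 1) ⊹ (+ 0) φ

-- Facets are octahedra p · x = 2 with outer normals p.
module OctahedralFacts (V normals : List (Vec ℤ[φ] 4)) where
  open SphericalPoints V A₂₄ using (Far)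

  private
    R A : ℤ[φ]
    R = R₂₄
    A = A₂₄

    𝕍 : Set
    𝕍 = Vec ℤ[φ] 4

  -- Orthogonal vertices share a proper face without being joined by an edge: they are opposite in
  -- an octahedral facet, whose normal is their sum.
  data Position (x y : 𝕍) : Set where
    equal      : x ≡ y → Position x y
    adjacent   : dot x y ≡ A → Position x y
    orthogonal : dot x y ≡ 0φ → x ⊞ y ∈ normals → Position x y
    opposed    : Far x y → Position x y

  record VertexFacts (x : 𝕍) : Set where
    field
      norm      : dot x x ≡ R
      antipode  : -1φ ⊡ x ∈ V
      position  : ∀ {y} → y ∈ V → Position x y
      no-four   : ∀ {w u t} → w ∈ V → u ∈ V → t ∈ V → dot x w ≡ A → dot x u ≡ A → dot w u ≡ A →
                  dot x t ≡ A → dot w t ≡ A → dot u t ≢ A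

  On : 𝕍 → 𝕍 → Set
  On p z = z ∈ V × dot p z ≡ 2φ

  -- In `outside`, a vertex off the octahedron is paired with a vertex on it that it shares no
  -- proper face with, so no proper face can contain the octahedron and more. In `third`, the two
  -- triangles of the octahedron at an edge end in opposite vertices, and opposite vertices sum to
  -- `p`. In `across`, the normals of the two facets at a triangle add up to the sum of its
  -- vertices.
  record FacetFacts (p : 𝕍) : Set where
    field
      norm    : dot p p ≡ 2φ +φ 2φ
      outside : ∀ {z} → z ∈ V → dot p z ≡ 2φ ⊎ (Pos (2φ -φ dot p z) × (∃[ x ] On p x × Far x z))
      nonempty : ¬ (∀ {z} → z ∈ V → dot p z ≢ 2φ)
      side    : ∀ {v} → On p v → ∃[ w ] On p w × dot v w ≡ A
      third   : ∀ {v w} → On p v → On p w → dot v w ≡ A →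
                ∃[ t ] ∃[ t′ ] (On p t × dot v t ≡ A × dot w t ≡ A) × (On p t′ × dot v t′ ≡ A × dot w t′ ≡ A) ×
                t ⊞ t′ ≡ p × (∀ {y} → On p y → dot v y ≡ A → dot w y ≡ A → y ≡ t ⊎ y ≡ t′)
      across  : ∀ {v w u} → On p v → On p w → On p u → dot v w ≡ A → dot v u ≡ A → dot w u ≡ A →
                (v ⊞ w ⊞ u) ⊞ -1φ ⊡ p ∈ normals
      others  : ∀ {q} → q ∈ normals → p ≡ q ⊎ Pos (2φ -φ dot p q)


module OctahedralComplex (V normals : List (Vec ℤ[φ] 4))
  (lookup-injective : ∀ {i j} → List.lookup V i ≡ List.lookup V j → i ≡ j)
  (vertexFacts : ∀ {x} → x ∈ V → OctahedralFacts.VertexFacts V normals x)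
  (facetFacts : ∀ {p} → p ∈ normals → OctahedralFacts.FacetFacts V normals p)
  (vertex : Fin (List.length V))
  where
  open OctahedralFacts V normals
  open SphericalPoints V A₂₄
  open FaceComplex (convexHull V) using (IsFace)
  open CoveringFaces (convexHull V)

  private
    N : ℕ
    N = List.length V
    𝕍 : Set
    𝕍 = Vec ℤ[φ] 4

  position⇒below : ∀ {x y} → Position x y → x ≡ y ⊎ Pos (A₂₄ -φ dot x y)
  position⇒below (equal eq)        = inj₁ eq
  position⇒below {x} {y} (adjacent adj) = inj₂ (pair⇒below {x} {y} (inj₁ adj))
  position⇒below (orthogonal eq _) = inj₂ (subst (λ z → Pos (A₂₄ -φ z)) (≡.sym eq) (Nat⇒Pos 1 0))
  position⇒below (opposed distant) = inj₂ (Far.below distant)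

  open CliqueFaces V R₂₄ A₂₄ lookup-injective (VertexFacts.norm ∘ vertexFacts) (VertexFacts.antipode ∘ vertexFacts)
    (λ x∈ y∈ → position⇒below (VertexFacts.position (vertexFacts x∈) y∈))
    (NonNegative⇒Pos (R₂₄ -φ A₂₄) (toWitness {a? = nonNegative? (R₂₄ -φ A₂₄)} _)) (λ ()) (λ ()) (λ ()) vertex

  0≢A : 0φ ≢ A₂₄
  0≢A ()

  0≢R : 0φ ≢ R₂₄
  0≢R ()

  adjacent⇒≢ : ∀ {i j} → Adjacent i j → i ≢ j
  adjacent⇒≢ adj ≡.refl = ¬adjacent-refl adj

  clique₁ : ∀ {v} → Clique (⊥ ⊕ v)
  clique₁ = clique-⊕ (λ i∈ → ⊥-elim (Subsetₚ.∉⊥ i∈)) (λ i∈ → ⊥-elim (Subsetₚ.∉⊥ i∈))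

  clique₂ : ∀ {v w} → Adjacent v w → Clique (⊥ ⊕ v ⊕ w)
  clique₂ {v} {w} vw = clique-⊕ clique₁ λ i∈ → [ (λ i∈⊥ → ⊥-elim (Subsetₚ.∉⊥ i∈⊥)) , (λ { ≡.refl → vw }) ]′ (∈-insert⁻ ⊥ v i∈)

  adjacent-to₂ : ∀ {v w u} → Adjacent v u → Adjacent w u → ∀ {i} → i ∈ˢ ⊥ ⊕ v ⊕ w → Adjacent i u
  adjacent-to₂ {v} {w} vu wu i∈ with ∈-insert⁻ (⊥ ⊕ v) w i∈
  ... | inj₂ ≡.refl = wu
  ... | inj₁ i∈v with ∈-insert⁻ ⊥ v i∈v
  ...   | inj₁ i∈⊥    = ⊥-elim (Subsetₚ.∉⊥ i∈⊥)
  ...   | inj₂ ≡.refl = vu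

  record Triangle (v w u : Fin N) : Set where
    field
      vw : Adjacent v w
      vu : Adjacent v u
      wu : Adjacent w u

  clique₃ : ∀ {v w u} → Triangle v w u → Clique (⊥ ⊕ v ⊕ w ⊕ u)
  clique₃ t = clique-⊕ (clique₂ vw) (adjacent-to₂ vu wu)
    where open Triangle t

  v∉⊥ : ∀ {v : Fin N} → v ∉ˢ ⊥
  v∉⊥ = Subsetₚ.∉⊥

  ∉₁ : ∀ {v w} → Adjacent v w → w ∉ˢ ⊥ ⊕ v
  ∉₁ vw = ∉-insert v∉⊥ (adjacent⇒≢ vw ∘ ≡.sym)

  ∉₂ : ∀ {v w u} → Adjacent v u → Adjacent w u → u ∉ˢ ⊥ ⊕ v ⊕ w
  ∉₂ vu wu = ∉-insert (∉₁ vu) (adjacent⇒≢ wu ∘ ≡.sym)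

  ∉-triangle : ∀ {v w u a} → a ≢ v → a ≢ w → a ≢ u → a ∉ˢ ⊥ ⊕ v ⊕ w ⊕ u
  ∉-triangle a≢v a≢w a≢u = ∉-insert (∉-insert (∉-insert v∉⊥ a≢v) a≢w) a≢u

  v∈₁ : ∀ {v : Fin N} → v ∈ˢ ⊥ ⊕ v
  v∈₁ {v} = ∈-insertʳ ⊥ v

  v∈₃ : ∀ {v w u : Fin N} → v ∈ˢ ⊥ ⊕ v ⊕ w ⊕ u
  v∈₃ {v} {w} {u} = ∈-insertˡ u (∈-insertˡ w v∈₁)

  w∈₃ : ∀ {v w u : Fin N} → w ∈ˢ ⊥ ⊕ v ⊕ w ⊕ u
  w∈₃ {v} {w} {u} = ∈-insertˡ u (∈-insertʳ (⊥ ⊕ v) w)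

  u∈₃ : ∀ {v w u : Fin N} → u ∈ˢ ⊥ ⊕ v ⊕ w ⊕ u
  u∈₃ {v} {w} {u} = ∈-insertʳ (⊥ ⊕ v ⊕ w) u

  triangle-⊆ : ∀ {v w u Z} → v ∈ˢ Z → w ∈ˢ Z → u ∈ˢ Z → ⊥ ⊕ v ⊕ w ⊕ u ⊆ Z
  triangle-⊆ v∈ w∈ u∈ = insert-⊆ (insert-⊆ (insert-⊆ (⊥-elim ∘ v∉⊥) v∈) w∈) u∈

  ⊂-insert : ∀ {X : Subset N} {a} → a ∉ˢ X → X ⊂ X ⊕ a
  ⊂-insert {X} {a} a∉ = ∈-insertˡ a , a , ∈-insertʳ X a , a∉

  clique≡triangle : ∀ {v w u Z} → Triangle v w u → Clique Z → ⊥ ⊕ v ⊕ w ⊕ u ⊆ Z → Z ≡ ⊥ ⊕ v ⊕ w ⊕ u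
  clique≡triangle {v} {w} {u} {Z} t clique ⊆Z = Subsetₚ.⊆-antisym Z⊆ ⊆Z
    where
    open Triangle t
    Z⊆ : Z ⊆ ⊥ ⊕ v ⊕ w ⊕ u
    Z⊆ {a} a∈ with a Subsetₚ.∈? ⊥ ⊕ v ⊕ w ⊕ u
    ... | yes a∈₃ = a∈₃
    ... | no  a∉₃ = ⊥-elim (VertexFacts.no-four (vertexFacts (pt∈ v)) (pt∈ w) (pt∈ u) (pt∈ a) vw vu wu
          (clique (⊆Z v∈₃) a∈ λ { ≡.refl → a∉₃ v∈₃ }) (clique (⊆Z w∈₃) a∈ λ { ≡.refl → a∉₃ w∈₃ })
          (clique (⊆Z u∈₃) a∈ λ { ≡.refl → a∉₃ u∈₃ }))

  oct : 𝕍 → Subset N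
  oct p = Vec.tabulate (λ i → Dec.does (dot p (pt i) ≟φ 2φ))

  ∈-oct⁺ : ∀ p i → dot p (pt i) ≡ 2φ → i ∈ˢ oct p
  ∈-oct⁺ p i eq = Vecₚ.lookup⇒[]= i (oct p) (≡.trans (Vecₚ.lookup∘tabulate _ i) (dec-true (dot p (pt i) ≟φ 2φ) eq))

  ∈-oct⁻ : ∀ p i → i ∈ˢ oct p → dot p (pt i) ≡ 2φ
  ∈-oct⁻ p i i∈ = does⇒ (dot p (pt i) ≟φ 2φ) (≡.trans (≡.sym (Vecₚ.lookup∘tabulate _ i)) (Vecₚ.[]=⇒lookup i∈))
    where
    does⇒ : ∀ {P : Set} (d : Dec P) → Dec.does d ≡ true → P
    does⇒ (yes p) _ = p

  on : ∀ p i → dot p (pt i) ≡ 2φ → On p (pt i)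
  on p i eq = pt∈ i , eq

  -- Every vertex of an octahedron is the third one of some triangle, and so has an antipode.
  oct-antipode : ∀ {p z} → p ∈ normals → On p z → ∃[ z′ ] On p z′ × z ⊞ z′ ≡ p
  oct-antipode {p} {z} p∈ z-on =
    let w , w-on , zw                  = side z-on
        t , _ , (t-on , zt , wt) , _   = third z-on w-on zw
        s , s′ , (s-on , _) , (s′-on , _) , sum , only = third w-on t-on wt
    in [ (λ z≡s → s′ , s′-on , ≡.trans (cong (_⊞ s′) z≡s) sum)
       , (λ z≡s′ → s , s-on , ≡.trans (cong (_⊞ s) z≡s′) (≡.trans (⊞-comm s′ s) sum)) ]′
       (only z-on (≡.trans (dot-comm w z) zw) (≡.trans (dot-comm t z) zt))
    where open FacetFacts (facetFacts p∈)

  reflect-on : ∀ {p z} → p ∈ normals → On p z → On p (p ⊞ -1φ ⊡ z)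
  reflect-on {p} {z} p∈ z-on = let z′ , z′-on , sum = oct-antipode p∈ z-on in
    subst (On p) (≡.trans (≡.sym (⊞-cancel z z′)) (cong (_⊞ -1φ ⊡ z) sum)) z′-on

  point? : (x : 𝕍) → Dec (∃[ i ] pt i ≡ x)
  point? x = Fin.any? (λ i → pt i ≟ᵛ x)

  flip : 𝕍 → Fin N → Fin N
  flip p i with point? (p ⊞ -1φ ⊡ pt i)
  ... | yes (j , _) = j
  -- Never reached on the octahedron of a normal, where the reflected vector is a vertex by
  -- `reflect-on`.
  ... | no  _       = i

  pt-flip : ∀ {p i} → p ∈ normals → dot p (pt i) ≡ 2φ → pt (flip p i) ≡ p ⊞ -1φ ⊡ pt i
  pt-flip {p} {i} p∈ eq with point? (p ⊞ -1φ ⊡ pt i)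
  ... | yes (_ , j≡) = j≡
  ... | no  none     = ⊥-elim (none (index (proj₁ (reflect-on p∈ (on p i eq)))))

  flip-on : ∀ {p i} → p ∈ normals → dot p (pt i) ≡ 2φ → dot p (pt (flip p i)) ≡ 2φ
  flip-on {p} {i} p∈ eq = ≡.trans (cong (dot p) (pt-flip p∈ eq)) (proj₂ (reflect-on p∈ (on p i eq)))

  dot-flip : ∀ {p i} x → p ∈ normals → dot p (pt i) ≡ 2φ → dot x (pt (flip p i)) ≡ dot x p +φ neg (dot x (pt i))
  dot-flip {p} {i} x p∈ eq = ≡.trans (cong (dot x) (pt-flip p∈ eq))
    (≡.trans (dot-⊞ʳ x p (-1φ ⊡ pt i)) (cong (dot x p +φ_) (dot-antipode x (pt i))))

  flip-involutive : ∀ {p i} → p ∈ normals → dot p (pt i) ≡ 2φ → flip p (flip p i) ≡ i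
  flip-involutive {p} {i} p∈ eq = lookup-injective (≡.trans (pt-flip p∈ (flip-on p∈ eq))
    (≡.trans (cong (λ x → p ⊞ -1φ ⊡ x) (pt-flip p∈ eq)) (twice p (pt i))))
    where
    twice : ∀ {d} (p x : Vec ℤ[φ] d) → p ⊞ -1φ ⊡ (p ⊞ -1φ ⊡ x) ≡ x
    twice []      []      = ≡.refl
    twice (a ∷ p) (b ∷ x) = cong₂ _∷_ (lemma a b) (twice p x)
      where
      lemma : ∀ a b → a +φ -1φ *φ (a +φ -1φ *φ b) ≡ b
      lemma = Solver.solve-∀ ring-φ

  dot-flip-self : ∀ {p i} → p ∈ normals → dot p (pt i) ≡ 2φ → dot (pt i) (pt (flip p i)) ≡ 0φ
  dot-flip-self {p} {i} p∈ eq = ≡.trans (dot-flip (pt i) p∈ eq)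
    (cong₂ (λ a b → a +φ neg b) (≡.trans (dot-comm (pt i) p) eq) (norm-pt i))

  oct-face : ∀ {p} → p ∈ normals → IsFace (oct p)
  oct-face {p} p∈ = (Subsetₚ.⊆⊤ , beyond) , p , 2φ , bound , λ i → mk⇔ (∈-oct⁻ p i) (∈-oct⁺ p i)
    where
    beyond : ∃[ x ] x ∈ˢ ⊤ × x ∉ˢ oct p
    beyond with vertex Subsetₚ.∈? oct p
    ... | no  v∉ = vertex , Subsetₚ.∈⊤ , v∉
    ... | yes v∈ with j , eq ← index (VertexFacts.antipode (vertexFacts (pt∈ vertex))) =
      j , Subsetₚ.∈⊤ , λ j∈ → -2≢2 (≡.trans
        (≡.sym (≡.trans (cong (dot p) eq) (≡.trans (dot-antipode p (pt vertex)) (cong neg (∈-oct⁻ p vertex v∈)))))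
        (∈-oct⁻ p j j∈))
      where
      -2≢2 : neg 2φ ≢ 2φ
      -2≢2 ()
    bound : ∀ i → NonNegative (2φ -φ dot p (pt i))
    bound i with FacetFacts.outside (facetFacts p∈) (pt∈ i)
    ... | inj₁ eq       = Pos⇒NonNegative (subst (λ x → Pos (2φ -φ x)) (≡.sym eq) Pos-0)
    ... | inj₂ (le , _) = Pos⇒NonNegative le

  module _ {X : Subset N} (proper : X ⊂ ⊤) (f : 𝕍) (c : ℤ[φ])
    (bound : ∀ i → NonNegative (c -φ dot f (pt i))) (iff : ∀ i → (i ∈ˢ X) ⇔ (dot f (pt i) ≡ c)) where

    bounded : Bounded f c
    bounded z∈ with k , ≡.refl ← index z∈ = NonNegative⇒Pos (c -φ dot f (pt k)) (bound k)

    not-opposed : ∀ {i j} → i ∈ˢ X → j ∈ˢ X → ¬ Far (pt i) (pt j)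
    not-opposed {i} {j} i∈ j∈ distant = exposed⇒c≢0 f c proper bound iff
      (Far.separate distant f c bounded (Equivalence.to (iff i) i∈) (Equivalence.to (iff j) j∈))

    -- The functional takes the value 2c at the normal, hence on the sum of any two opposite
    -- vertices of the octahedron; being at most `c` at each, it equals `c` at both. A further
    -- vertex of `X` would be `Far` from some vertex of the octahedron.
    orthogonal⇒oct : ∀ {i j} → i ∈ˢ X → j ∈ˢ X → pt i ⊞ pt j ∈ normals → X ≡ oct (pt i ⊞ pt j)
    orthogonal⇒oct {i} {j} i∈ j∈ p∈ = Subsetₚ.⊆-antisym X⊆ ⊆X
      where
      p = pt i ⊞ pt j
      f·p : dot f p ≡ c +φ c
      f·p = ≡.trans (dot-⊞ʳ f (pt i) (pt j)) (cong₂ _+φ_ (Equivalence.to (iff i) i∈) (Equivalence.to (iff j) j∈))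
      ⊆X : oct p ⊆ X
      ⊆X {k} k∈ with z′ , (z′∈ , _) , sum ← oct-antipode {p} {pt k} p∈ (on p k (∈-oct⁻ p k k∈)) =
        Equivalence.from (iff k) (≡.sym (-φ-≡0 (Pos-antisym (bounded (pt∈ k)) (subst Pos slack (bounded z′∈)))))
        where
        double : dot f (pt k) +φ dot f z′ ≡ c +φ c
        double = ≡.trans (≡.sym (dot-⊞ʳ f (pt k) z′)) (≡.trans (cong (dot f) sum) f·p)
        slack : c -φ dot f z′ ≡ neg (c -φ dot f (pt k))
        slack = ≡.trans (-φ-neg c (dot f z′)) (≡.trans (solve-for c (dot f (pt k)) (dot f z′) double)
          (cong neg (≡.sym (-φ-neg c (dot f (pt k))))))
          where
          solve-for : ∀ c a b → a +φ b ≡ c +φ c → c +φ neg b ≡ neg (c +φ neg a)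
          solve-for c a b eq = ≡.trans (before a b c) (≡.trans (cong (λ s → a +φ (c +φ neg s)) eq) (after a c))
            where
            before : ∀ a b c → c +φ neg b ≡ a +φ (c +φ neg (a +φ b))
            before = Solver.solve-∀ ring-φ
            after : ∀ a c → a +φ (c +φ neg (c +φ c)) ≡ neg (c +φ neg a)
            after = Solver.solve-∀ ring-φ
      X⊆ : X ⊆ oct p
      X⊆ {k} k∈ with FacetFacts.outside (facetFacts p∈) (pt∈ k)
      ... | inj₁ eq = ∈-oct⁺ p k eq
      ... | inj₂ (_ , x , (x∈ , x-on) , distant) with l , ≡.refl ← index x∈ =
        ⊥-elim (not-opposed (⊆X (∈-oct⁺ p l x-on)) k∈ distant)

  -- A face with an orthogonal pair is the octahedron on that pair. Without one, all its pairs are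
  -- adjacent, since `Far` pairs are excluded in any case.
  classify : ∀ {X} → IsFace X → Clique X ⊎ (∃[ p ] p ∈ normals × X ≡ oct p)
  classify {X} (proper , f , c , bound , iff)
    with Fin.any? (λ i → Fin.any? (λ j → i Subsetₚ.∈? X ×-dec j Subsetₚ.∈? X ×-dec dot (pt i) (pt j) ≟φ 0φ))
  ... | yes (i , j , i∈ , j∈ , eq) with VertexFacts.position (vertexFacts (pt∈ i)) (pt∈ j)
  ...   | orthogonal _ p∈ = inj₂ (pt i ⊞ pt j , p∈ , orthogonal⇒oct proper f c bound iff i∈ j∈ p∈)
  ...   | opposed distant = ⊥-elim (not-opposed proper f c bound iff i∈ j∈ distant)
  ...   | adjacent adj    = ⊥-elim (0≢A (≡.trans (≡.sym eq) adj))
  ...   | equal same-point = ⊥-elim (0≢R (≡.trans (≡.sym eq) (≡.trans (cong (dot (pt i)) (≡.sym same-point)) (norm-pt i))))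
  classify {X} (proper , f , c , bound , iff) | no none = inj₁ λ {i} {j} i∈ j∈ i≢j →
    adjacent-by i∈ j∈ i≢j (VertexFacts.position (vertexFacts (pt∈ i)) (pt∈ j))
    where
    adjacent-by : ∀ {i j} → i ∈ˢ X → j ∈ˢ X → i ≢ j → Position (pt i) (pt j) → Adjacent i j
    adjacent-by i∈ j∈ i≢j (equal eq)        = ⊥-elim (i≢j (lookup-injective eq))
    adjacent-by i∈ j∈ i≢j (adjacent adj)    = adj
    adjacent-by i∈ j∈ i≢j (orthogonal eq _) = ⊥-elim (none (_ , _ , i∈ , j∈ , eq))
    adjacent-by i∈ j∈ i≢j (opposed distant) = ⊥-elim (not-opposed proper f c bound iff i∈ j∈ distant)

  -- Two opposite vertices of the first octahedron sum to `p`, and both have product 2 with `q`, so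
  -- the product of `p` and `q` is 4. Distinct normals have product at most 2.
  oct-injective : ∀ {p q i} → p ∈ normals → q ∈ normals → i ∈ˢ oct p → oct p ⊆ oct q → p ≡ q
  oct-injective {p} {q} {i} p∈ q∈ i∈ p⊆q with FacetFacts.others (facetFacts p∈) q∈
  ... | inj₁ eq = eq
  ... | inj₂ le with z′ , (z′∈ , z′-on) , sum ← oct-antipode {p} {pt i} p∈ (on p i (∈-oct⁻ p i i∈))
                with j , ≡.refl ← index z′∈ =
    ⊥-elim (-2≱0 (Pos⇒NonNegative (subst (λ x → Pos (2φ -φ x)) p·q le)))
    where
    p·q : dot p q ≡ 2φ +φ 2φ
    p·q = ≡.trans (dot-comm p q) (≡.trans (cong (dot q) (≡.sym sum)) (≡.trans (dot-⊞ʳ q (pt i) (pt j))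
      (cong₂ _+φ_ (∈-oct⁻ q i (p⊆q i∈)) (∈-oct⁻ q j (p⊆q (∈-oct⁺ p j z′-on))))))
    -2≱0 : ¬ NonNegative (2φ -φ (2φ +φ 2φ))
    -2≱0 ()

  covers-clique : ∀ {X Y a} → Covers (convexHull V) Y X → X ⊆ Y → a ∈ˢ Y → a ∉ˢ X → Clique (X ⊕ a) → X ⊕ a ≡ Y
  covers-clique covers X⊆Y a∈ a∉ clique = covers-≡ covers (clique⇒face clique) (⊂-insert a∉) (insert-⊆ X⊆Y a∈)

  rank₀ : ∀ {Y} → IsFaceOfRank (convexHull V) 0 Y → ∃[ v ] Y ≡ ⊥ ⊕ v
  rank₀ (_ , covers@((⊥⊆Y , v , v∈ , v∉) , _)) = v , ≡.sym (covers-clique covers ⊥⊆Y v∈ v∉ clique₁)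

  -- The octahedral case need not be refuted: the octahedron has an edge at `v`, and since it is
  -- supposed to cover the vertex `v`, it would equal that edge. The next rank is treated alike,
  -- with a triangle.
  rank₁ : ∀ {Y} → IsFaceOfRank (convexHull V) 1 Y → ∃[ v ] ∃[ w ] Adjacent v w × Y ≡ ⊥ ⊕ v ⊕ w
  rank₁ {Y} (face , X , rankX , covers@((X⊆Y , a , a∈ , a∉) , _)) with v , ≡.refl ← rank₀ rankX with classify face
  ... | inj₁ clique = v , a , va , ≡.sym (covers-clique covers X⊆Y a∈ a∉ (clique₂ va))
    where
    va : Adjacent v a
    va = clique (X⊆Y v∈₁) a∈ λ { ≡.refl → a∉ v∈₁ }
  ... | inj₂ (p , p∈ , ≡.refl)
    with x , (x∈ , x-on) , vx ← FacetFacts.side (facetFacts p∈) (on p v (∈-oct⁻ p v (X⊆Y v∈₁)))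
    with w , ≡.refl ← index x∈ =
    v , w , vx , ≡.sym (covers-clique covers X⊆Y (∈-oct⁺ p w x-on) (∉₁ vx) (clique₂ vx))

  rank₂ : ∀ {Y} → IsFaceOfRank (convexHull V) 2 Y → ∃[ v ] ∃[ w ] ∃[ u ] Triangle v w u × Y ≡ ⊥ ⊕ v ⊕ w ⊕ u
  rank₂ {Y} (face , X , rankX , covers@((X⊆Y , a , a∈ , a∉) , _)) with v , w , vw , ≡.refl ← rank₁ rankX with classify face
  ... | inj₁ clique = v , w , a , t , ≡.sym (covers-clique covers X⊆Y a∈ a∉ (clique₃ t))
    where
    w∈₂ : w ∈ˢ ⊥ ⊕ v ⊕ w
    w∈₂ = ∈-insertʳ (⊥ ⊕ v) w
    v∈₂ : v ∈ˢ ⊥ ⊕ v ⊕ w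
    v∈₂ = ∈-insertˡ w v∈₁
    t : Triangle v w a
    t = record { vw = vw ; vu = clique (X⊆Y v∈₂) a∈ (λ { ≡.refl → a∉ v∈₂ }) ; wu = clique (X⊆Y w∈₂) a∈ λ { ≡.refl → a∉ w∈₂ } }
  ... | inj₂ (p , p∈ , ≡.refl)
    with x , _ , ((x∈ , x-on) , vx , wx) , _ ← FacetFacts.third (facetFacts p∈) (on p v (∈-oct⁻ p v (X⊆Y (∈-insertˡ w v∈₁))))
           (on p w (∈-oct⁻ p w (X⊆Y (∈-insertʳ (⊥ ⊕ v) w)))) vw
    with u , ≡.refl ← index x∈ =
    v , w , u , t , ≡.sym (covers-clique covers X⊆Y (∈-oct⁺ p u x-on) (∉₂ vx wx) (clique₃ t))
    where
    t : Triangle v w u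
    t = record { vw = vw ; vu = vx ; wu = wx }

  rank₃ : ∀ {Y} → IsFaceOfRank (convexHull V) 3 Y → ∃[ p ] p ∈ normals × Y ≡ oct p
  rank₃ {Y} (face , X , rankX , (X⊆Y , a , a∈ , a∉) , _) with v , w , u , t , ≡.refl ← rank₂ rankX with classify face
  ... | inj₂ facet  = facet
  ... | inj₁ clique = ⊥-elim (a∉ (subst (a ∈ˢ_) (clique≡triangle t clique X⊆Y) a∈))

  -- Facets are not simplices here, so a flag is coded by three vertices for the lower faces and by
  -- the normal of its facet.
  record Raw : Set where
    constructor raw
    field
      v w u : Fin N
      p     : 𝕍

  record Valid (c : Raw) : Set where
    open Raw c
    field
      triangle : Triangle v w u
      p∈       : p ∈ normals
      v-on     : dot p (pt v) ≡ 2φ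
      w-on     : dot p (pt w) ≡ 2φ
      u-on     : dot p (pt u) ≡ 2φ
    open Triangle triangle public

  Code : Set
  Code = ∃[ c ] Valid c

  faces : Raw → Fin 4 → Subset N
  faces (raw v w u p) zero                   = ⊥ ⊕ v
  faces (raw v w u p) (suc zero)             = ⊥ ⊕ v ⊕ w
  faces (raw v w u p) (suc (suc zero))       = ⊥ ⊕ v ⊕ w ⊕ u
  faces (raw v w u p) (suc (suc (suc zero))) = oct p

  module _ {c : Raw} (valid : Valid c) where
    open Raw c
    open Valid valid

    v∈oct : v ∈ˢ oct p
    v∈oct = ∈-oct⁺ p v v-on

    triangle⊂oct : ⊥ ⊕ v ⊕ w ⊕ u ⊂ oct p
    triangle⊂oct = triangle-⊆ v∈oct (∈-oct⁺ p w w-on) (∈-oct⁺ p u u-on)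
      , flip p v , ∈-oct⁺ p (flip p v) (flip-on p∈ v-on)
      , ∉-triangle (λ eq → 0≢R (≡.trans (≡.sym orth) (≡.trans (cong (λ i → dot (pt v) (pt i)) eq) (norm-pt v))))
                   (λ eq → 0≢A (≡.trans (≡.sym orth) (≡.trans (cong (λ i → dot (pt v) (pt i)) eq) vw)))
                   (λ eq → 0≢A (≡.trans (≡.sym orth) (≡.trans (cong (λ i → dot (pt v) (pt i)) eq) vu)))
      where
      orth : dot (pt v) (pt (flip p v)) ≡ 0φ
      orth = dot-flip-self p∈ v-on

    rank-0 : IsFaceOfRank (convexHull V) 0 (⊥ ⊕ v)
    rank-0 = clique⇒face clique₁ , ∣∣⇒covers (∈-insertˡ v) (∣insert∣ v∉⊥)

    rank-1 : IsFaceOfRank (convexHull V) 1 (⊥ ⊕ v ⊕ w)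
    rank-1 = clique⇒face (clique₂ vw) , _ , rank-0 , ∣∣⇒covers (∈-insertˡ w) (∣insert∣ (∉₁ vw))

    rank-2 : IsFaceOfRank (convexHull V) 2 (⊥ ⊕ v ⊕ w ⊕ u)
    rank-2 = clique⇒face (clique₃ triangle) , _ , rank-1 , ∣∣⇒covers (∈-insertˡ u) (∣insert∣ (∉₂ vu wu))

    between : ∀ Z → IsFace Z → ⊥ ⊕ v ⊕ w ⊕ u ⊂ Z → ¬ (Z ⊂ oct p)
    between Z face (⊆Z , a , a∈ , a∉) Z⊂oct with classify face
    ... | inj₁ clique            = a∉ (subst (a ∈ˢ_) (clique≡triangle triangle clique ⊆Z) a∈)
    ... | inj₂ (q , q∈ , ≡.refl) = Subsetₚ.⊂-irref (cong oct (oct-injective q∈ p∈ (⊆Z v∈₃) (proj₁ Z⊂oct))) Z⊂oct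

    rank-3 : IsFaceOfRank (convexHull V) 3 (oct p)
    rank-3 = oct-face p∈ , _ , rank-2 , triangle⊂oct , between

    ranks : ∀ i → IsFaceOfRank (convexHull V) (toℕ i) (faces c i)
    ranks zero                   = rank-0
    ranks (suc zero)             = rank-1
    ranks (suc (suc zero))       = rank-2
    ranks (suc (suc (suc zero))) = rank-3

    chain : ∀ {i j} → i <ᶠ j → faces c i ⊂ faces c j
    chain {zero} {suc zero} _ = ⊂-insert (∉₁ vw)
    chain {zero} {suc (suc zero)} _ = Subsetₚ.⊂-trans (⊂-insert (∉₁ vw)) (⊂-insert (∉₂ vu wu))
    chain {zero} {suc (suc (suc zero))} _ = Subsetₚ.⊂-trans (⊂-insert (∉₁ vw)) (Subsetₚ.⊂-trans (⊂-insert (∉₂ vu wu)) triangle⊂oct)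
    chain {suc zero} {suc (suc zero)} _ = ⊂-insert (∉₂ vu wu)
    chain {suc zero} {suc (suc (suc zero))} _ = Subsetₚ.⊂-trans (⊂-insert (∉₂ vu wu)) triangle⊂oct
    chain {suc (suc zero)} {suc (suc (suc zero))} _ = triangle⊂oct
    chain {suc zero} {suc zero} (s≤s ())
    chain {suc (suc zero)} {suc zero} (s≤s ())
    chain {suc (suc zero)} {suc (suc zero)} (s≤s (s≤s ()))
    chain {suc (suc (suc zero))} {suc zero} (s≤s ())
    chain {suc (suc (suc zero))} {suc (suc zero)} (s≤s (s≤s ()))
    chain {suc (suc (suc zero))} {suc (suc (suc zero))} (s≤s (s≤s (s≤s ())))

    maximal : ∀ Z → IsFace Z → (∀ i → Z ⊆ faces c i ⊎ faces c i ⊆ Z) → Z ≡ ⊥ ⊎ (∃[ i ] Z ≡ faces c i)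
    maximal Z face comparable with classify face
    ... | inj₂ (q , q∈ , ≡.refl) = inj₂ (# 3 , facet (comparable (# 3)))
      where
      member : ∃[ i ] i ∈ˢ oct q
      member with Subsetₚ.nonempty? (oct q)
      ... | yes i     = i
      ... | no  empty = ⊥-elim (FacetFacts.nonempty (facetFacts q∈) λ z∈ z-on →
        let i , eq = index z∈ in empty (i , ∈-oct⁺ q i (≡.trans (cong (dot q) eq) z-on)))
      facet : oct q ⊆ oct p ⊎ oct p ⊆ oct q → oct q ≡ oct p
      facet (inj₁ q⊆p) = cong oct (oct-injective q∈ p∈ (proj₂ member) q⊆p)
      facet (inj₂ p⊆q) = cong oct (≡.sym (oct-injective p∈ q∈ v∈oct p⊆q))
    ... | inj₁ clique = below₃ (comparable (# 2))
      where
      Goal : Set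
      Goal = Z ≡ ⊥ ⊎ (∃[ i ] Z ≡ faces c i)
      below₁ : Z ⊆ ⊥ ⊕ v → Goal
      below₁ Z⊆ = Sum.map₂ (# 0 ,_) (insert-between {X = ⊥} {Z} {v} (⊥-elim ∘ v∉⊥) Z⊆)
      below₂ : Z ⊆ ⊥ ⊕ v ⊕ w → Z ⊆ ⊥ ⊕ v ⊎ ⊥ ⊕ v ⊆ Z → Goal
      below₂ Z⊆ (inj₁ Z⊆₁) = below₁ Z⊆₁
      below₂ Z⊆ (inj₂ ⊆Z)  = inj₂ ([ (# 0 ,_) , (# 1 ,_) ]′ (insert-between {X = ⊥ ⊕ v} {Z} {w} ⊆Z Z⊆))
      below₃′ : Z ⊆ ⊥ ⊕ v ⊕ w ⊕ u → Z ⊆ ⊥ ⊕ v ⊕ w ⊎ ⊥ ⊕ v ⊕ w ⊆ Z → Goal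
      below₃′ Z⊆ (inj₁ Z⊆₂) = below₂ Z⊆₂ (comparable (# 0))
      below₃′ Z⊆ (inj₂ ⊆Z)  = inj₂ ([ (# 1 ,_) , (# 2 ,_) ]′ (insert-between {X = ⊥ ⊕ v ⊕ w} {Z} {u} ⊆Z Z⊆))
      below₃ : Z ⊆ ⊥ ⊕ v ⊕ w ⊕ u ⊎ ⊥ ⊕ v ⊕ w ⊕ u ⊆ Z → Goal
      below₃ (inj₁ Z⊆) = below₃′ Z⊆ (comparable (# 1))
      below₃ (inj₂ ⊆Z) = inj₂ (# 2 , clique≡triangle triangle clique ⊆Z)

  flagOf : Code → Flag (convexHull V)
  flagOf (c , valid) = record
    { face = faces c ; ranked = ranks valid ; chain = λ {i} {j} → chain valid {i} {j} ; maximal = maximal valid }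

  open FlagEquality (convexHull V)

  ∣pair∣ : ∀ {v w} → Adjacent v w → ∣ ⊥ ⊕ v ⊕ w ∣ ≡ 2
  ∣pair∣ vw = ≡.trans (∣insert∣ (∉₁ vw)) (cong suc (≡.trans (∣insert∣ v∉⊥) (cong suc (Subsetₚ.∣⊥∣≡0 N))))

  ∣triangle∣ : ∀ {v w u} → Triangle v w u → ∣ ⊥ ⊕ v ⊕ w ⊕ u ∣ ≡ 3
  ∣triangle∣ t = ≡.trans (∣insert∣ (∉₂ (Triangle.vu t) (Triangle.wu t))) (cong suc (∣pair∣ (Triangle.vw t)))

  -- Each face comes with a vertex list of its own, and these need not extend one another. Only
  -- their sizes are used: nested faces that differ by one vertex determine the next vertex of a
  -- common list.
  assemble : (f : Fin 4 → Subset N) → f (# 0) ⊆ f (# 1) → f (# 1) ⊆ f (# 2) → f (# 2) ⊆ f (# 3) →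
    (∃[ v ] f (# 0) ≡ ⊥ ⊕ v) → (∃[ v ] ∃[ w ] Adjacent v w × f (# 1) ≡ ⊥ ⊕ v ⊕ w) →
    (∃[ v ] ∃[ w ] ∃[ u ] Triangle v w u × f (# 2) ≡ ⊥ ⊕ v ⊕ w ⊕ u) → (∃[ p ] p ∈ normals × f (# 3) ≡ oct p) →
    ∃[ c ] Valid c × (∀ i → faces c i ≡ f i)
  assemble f ⊆₁ ⊆₂ ⊆₃ (v , f₀) (_ , _ , vw₁ , f₁) (_ , _ , _ , t₂ , f₂) (p , p∈ , f₃) =
    raw v w u p , valid , λ { zero → ≡.sym f₀ ; (suc zero) → ≡.sym e₁ ; (suc (suc zero)) → ≡.sym e₂
                            ; (suc (suc (suc zero))) → ≡.sym f₃ }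
    where
    ∣f₀∣ : ∣ f (# 0) ∣ ≡ 1
    ∣f₀∣ = ≡.trans (cong ∣_∣ f₀) (≡.trans (∣insert∣ v∉⊥) (cong suc (Subsetₚ.∣⊥∣≡0 N)))
    ∣f₁∣ : ∣ f (# 1) ∣ ≡ 2
    ∣f₁∣ = ≡.trans (cong ∣_∣ f₁) (∣pair∣ vw₁)
    next₁ : ∃[ a ] a ∉ˢ f (# 0) × f (# 1) ≡ f (# 0) ⊕ a
    next₁ = ⊂-card-suc ⊆₁ (≡.trans ∣f₁∣ (cong suc (≡.sym ∣f₀∣)))
    next₂ : ∃[ a ] a ∉ˢ f (# 1) × f (# 2) ≡ f (# 1) ⊕ a
    next₂ = ⊂-card-suc ⊆₂ (≡.trans (≡.trans (cong ∣_∣ f₂) (∣triangle∣ t₂)) (cong suc (≡.sym ∣f₁∣)))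
    w = proj₁ next₁
    u = proj₁ next₂
    e₁ : f (# 1) ≡ ⊥ ⊕ v ⊕ w
    e₁ = ≡.trans (proj₂ (proj₂ next₁)) (cong (_⊕ w) f₀)
    e₂ : f (# 2) ≡ ⊥ ⊕ v ⊕ w ⊕ u
    e₂ = ≡.trans (proj₂ (proj₂ next₂)) (cong (_⊕ u) e₁)
    w∉ : w ∉ˢ ⊥ ⊕ v
    w∉ = proj₁ (proj₂ next₁) ∘ subst (w ∈ˢ_) (≡.sym f₀)
    u∉ : u ∉ˢ ⊥ ⊕ v ⊕ w
    u∉ = proj₁ (proj₂ next₂) ∘ subst (u ∈ˢ_) (≡.sym e₁)
    clique : Clique (⊥ ⊕ v ⊕ w ⊕ u)
    clique = subst Clique (≡.trans (≡.sym f₂) e₂) (clique₃ t₂)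
    triangle-on : ∀ {i} → i ∈ˢ ⊥ ⊕ v ⊕ w ⊕ u → dot p (pt i) ≡ 2φ
    triangle-on {i} i∈ = ∈-oct⁻ p i (subst (i ∈ˢ_) f₃ (⊆₃ (subst (i ∈ˢ_) (≡.sym e₂) i∈)))
    v≢w : v ≢ w
    v≢w eq = w∉ (subst (_∈ˢ ⊥ ⊕ v) eq v∈₁)
    v≢u : v ≢ u
    v≢u eq = u∉ (subst (_∈ˢ ⊥ ⊕ v ⊕ w) eq (∈-insertˡ w v∈₁))
    w≢u : w ≢ u
    w≢u eq = u∉ (subst (_∈ˢ ⊥ ⊕ v ⊕ w) eq (∈-insertʳ (⊥ ⊕ v) w))
    valid : Valid (raw v w u p)
    valid = record
      { triangle = record { vw = clique v∈₃ w∈₃ v≢w ; vu = clique v∈₃ u∈₃ v≢u ; wu = clique w∈₃ u∈₃ w≢u }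
      ; p∈ = p∈ ; v-on = triangle-on v∈₃ ; w-on = triangle-on w∈₃ ; u-on = triangle-on u∈₃ }

  codeOf : ∀ F → ∃[ c ] flagOf c ≋ F
  codeOf F =
    let c , valid , eq = assemble face (proj₁ (strict {# 0} {# 1} z<s)) (proj₁ (strict {# 1} {# 2} (s≤s z<s)))
          (proj₁ (strict {# 2} {# 3} (s≤s (s≤s z<s)))) (rank₀ (ranked (# 0))) (rank₁ (ranked (# 1)))
          (rank₂ (ranked (# 2))) (rank₃ (ranked (# 3)))
    in (c , valid) , pointwise eq
    where
    open Flag F using (face; ranked)
    strict : ∀ {i j} → i <ᶠ j → face i ⊂ face j
    strict = Flag.chain F

  across : Raw → 𝕍
  across (raw v w u p) = (pt v ⊞ pt w ⊞ pt u) ⊞ -1φ ⊡ p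

  -- A change of the triangle stays within the octahedron, where the third vertex is replaced by its
  -- opposite; a change of the facet passes to the octahedron on the other side of the triangle.
  moveRaw : Fin 4 → Raw → Raw
  moveRaw zero                   (raw v w u p)   = raw w v u p
  moveRaw (suc zero)             (raw v w u p)   = raw v u w p
  moveRaw (suc (suc zero))       (raw v w u p)   = raw v w (flip p u) p
  moveRaw (suc (suc (suc zero))) c@(raw v w u p) = raw v w u (across c)

  dot-across : ∀ c x → dot x (across c) ≡ (dot x (pt (Raw.v c)) +φ dot x (pt (Raw.w c)) +φ dot x (pt (Raw.u c))) +φ neg (dot x (Raw.p c))
  dot-across (raw v w u p) x = ≡.trans (dot-⊞ʳ x (pt v ⊞ pt w ⊞ pt u) (-1φ ⊡ p)) (cong₂ _+φ_
    (≡.trans (dot-⊞ʳ x (pt v ⊞ pt w) (pt u)) (cong (_+φ dot x (pt u)) (dot-⊞ʳ x (pt v) (pt w))))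
    (dot-antipode x p))

  module _ {c : Raw} (valid : Valid c) where
    open Raw c
    open Valid valid

    swap₀-valid : Valid (raw w v u p)
    swap₀-valid = record
      { triangle = record { vw = adjacent-sym vw ; vu = wu ; wu = vu }
      ; p∈ = p∈ ; v-on = w-on ; w-on = v-on ; u-on = u-on }

    swap₁-valid : Valid (raw v u w p)
    swap₁-valid = record
      { triangle = record { vw = vu ; vu = vw ; wu = adjacent-sym wu }
      ; p∈ = p∈ ; v-on = v-on ; w-on = u-on ; u-on = w-on }

    flip-adjacent : ∀ i → dot p (pt i) ≡ 2φ → Adjacent i u → Adjacent i (flip p u)
    flip-adjacent i i-on iu = ≡.trans (dot-flip (pt i) p∈ u-on)
      (cong₂ (λ a b → a +φ neg b) (≡.trans (dot-comm (pt i) p) i-on) iu)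

    flip-valid : Valid (raw v w (flip p u) p)
    flip-valid = record
      { triangle = record { vw = vw ; vu = flip-adjacent v v-on vu ; wu = flip-adjacent w w-on wu }
      ; p∈ = p∈ ; v-on = v-on ; w-on = w-on ; u-on = flip-on p∈ u-on }

    across∈ : across c ∈ normals
    across∈ = FacetFacts.across (facetFacts p∈) (on p v v-on) (on p w w-on) (on p u u-on) vw vu wu

    across-on : ∀ x → dot x (pt v) +φ dot x (pt w) +φ dot x (pt u) ≡ 2φ +φ 2φ → dot x p ≡ 2φ → dot (across c) x ≡ 2φ
    across-on x sum x-on = ≡.trans (dot-comm (across c) x)
      (≡.trans (dot-across c x) (cong₂ (λ a b → a +φ neg b) sum x-on))

    across-valid : Valid (raw v w u (across c))
    across-valid = record
      { triangle = triangle ; p∈ = across∈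
      ; v-on = across-on (pt v) (sum₃ (norm-pt v) vw vu) (≡.trans (dot-comm (pt v) p) v-on)
      ; w-on = across-on (pt w) (sum₃ (adjacent-sym vw) (norm-pt w) wu) (≡.trans (dot-comm (pt w) p) w-on)
      ; u-on = across-on (pt u) (sum₃ (adjacent-sym vu) (adjacent-sym wu) (norm-pt u)) (≡.trans (dot-comm (pt u) p) u-on) }
      where
      sum₃ : ∀ {a b c a′ b′ c′ : ℤ[φ]} → a ≡ a′ → b ≡ b′ → c ≡ c′ → a +φ b +φ c ≡ a′ +φ b′ +φ c′
      sum₃ ≡.refl ≡.refl ≡.refl = ≡.refl

    p·across : dot p (across c) ≡ 2φ
    p·across = ≡.trans (dot-across c p)
      (cong₂ (λ a b → a +φ neg b) (cong₂ _+φ_ (cong₂ _+φ_ v-on w-on) u-on) (FacetFacts.norm (facetFacts p∈)))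

    p≢across : p ≢ across c
    p≢across eq = 4≢2 (≡.trans (≡.sym (FacetFacts.norm (facetFacts p∈))) (≡.trans (cong (dot p) eq) p·across))
      where
      4≢2 : 2φ +φ 2φ ≢ 2φ
      4≢2 ()

    flip≢ : flip p u ≢ u
    flip≢ eq = 0≢R (≡.trans (≡.sym (dot-flip-self p∈ u-on)) (≡.trans (cong (λ i → dot (pt u) (pt i)) eq) (norm-pt u)))

    third-unique : ∀ u′ → dot p (pt u′) ≡ 2φ → Adjacent v u′ → Adjacent w u′ → u′ ≢ u → u′ ≡ flip p u
    third-unique u′ u′-on vu′ wu′ u′≢u =
      let t , t′ , _ , _ , sum , only = FacetFacts.third (facetFacts p∈) (on p v v-on) (on p w w-on) vw
      in lookup-injective (≡.trans (other t t′ sum (only (on p u u-on) vu wu) (only (on p u′ u′-on) vu′ wu′)) (≡.sym (pt-flip p∈ u-on)))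
      where
      other : ∀ t t′ → t ⊞ t′ ≡ p → pt u ≡ t ⊎ pt u ≡ t′ → pt u′ ≡ t ⊎ pt u′ ≡ t′ → pt u′ ≡ p ⊞ -1φ ⊡ pt u
      other t t′ sum (inj₁ u≡) (inj₁ u′≡) = ⊥-elim (u′≢u (lookup-injective (≡.trans u′≡ (≡.sym u≡))))
      other t t′ sum (inj₂ u≡) (inj₂ u′≡) = ⊥-elim (u′≢u (lookup-injective (≡.trans u′≡ (≡.sym u≡))))
      other t t′ sum (inj₁ u≡) (inj₂ u′≡) = ≡.trans u′≡ (≡.trans (≡.sym (⊞-cancel t t′))
        (cong₂ (λ p t → p ⊞ -1φ ⊡ t) sum (≡.sym u≡)))
      other t t′ sum (inj₂ u≡) (inj₁ u′≡) = ≡.trans u′≡ (≡.trans (≡.sym (⊞-cancel t′ t))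
        (cong₂ (λ p t → p ⊞ -1φ ⊡ t) (≡.trans (⊞-comm t′ t) sum) (≡.sym u≡)))

    -- The normals `p` and `across c` add up to the sum of the triangle, with which `q` has product
    -- 6. If `q` were a third normal, its products with these two would add up to at most 4.
    facet-unique : ∀ {q} → q ∈ normals → dot q (pt v) ≡ 2φ → dot q (pt w) ≡ 2φ → dot q (pt u) ≡ 2φ → q ≢ p → q ≡ across c
    facet-unique {q} q∈ qv qw qu q≢p with FacetFacts.others (facetFacts q∈) p∈ | FacetFacts.others (facetFacts q∈) across∈
    ... | inj₁ eq | _       = ⊥-elim (q≢p eq)
    ... | inj₂ _  | inj₁ eq = eq
    ... | inj₂ le | inj₂ le′ = ⊥-elim (-2≱0 (Pos⇒NonNegative (subst Pos total (Pos-+ le le′))))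
      where
      -2≱0 : ¬ NonNegative ((2φ +φ 2φ) -φ (2φ +φ 2φ +φ 2φ))
      -2≱0 ()
      split : ∀ a b → a +φ (b +φ neg a) ≡ b
      split = Solver.solve-∀ ring-φ
      total : (2φ -φ dot q p) +φ (2φ -φ dot q (across c)) ≡ (2φ +φ 2φ) -φ (2φ +φ 2φ +φ 2φ)
      total = ≡.trans (-φ-interchange 2φ (dot q p) 2φ (dot q (across c))) (cong ((2φ +φ 2φ) -φ_)
        (≡.trans (cong (dot q p +φ_) (dot-across c q)) (≡.trans (split (dot q p) _) (cong₂ _+φ_ (cong₂ _+φ_ qv qw) qu))))

  move-valid : ∀ i {c} → Valid c → Valid (moveRaw i c)
  move-valid zero                   = swap₀-valid
  move-valid (suc zero)             = swap₁-valid
  move-valid (suc (suc zero))       = flip-valid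
  move-valid (suc (suc (suc zero))) = across-valid

  move : Fin 4 → Code → Code
  move i (c , valid) = moveRaw i c , move-valid i valid

  move-differ : ∀ i c → DifferPreciselyAt (convexHull V) i (flagOf c) (flagOf (move i c))
  move-differ zero (raw v w u p , valid) =
      (λ eq → adjacent⇒≢ (Valid.vw valid) (insert-cancelˡ v∉⊥ eq))
    , λ { zero ne → ⊥-elim (ne ≡.refl) ; (suc zero) _ → insert-comm ⊥ v w
        ; (suc (suc zero)) _ → cong (_⊕ u) (insert-comm ⊥ v w) ; (suc (suc (suc zero))) _ → ≡.refl }
  move-differ (suc zero) (raw v w u p , valid) =
      (λ eq → adjacent⇒≢ (Valid.wu valid) (insert-cancelˡ (∉₁ (Valid.vw valid)) eq))
    , λ { zero _ → ≡.refl ; (suc zero) ne → ⊥-elim (ne ≡.refl)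
        ; (suc (suc zero)) _ → insert-comm (⊥ ⊕ v) w u ; (suc (suc (suc zero))) _ → ≡.refl }
  move-differ (suc (suc zero)) (raw v w u p , valid) =
      (λ eq → flip≢ valid (≡.sym (insert-cancelˡ (∉₂ (Valid.vu valid) (Valid.wu valid)) eq)))
    , λ { zero _ → ≡.refl ; (suc zero) _ → ≡.refl
        ; (suc (suc zero)) ne → ⊥-elim (ne ≡.refl) ; (suc (suc (suc zero))) _ → ≡.refl }
  move-differ (suc (suc (suc zero))) (c@(raw v w u p) , valid) =
      (λ eq → p≢across valid (oct-injective (Valid.p∈ valid) (across∈ valid) (v∈oct valid) (λ {x} → subst (x ∈ˢ_) eq)))
    , λ { zero _ → ≡.refl ; (suc zero) _ → ≡.refl ; (suc (suc zero)) _ → ≡.refl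
        ; (suc (suc (suc zero))) ne → ⊥-elim (ne ≡.refl) }

  oct-≡⇒≡ : ∀ {c d} → Valid c → Valid d → oct (Raw.p c) ≡ oct (Raw.p d) → Raw.p c ≡ Raw.p d
  oct-≡⇒≡ valid valid′ eq = oct-injective (Valid.p∈ valid) (Valid.p∈ valid′) (v∈oct valid) (λ {x} → subst (x ∈ˢ_) eq)

  -- In the lowest two ranks the shared next face leaves a single other vertex to choose. In the
  -- upper two, uniqueness comes from the octahedron and from the normals.
  changed-face : ∀ i {c d} → Valid c → Valid d → faces c i ≢ faces d i → (∀ j → j ≢ i → faces c j ≡ faces d j) →
    faces (moveRaw i c) i ≡ faces d i
  changed-face zero {raw v w u p} {raw v′ w′ u′ p′} valid valid′ ne agree =
    cong (⊥ ⊕_) ([ (λ v′∈ → ⊥-elim (ne (cong (⊥ ⊕_) (≡.sym ([ ⊥-elim ∘ v∉⊥ , id ]′ (∈-insert⁻ ⊥ v v′∈)))))) , ≡.sym ]′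
      (∈-insert⁻ (⊥ ⊕ v) w (subst (v′ ∈ˢ_) (≡.sym (agree (suc zero) λ ())) (∈-insertˡ w′ v∈₁))))
  changed-face (suc zero) {raw v w u p} {raw v′ w′ u′ p′} valid valid′ ne agree =
    cong₂ _⊕_ (agree zero λ ()) ([ (λ w′∈₂ → ⊥-elim ([ not-v , not-w ]′ (∈-insert⁻ (⊥ ⊕ v) w w′∈₂))) , ≡.sym ]′
      (∈-insert⁻ (⊥ ⊕ v ⊕ w) u (subst (w′ ∈ˢ_) (≡.sym (agree (suc (suc zero)) λ ())) w∈₃)))
    where
    not-v : w′ ∉ˢ ⊥ ⊕ v
    not-v w′∈ = ∉₁ (Valid.vw valid′) (subst (w′ ∈ˢ_) (agree zero λ ()) w′∈)
    not-w : w′ ≢ w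
    not-w eq = ne (≡.sym (cong₂ _⊕_ (≡.sym (agree zero λ ())) eq))
  changed-face (suc (suc zero)) {raw v w u p} {raw v′ w′ u′ p′} valid valid′ ne agree =
    cong₂ _⊕_ (agree (suc zero) λ ()) (≡.sym (third-unique valid u′
      (≡.trans (cong (λ p → dot p (pt u′)) p≡) (Valid.u-on valid′))
      (adjacent-to-u′ (∈-insertˡ w v∈₁)) (adjacent-to-u′ (∈-insertʳ (⊥ ⊕ v) w))
      λ eq → ne (≡.sym (cong₂ _⊕_ (≡.sym (agree (suc zero) λ ())) eq))))
    where
    p≡ : p ≡ p′
    p≡ = oct-≡⇒≡ valid valid′ (agree (suc (suc (suc zero))) λ ())
    adjacent-to-u′ : ∀ {i} → i ∈ˢ ⊥ ⊕ v ⊕ w → Adjacent i u′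
    adjacent-to-u′ {i} i∈ = adjacent-to₂ (Valid.vu valid′) (Valid.wu valid′) (subst (i ∈ˢ_) (agree (suc zero) λ ()) i∈)
  changed-face (suc (suc (suc zero))) {c@(raw v w u p)} {raw v′ w′ u′ p′} valid valid′ ne agree =
    cong oct (≡.sym (facet-unique valid (Valid.p∈ valid′) (on′ v∈₃) (on′ w∈₃) (on′ u∈₃) λ eq → ne (cong oct (≡.sym eq))))
    where
    on′ : ∀ {i} → i ∈ˢ ⊥ ⊕ v ⊕ w ⊕ u → dot p′ (pt i) ≡ 2φ
    on′ {i} i∈ = ∈-oct⁻ p′ i (proj₁ (triangle⊂oct valid′) (subst (i ∈ˢ_) (agree (suc (suc zero)) λ ()) i∈))

  move-unique : ∀ i c d → DifferPreciselyAt (convexHull V) i (flagOf c) (flagOf d) → flagOf (move i c) ≋ flagOf d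
  move-unique i c d (ne , agree) = pointwise λ j → by-cases j (j Fin.≟ i)
    where
    by-cases : ∀ j → Dec (j ≡ i) → faces (proj₁ (move i c)) j ≡ faces (proj₁ d) j
    by-cases j (yes ≡.refl) = changed-face i (proj₂ c) (proj₂ d) ne agree
    by-cases j (no  j≢i)    = ≡.trans (≡.sym (proj₂ (move-differ i c) j j≢i)) (agree j j≢i)

  open CodedFlags (convexHull V) flagOf codeOf move move-differ move-unique

  raw-≡ : ∀ {v w u p v′ w′ u′ p′} → v ≡ v′ → w ≡ w′ → u ≡ u′ → p ≡ p′ → raw v w u p ≡ raw v′ w′ u′ p′
  raw-≡ ≡.refl ≡.refl ≡.refl ≡.refl = ≡.refl

  flagOf-≡ : ∀ {c d} → proj₁ c ≡ proj₁ d → flagOf c ≋ flagOf d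
  flagOf-≡ eq = pointwise λ i → cong (λ c → faces c i) eq

  far-raw : ∀ i j → suc (suc (toℕ i)) ≤ toℕ j → ∀ c → moveRaw j (moveRaw i c) ≡ moveRaw i (moveRaw j c)
  far-raw zero       (suc (suc zero))       _ (raw v w u p) = ≡.refl
  far-raw zero       (suc (suc (suc zero))) _ (raw v w u p) =
    cong (λ s → raw w v u ((s ⊞ pt u) ⊞ -1φ ⊡ p)) (⊞-comm (pt w) (pt v))
  far-raw (suc zero) (suc (suc (suc zero))) _ (raw v w u p) = cong (λ s → raw v u w (s ⊞ -1φ ⊡ p))
    (≡.trans (⊞-assoc (pt v) (pt u) (pt w)) (≡.trans (cong (pt v ⊞_) (⊞-comm (pt u) (pt w))) (≡.sym (⊞-assoc (pt v) (pt w) (pt u)))))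
  far-raw zero       (suc zero) (s≤s ()) c
  far-raw (suc zero) (suc zero) (s≤s ()) c
  far-raw (suc zero) (suc (suc zero)) (s≤s (s≤s ())) c
  far-raw (suc (suc zero)) (suc zero) (s≤s ()) c
  far-raw (suc (suc zero)) (suc (suc zero)) (s≤s (s≤s ())) c
  far-raw (suc (suc zero)) (suc (suc (suc zero))) (s≤s (s≤s (s≤s ()))) c
  far-raw (suc (suc (suc zero))) (suc zero) (s≤s ()) c
  far-raw (suc (suc (suc zero))) (suc (suc zero)) (s≤s (s≤s ())) c
  far-raw (suc (suc (suc zero))) (suc (suc (suc zero))) (s≤s (s≤s (s≤s ()))) c

  label : ℕ → ℕ
  label k = if k ≡ᵇ 1 then 4 else 3

  private
    -- Three rounds of u ↦ p − u, p ↦ s + u − p.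
    third-u : ∀ {d} (s u p : Vec ℤ[φ] d) → let u₁ = p ⊞ -1φ ⊡ u; p₁ = (s ⊞ u₁) ⊞ -1φ ⊡ p; u₂ = p₁ ⊞ -1φ ⊡ u₁
                                               p₂ = (s ⊞ u₂) ⊞ -1φ ⊡ p₁ in p₂ ⊞ -1φ ⊡ u₂ ≡ u
    third-u []      []      []      = ≡.refl
    third-u (a ∷ s) (b ∷ u) (c ∷ p) = cong₂ _∷_ (lemma a b c) (third-u s u p)
      where
      lemma : ∀ s u p →
        (s +φ ((s +φ (p +φ -1φ *φ u) +φ -1φ *φ p) +φ -1φ *φ (p +φ -1φ *φ u)) +φ -1φ *φ (s +φ (p +φ -1φ *φ u) +φ -1φ *φ p))
        +φ -1φ *φ ((s +φ (p +φ -1φ *φ u) +φ -1φ *φ p) +φ -1φ *φ (p +φ -1φ *φ u)) ≡ u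
      lemma = Solver.solve-∀ ring-φ

    third-p : ∀ {d} (s u p : Vec ℤ[φ] d) → let u₁ = p ⊞ -1φ ⊡ u; p₁ = (s ⊞ u₁) ⊞ -1φ ⊡ p; u₂ = p₁ ⊞ -1φ ⊡ u₁
                                               p₂ = (s ⊞ u₂) ⊞ -1φ ⊡ p₁ in (s ⊞ u) ⊞ -1φ ⊡ p₂ ≡ p
    third-p []      []      []      = ≡.refl
    third-p (a ∷ s) (b ∷ u) (c ∷ p) = cong₂ _∷_ (lemma a b c) (third-p s u p)
      where
      lemma : ∀ s u p → (s +φ u) +φ -1φ *φ
        (s +φ ((s +φ (p +φ -1φ *φ u) +φ -1φ *φ p) +φ -1φ *φ (p +φ -1φ *φ u)) +φ -1φ *φ (s +φ (p +φ -1φ *φ u) +φ -1φ *φ p)) ≡ p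
      lemma = Solver.solve-∀ ring-φ

  -- Three facets meet at an edge. Since `flip` finds its vertex by a search, the three rounds are
  -- followed on the points themselves, where they are linear, and the indices are recovered at the
  -- end.
  edge₂₃ : ∀ c → Valid c → iterate (λ c → moveRaw (# 3) (moveRaw (# 2) c)) c 3 ≡ c
  edge₂₃ c@(raw v w u p) valid = raw-≡ ≡.refl ≡.refl u₃≡u p₃≡p
    where
    step : Raw → Raw
    step c = moveRaw (# 3) (moveRaw (# 2) c)
    step-valid : ∀ {c} → Valid c → Valid (step c)
    step-valid valid = across-valid (flip-valid valid)
    s : 𝕍
    s = pt v ⊞ pt w
    c₁ c₂ c₃ : Raw
    c₁ = step c
    c₂ = step c₁
    c₃ = step c₂
    u₁ p₁ u₂ p₂ : 𝕍
    u₁ = p ⊞ -1φ ⊡ pt u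
    p₁ = (s ⊞ u₁) ⊞ -1φ ⊡ p
    u₂ = p₁ ⊞ -1φ ⊡ u₁
    p₂ = (s ⊞ u₂) ⊞ -1φ ⊡ p₁
    pt-u : ∀ {c} → Valid c → pt (Raw.u (step c)) ≡ Raw.p c ⊞ -1φ ⊡ pt (Raw.u c)
    pt-u valid = pt-flip (Valid.p∈ valid) (Valid.u-on valid)
    u₁≡ : pt (Raw.u c₁) ≡ u₁
    u₁≡ = pt-u valid
    p₁≡ : Raw.p c₁ ≡ p₁
    p₁≡ = cong (λ x → (s ⊞ x) ⊞ -1φ ⊡ p) u₁≡
    u₂≡ : pt (Raw.u c₂) ≡ u₂
    u₂≡ = ≡.trans (pt-u (step-valid valid)) (cong₂ (λ p x → p ⊞ -1φ ⊡ x) p₁≡ u₁≡)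
    p₂≡ : Raw.p c₂ ≡ p₂
    p₂≡ = cong₂ (λ x p → (s ⊞ x) ⊞ -1φ ⊡ p) u₂≡ p₁≡
    u₃≡ : pt (Raw.u c₃) ≡ pt u
    u₃≡ = ≡.trans (pt-u (step-valid (step-valid valid)))
      (≡.trans (cong₂ (λ p x → p ⊞ -1φ ⊡ x) p₂≡ u₂≡) (third-u s (pt u) p))
    u₃≡u : Raw.u c₃ ≡ u
    u₃≡u = lookup-injective u₃≡
    p₃≡p : Raw.p c₃ ≡ p
    p₃≡p = ≡.trans (cong₂ (λ x p → (s ⊞ x) ⊞ -1φ ⊡ p) u₃≡ p₂≡) (third-p s (pt u) p)

  edge-raw : ∀ i j → toℕ j ≡ suc (toℕ i) → ∀ c → Valid c →
    iterate (λ c → moveRaw j (moveRaw i c)) c (label (toℕ i)) ≡ c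
  edge-raw zero             (suc zero)             _ (raw v w u p) valid = ≡.refl
  edge-raw (suc zero)       (suc (suc zero))       _ (raw v w u p) valid =
    raw-≡ ≡.refl (flip-involutive p∈ w-on) (flip-involutive p∈ u-on) ≡.refl
    where open Valid valid
  edge-raw (suc (suc zero)) (suc (suc (suc zero))) _ c valid = edge₂₃ c valid

  iterate-move : ∀ i j k c → proj₁ (iterate (λ d → move j (move i d)) c k)
                           ≡ iterate (λ c → moveRaw j (moveRaw i c)) (proj₁ c) k
  iterate-move i j zero    c = ≡.refl
  iterate-move i j (suc k) c = iterate-move i j k _

  -- The four moves in order take (v, w, u, p) to (w, u, v′, p′) with v′ = p - v and p′ = w + u + v′
  -- - p; the products with a fixed vector follow the same formulas.
  rotateProducts : Vec ℤ[φ] 4 → Vec ℤ[φ] 4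
  rotateProducts (a ∷ b ∷ c ∷ e ∷ []) = b ∷ c ∷ e +φ neg a ∷ (b +φ c +φ (e +φ neg a)) +φ neg e ∷ []

  module _ (x : 𝕍) where

    products : Code → Vec ℤ[φ] 4
    products (raw v w u p , _) = dot x (pt v) ∷ dot x (pt w) ∷ dot x (pt u) ∷ dot x p ∷ []

    products-rotate : ∀ c → products (rotate c) ≡ rotateProducts (products c)
    products-rotate (raw v w u p , valid) = cong₂ (λ a e → dot x (pt w) ∷ dot x (pt u) ∷ a ∷ e ∷ []) v′≡
      (≡.trans (dot-across (raw w u (flip p v) p) x) (cong (λ a → (dot x (pt w) +φ dot x (pt u) +φ a) +φ neg (dot x p)) v′≡))
      where
      v′≡ : dot x (pt (flip p v)) ≡ dot x p +φ neg (dot x (pt v))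
      v′≡ = dot-flip x (Valid.p∈ valid) (Valid.v-on valid)

    products-iterate : ∀ k c → products (iterate rotate c k) ≡ iterate rotateProducts (products c) k
    products-iterate zero    c = ≡.refl
    products-iterate (suc k) c = ≡.trans (products-iterate k (rotate c))
      (cong (λ D → iterate rotateProducts D k) (products-rotate c))

  initialProducts : Vec ℤ[φ] 4
  initialProducts = R₂₄ ∷ A₂₄ ∷ A₂₄ ∷ 2φ ∷ []

  products-initial : ∀ c → products (pt (Raw.v (proj₁ c))) c ≡ initialProducts
  products-initial (raw v w u p , valid) = cong₂ (λ a (b , c , e) → a ∷ b ∷ c ∷ e ∷ []) (norm-pt v)
    (cong₂ _,_ vw (cong₂ _,_ vu (≡.trans (dot-comm (pt v) p) v-on)))
    where open Valid valid

  aperiodic : ∀ c k → 0 < k → k < 12 → ¬ (flagOf (iterate rotate c k) ≋ flagOf c)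
  aperiodic c (suc k) _ (s≤s k<11) fixed = apart k<11 (begin
    head (iterate rotateProducts initialProducts (suc k))       ≡⟨ cong (λ D → head (iterate rotateProducts D (suc k))) (products-initial c) ⟨
    head (iterate rotateProducts (products v c) (suc k))        ≡⟨ cong head (products-iterate v (suc k) c) ⟨
    head (products v (iterate rotate c (suc k)))                ≡⟨ cong (λ i → dot v (pt i)) same-vertex ⟩
    dot v v                                                     ≡⟨ norm-pt (Raw.v (proj₁ c)) ⟩
    R₂₄                                                         ∎)
    where
    open ≡.≡-Reasoning
    v : 𝕍
    v = pt (Raw.v (proj₁ c))
    apart : ∀ {k} → k < 11 → head (iterate rotateProducts initialProducts (suc k)) ≢ R₂₄
    apart = toWitness {a? = ℕ.allUpTo? (λ k → ¬? (head (iterate rotateProducts initialProducts (suc k)) ≟φ R₂₄)) 11} _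
    same-vertex : Raw.v (proj₁ (iterate rotate c (suc k))) ≡ Raw.v (proj₁ c)
    same-vertex = insert-cancelˡ v∉⊥ (at fixed zero)

  octahedralLengths : Code → IsCoxeterNumber F₄-matrix 12 × ZigzagsHaveLength (convexHull V) 12
  octahedralLengths c₀ = lengths label
    (λ i j f (c , _) → flagOf-≡ (far-raw i j f c))
    (λ i j e c → flagOf-≡ (≡.trans (iterate-move i j (label (toℕ i)) c) (edge-raw i j e (proj₁ c) (proj₂ c))))
    12 z<s F₄-power c₀ aperiodic

module 24-cellZigzags where
  private
    R A : ℤ[φ]
    R = R₂₄
    A = A₂₄

    𝕍 : Set
    𝕍 = Vec ℤ[φ] 4

    V : List 𝕍
    V = 24-cellVertices

  -- The vertices of a dual 24-cell.
  normals : List 𝕍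
  normals =
    concatMap (λ x → (x ∷ 0φ ∷ 0φ ∷ 0φ ∷ []) ∷ (0φ ∷ x ∷ 0φ ∷ 0φ ∷ []) ∷
                     (0φ ∷ 0φ ∷ x ∷ 0φ ∷ []) ∷ (0φ ∷ 0φ ∷ 0φ ∷ x ∷ []) ∷ []) (± 2φ) ++
    concatMap (λ x → concatMap (λ y → concatMap (λ z → map (λ t →
      x ∷ y ∷ z ∷ t ∷ []) (± 1φ)) (± 1φ)) (± 1φ)) (± 1φ)

  -- At product -1 there is a single such neighbour and it equals x + y. For y = -x the eight
  -- neighbours sum to 4x = 7x + 3y, and 7 + 3 > 8.
  certificates : List Certificate
  certificates =
      certificate (-[1+ 0 ] ⊹ (+ 0) φ) ((+ 1) ⊹ (+ 0) φ)    ((+ 1) ⊹ (+ 0) φ) ((+ 1) ⊹ (+ 0) φ)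
    ∷ certificate (-[1+ 1 ] ⊹ (+ 0) φ) (-[1+ 0 ] ⊹ (+ 0) φ) ((+ 7) ⊹ (+ 0) φ) ((+ 3) ⊹ (+ 0) φ)
    ∷ []

  open PointChecks V R A certificates
  open SphericalPoints V A
  open DecMembership (_≟ᵛ_ {4}) using (_∈?_)

  open OctahedralFacts V normals

  PositionCheck : List 𝕍 → 𝕍 → 𝕍 → ℤ[φ] → Set
  PositionCheck nb x y xy = (xy ≡ 0φ × x ⊞ y ∈ normals) ⊎ PairCheck nb x y xy

  NoFourCheck : List 𝕍 → Set
  NoFourCheck nb = All (λ w → All (λ u → neighbours u (neighbours w nb) ≡ []) (neighbours w nb)) nb

  VertexCheck : 𝕍 → List 𝕍 → Set
  VertexCheck x nb = dot x x ≡ R × -1φ ⊡ x ∈ V × All (λ y → PositionCheck nb x y (dot x y)) V × NoFourCheck nb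

  vertexCheck? : ∀ x → Dec (VertexCheck x (neighbours x V))
  vertexCheck? x = go (neighbours x V)
    where
    null? : ∀ (L : List 𝕍) → Dec (L ≡ [])
    null? []      = yes ≡.refl
    null? (_ ∷ _) = no λ ()
    positionCheck? : ∀ nb y xy → Dec (PositionCheck nb x y xy)
    positionCheck? nb y xy = (xy ≟φ 0φ ×-dec (x ⊞ y) ∈? normals) ⊎-dec pairCheck? nb x y xy
    go : ∀ nb → Dec (VertexCheck x nb)
    go nb = dot x x ≟φ R ×-dec (-1φ ⊡ x) ∈? V ×-dec All.all? (λ y → positionCheck? nb y (dot x y)) V ×-dec
      All.all? (λ w → All.all? (λ u → null? (neighbours u (neighbours w nb))) (neighbours w nb)) nb

  ∈-neighbours : ∀ w {z} L → z ∈ L → dot w z ≡ A → z ∈ neighbours w L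
  ∈-neighbours w L z∈ adj = ∈ₗ.∈-filter⁺ (λ z → dot w z ≟φ A) z∈ adj

  neighbours-∈ : ∀ w {z} L → z ∈ neighbours w L → z ∈ L × dot w z ≡ A
  neighbours-∈ w L z∈ = ∈ₗ.∈-filter⁻ (λ z → dot w z ≟φ A) {xs = L} z∈

  vertexCheck⇒Facts : ∀ {x} → VertexCheck x (neighbours x V) → VertexFacts x
  vertexCheck⇒Facts {x} (norm , antipode , positions , no-four) = record
    { norm     = norm
    ; antipode = antipode
    ; position = λ y∈ → position (All.lookup positions y∈)
    ; no-four  = λ {w} {u} {t} w∈ u∈ t∈ xw xu wu xt wt ut →
        let nb = neighbours x V in
        absurd (subst (t ∈_)
          (All.lookup (All.lookup no-four (∈-neighbours x V w∈ xw)) (∈-neighbours w nb (∈-neighbours x V u∈ xu) wu))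
          (∈-neighbours u (neighbours w nb) (∈-neighbours w nb (∈-neighbours x V t∈ xt) wt) ut))
    }
    where
    absurd : ∀ {t : 𝕍} → t ∉ []
    absurd ()
    position : ∀ {y} → PositionCheck (neighbours x V) x y (dot x y) → Position x y
    position (inj₁ (perp , normal))    = orthogonal perp normal
    position (inj₂ (inj₁ eq))          = equal eq
    position (inj₂ (inj₂ (inj₁ adj)))  = adjacent adj
    position (inj₂ (inj₂ (inj₂ check))) = opposed (farCheck⇒Far antipode check)

  PairIs : 𝕍 → List 𝕍 → Set
  PairIs p (t ∷ t′ ∷ []) = t ⊞ t′ ≡ p
  PairIs p _             = Data.Empty.⊥

  pairIs? : ∀ p L → Dec (PairIs p L)
  pairIs? p []              = no λ ()
  pairIs? p (_ ∷ [])        = no λ ()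
  pairIs? p (t ∷ t′ ∷ [])   = (t ⊞ t′) ≟ᵛ p
  pairIs? p (_ ∷ _ ∷ _ ∷ _) = no λ ()

  FacetCheck : 𝕍 → List 𝕍 → Set
  FacetCheck p O =
      dot p p ≡ 2φ +φ 2φ
    × All (λ z → dot p z ≡ 2φ ⊎ (NonNegative (2φ -φ dot p z) ×
        Any (λ x → FarCheck (neighbours x V) x z (dot x z)) O)) V
    × Any (λ v → dot p v ≡ 2φ) V
    × All (λ v → Any (λ w → dot v w ≡ A) O) O
    × All (λ v → All (λ w → PairIs p (neighbours w (neighbours v O))) (neighbours v O)) O
    × All (λ v → All (λ w → All (λ u → (v ⊞ w ⊞ u) ⊞ -1φ ⊡ p ∈ normals) (neighbours w (neighbours v O))) (neighbours v O)) O
    × All (λ q → p ≡ q ⊎ NonNegative (2φ -φ dot p q)) normals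

  octahedron : 𝕍 → List 𝕍
  octahedron p = filter (λ z → dot p z ≟φ 2φ) V

  facetCheck? : ∀ p → Dec (FacetCheck p (octahedron p))
  facetCheck? p = go (octahedron p)
    where
    go : ∀ O → Dec (FacetCheck p O)
    go O =
      dot p p ≟φ (2φ +φ 2φ)
      ×-dec All.all? (λ z → dot p z ≟φ 2φ ⊎-dec nonNegative? (2φ -φ dot p z) ×-dec
        Any.any? (λ x → farCheck? (neighbours x V) x z (dot x z)) O) V
      ×-dec Any.any? (λ v → dot p v ≟φ 2φ) V
      ×-dec All.all? (λ v → Any.any? (λ w → dot v w ≟φ A) O) O
      ×-dec All.all? (λ v → All.all? (λ w → pairIs? p (neighbours w (neighbours v O))) (neighbours v O)) O
      ×-dec All.all? (λ v → All.all? (λ w → All.all? (λ u → ((v ⊞ w ⊞ u) ⊞ -1φ ⊡ p) ∈? normals)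
        (neighbours w (neighbours v O))) (neighbours v O)) O
      ×-dec All.all? (λ q → p ≟ᵛ q ⊎-dec nonNegative? (2φ -φ dot p q)) normals

  vertexFacts : ∀ {x} → x ∈ V → VertexFacts x
  vertexFacts x∈ = vertexCheck⇒Facts (All.lookup (toWitness {a? = All.all? vertexCheck? V} _) x∈)

  ∈-octahedron : ∀ p {z} → On p z → z ∈ octahedron p
  ∈-octahedron p (z∈ , eq) = ∈ₗ.∈-filter⁺ (λ z → dot p z ≟φ 2φ) z∈ eq

  octahedron-∈ : ∀ p {z} → z ∈ octahedron p → On p z
  octahedron-∈ p z∈ = ∈ₗ.∈-filter⁻ (λ z → dot p z ≟φ 2φ) {xs = V} z∈

  facetCheck⇒Facts : ∀ {p} → FacetCheck p (octahedron p) → FacetFacts p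
  facetCheck⇒Facts {p} (norm , outside , nonempty , side , third , across , others) = record
    { norm    = norm
    ; outside = λ {z} z∈ → Sum.map₂ (λ (le , check) → NonNegative⇒Pos (2φ -φ dot p z) le , witness check) (All.lookup outside z∈)
    ; nonempty = λ none → let _ , v∈ , eq = find nonempty in none v∈ eq
    ; side    = λ v → let w , w∈ , adj = find (All.lookup side (∈-octahedron p v)) in w , octahedron-∈ p w∈ , adj
    ; third   = λ {v} {w} v-on w-on vw → pair v w
        (All.lookup (All.lookup third (∈-octahedron p v-on)) (∈-neighbours v O (∈-octahedron p w-on) vw))
        (λ y∈ → let y∈v , wy = neighbours-∈ w (neighbours v O) y∈ ; y∈O , vy = neighbours-∈ v O y∈v in octahedron-∈ p y∈O , vy , wy)
        (λ y vy wy → ∈-neighbours w (neighbours v O) (∈-neighbours v O (∈-octahedron p y) vy) wy)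
    ; across  = λ {v} {w} v-on w-on u-on vw vu wu → All.lookup (All.lookup (All.lookup across (∈-octahedron p v-on))
        (∈-neighbours v O (∈-octahedron p w-on) vw)) (∈-neighbours w (neighbours v O) (∈-neighbours v O (∈-octahedron p u-on) vu) wu)
    ; others  = λ {q} q∈ → Sum.map₂ (NonNegative⇒Pos (2φ -φ dot p q)) (All.lookup others q∈)
    }
    where
    O : List 𝕍
    O = octahedron p
    witness : ∀ {z} → Any (λ x → FarCheck (neighbours x V) x z (dot x z)) O → ∃[ x ] On p x × Far x z
    witness checks = let x , x∈ , check = find checks ; on = octahedron-∈ p x∈ in
      x , on , farCheck⇒Far (VertexFacts.antipode (vertexFacts (proj₁ on))) check
    pair : ∀ v w {L} → PairIs p L → (∀ {y} → y ∈ L → On p y × dot v y ≡ A × dot w y ≡ A) →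
      (∀ {y} → On p y → dot v y ≡ A → dot w y ≡ A → y ∈ L) →
      ∃[ t ] ∃[ t′ ] (On p t × dot v t ≡ A × dot w t ≡ A) × (On p t′ × dot v t′ ≡ A × dot w t′ ≡ A) ×
      t ⊞ t′ ≡ p × (∀ {y} → On p y → dot v y ≡ A → dot w y ≡ A → y ≡ t ⊎ y ≡ t′)
    pair v w {t ∷ t′ ∷ []} sum to from =
      t , t′ , to (here ≡.refl) , to (there (here ≡.refl)) , sum , λ y vy wy → split (from y vy wy)
      where
      split : ∀ {y} → y ∈ t ∷ t′ ∷ [] → y ≡ t ⊎ y ≡ t′
      split (here eq)         = inj₁ eq
      split (there (here eq)) = inj₂ eq

  facetFacts : ∀ {p} → p ∈ normals → FacetFacts p
  facetFacts p∈ = facetCheck⇒Facts (All.lookup (toWitness {a? = All.all? facetCheck? normals} _) p∈)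

  vertices-distinct : Unique V
  vertices-distinct = toWitness {a? = DecUnique.unique? _≟ᵛ_ V} _

  open OctahedralComplex V normals (Unique⇒lookup-injective vertices-distinct) vertexFacts facetFacts zero

  zigzags : IsCoxeterNumber F₄-matrix 12 × ZigzagsHaveLength 24-cell 12
  -- The vertices are (1, 1, 0, 0), (1, 0, 1, 0) and (1, 0, 0, 1), on the facet whose first
  -- coordinate is 1.
  zigzags = octahedralLengths (raw (# 0) (# 1) (# 2) (2φ ∷ 0φ ∷ 0φ ∷ 0φ ∷ []) , record
    { triangle = record { vw = ≡.refl ; vu = ≡.refl ; wu = ≡.refl }
    ; p∈ = here ≡.refl ; v-on = ≡.refl ; w-on = ≡.refl ; u-on = ≡.refl })

corollary2 : ((n : ℕ) → .{{_ : NonZero n}} → IsCoxeterNumber (A-matrix n) (n + 1) × ZigzagsHaveLength (simplex n) (n + 1)) ×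
    ((n : ℕ) → .{{_ : NonZero n}} → IsCoxeterNumber (B-matrix n) (2 * n) × ZigzagsHaveLength (crossPolytope n) (2 * n)) ×
    (IsCoxeterNumber F₄-matrix 12 × ZigzagsHaveLength 24-cell 12) ×
    (IsCoxeterNumber H₃-matrix 10 × ZigzagsHaveLength icosahedron 10) ×
    (IsCoxeterNumber H₄-matrix 30 × ZigzagsHaveLength 600-cell 30)
corollary2 =
    simplex-zigzags
  , crossPolytope-zigzags
  , 24-cellZigzags.zigzags
  , IcosahedronZigzags.zigzags
  , 600-cellZigzags.zigzags
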